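{- Let $c<1$ be a constant and $p=p(n)=\frac{c}{n}$. Then $\mathbb{P}_{n,p}\big(G \text{ is realizable in } \mathbb{R}^2 \text{ as a distance graph}\big)\to 1$ as $n\to\infty$, where $G$ is the random graph $G(n,p)$.
   Context: $G(n,p)$ is the Erdős–Rényi random graph on $n$ labelled vertices in which each of the $\binom n2$ possible edges is present independently with probability $p$ ($p$ may depend on $n$); $\mathbb{P}_{n,p}$ is the corresponding probability. A distance graph in $\mathbb{R}^d$ is a finite graph $(V,E)$ with $V\subset\mathbb{R}^d$ finite and $E\subseteq\{\{\mathbf{x},\mathbf{y}\}\subseteq V: |\mathbf{x}-\mathbf{y}|=1\}$ (Euclidean norm). A graph is realizable in $\mathbb{R}^d$ as a distance graph if it is isomorphic to some distance graph in $\mathbb{R}^d$, i.e. its vertices can be mapped injectively to points of $\mathbb{R}^d$ so that every edge joins two points at Euclidean distance $1$. -}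

module Defs where

open import Data.Bool.Base using (if_then_else_)
open import Data.Empty using (⊥)
open import Data.Fin.Base using (Fin; zero; suc)
open import Data.Fin.Subset using (Subset; inside; outside; _∈_)
import Data.Integer.Base as ℤ
open import Data.List.Base as List using (List; []; _∷_; _++_)
open import Data.Nat.Base as ℕ using (ℕ; zero; suc; NonZero)
import Data.Nat.Properties as ℕ
open import Data.Product using (Σ; ∃; _×_; _,_; proj₁; proj₂)
open import Data.Rational.Base as ℚ using (ℚ; 0ℚ; 1ℚ; ½)
import Data.Rational.Properties as ℚ
open import Data.Rational.Solver using (module +-*-Solver)
open import Data.Sum.Base using (inj₁; inj₂)
open import Data.Vec.Base as Vec using ([]; _∷_)
open import Data.Vec.Functional as Vector using (Vector)
open import Function.Definitions using (Injective)
open import Level using (Level)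
open import Relation.Binary.PropositionalEquality
open import Relation.Nullary.Negation using (¬_)
open import Relation.Unary using (Pred; Decidable)

infix  4 _≈_ _<_ _≤_ _≋_ _⟶_
infixl 6 _+_ _-_
infixl 7 _*_ _/_
infix  8 -_

private
  variable
    ℓ : Level
    n d : ℕ

------------------------------------------------------------------------
-- Real numbers

IsCauchy : (ℕ → ℚ) → Set
IsCauchy x = ∀ ε → 0ℚ ℚ.< ε →
  ∃ λ N → ∀ m n → N ℕ.≤ m → N ℕ.≤ n → ℚ.∣ x m ℚ.- x n ∣ ℚ.< ε

record ℝ : Set where
  constructor mkℝ
  field
    seq    : ℕ → ℚ
    cauchy : IsCauchy seq

open ℝ public

-- Distinct Cauchy sequences may represent the same real number, so equality
-- of reals is _≈_ and never _≡_.

_≈_ : ℝ → ℝ → Set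
x ≈ y = ∀ ε → 0ℚ ℚ.< ε →
  ∃ λ N → ∀ n → N ℕ.≤ n → ℚ.∣ seq x n ℚ.- seq y n ∣ ℚ.< ε

_<_ : ℝ → ℝ → Set
x < y = ∃ λ δ → 0ℚ ℚ.< δ ×
  ∃ λ N → ∀ n → N ℕ.≤ n → seq x n ℚ.+ δ ℚ.< seq y n

_≤_ : ℝ → ℝ → Set
x ≤ y = ∀ ε → 0ℚ ℚ.< ε →
  ∃ λ N → ∀ n → N ℕ.≤ n → seq x n ℚ.< seq y n ℚ.+ ε

private
  abstract
    half-pos : ∀ {ε} → 0ℚ ℚ.< ε → 0ℚ ℚ.< ½ ℚ.* ε
    half-pos {ε} 0<ε = subst (ℚ._< ½ ℚ.* ε) (ℚ.*-zeroʳ ½) (ℚ.*-monoʳ-<-pos ½ 0<ε)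

    half+half : ∀ ε → ½ ℚ.* ε ℚ.+ ½ ℚ.* ε ≡ ε
    half+half ε = trans (sym (ℚ.*-distribʳ-+ ε ½ ½)) (ℚ.*-identityˡ ε)

    const-cauchy : ∀ q → IsCauchy (λ _ → q)
    const-cauchy q ε 0<ε = 0 , λ _ _ _ _ →
      subst (λ r → ℚ.∣ r ∣ ℚ.< ε) (sym (ℚ.+-inverseʳ q)) 0<ε

    +-cauchy : ∀ x y → IsCauchy x → IsCauchy y → IsCauchy (λ n → x n ℚ.+ y n)
    +-cauchy x y cx cy ε 0<ε
      with cx (½ ℚ.* ε) (half-pos 0<ε) | cy (½ ℚ.* ε) (half-pos 0<ε)
    ... | M , hx | N , hy = M ℕ.⊔ N , λ m n m≥ n≥ → begin-strict
      ℚ.∣ (x m ℚ.+ y m) ℚ.- (x n ℚ.+ y n) ∣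
        ≡⟨ cong ℚ.∣_∣ (rearrange (x m) (y m) (x n) (y n)) ⟩
      ℚ.∣ (x m ℚ.- x n) ℚ.+ (y m ℚ.- y n) ∣
        ≤⟨ ℚ.∣p+q∣≤∣p∣+∣q∣ (x m ℚ.- x n) (y m ℚ.- y n) ⟩
      ℚ.∣ x m ℚ.- x n ∣ ℚ.+ ℚ.∣ y m ℚ.- y n ∣
        <⟨ ℚ.+-mono-< (hx m n (ℕ.m⊔n≤o⇒m≤o M N m≥) (ℕ.m⊔n≤o⇒m≤o M N n≥))
                      (hy m n (ℕ.m⊔n≤o⇒n≤o M N m≥) (ℕ.m⊔n≤o⇒n≤o M N n≥)) ⟩
      ½ ℚ.* ε ℚ.+ ½ ℚ.* ε
        ≡⟨ half+half ε ⟩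
      ε ∎
      where
      open ℚ.≤-Reasoning
      rearrange : ∀ a b c d →
        (a ℚ.+ b) ℚ.- (c ℚ.+ d) ≡ (a ℚ.- c) ℚ.+ (b ℚ.- d)
      rearrange = solve 4 (λ a b c d →
        (a :+ b) :- (c :+ d) := (a :- c) :+ (b :- d)) refl
        where open +-*-Solver

    neg-cauchy : ∀ x → IsCauchy x → IsCauchy (λ n → ℚ.- x n)
    neg-cauchy x cx ε 0<ε with cx ε 0<ε
    ... | N , hx = N , λ m n m≥ n≥ → subst (ℚ._< ε)
      (trans (sym (ℚ.∣-p∣≡∣p∣ (x m ℚ.- x n)))
             (cong ℚ.∣_∣ (ℚ.neg-distrib-+ (x m) (ℚ.- x n))))
      (hx m n m≥ n≥)

    ∣p∣-∣q∣≤∣p-q∣ : ∀ p q → ℚ.∣ p ∣ ℚ.- ℚ.∣ q ∣ ℚ.≤ ℚ.∣ p ℚ.- q ∣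
    ∣p∣-∣q∣≤∣p-q∣ p q = begin
      ℚ.∣ p ∣ ℚ.- ℚ.∣ q ∣
        ≡⟨ cong (λ r → ℚ.∣ r ∣ ℚ.- ℚ.∣ q ∣) (split p q) ⟩
      ℚ.∣ (p ℚ.- q) ℚ.+ q ∣ ℚ.- ℚ.∣ q ∣
        ≤⟨ ℚ.+-monoˡ-≤ (ℚ.- ℚ.∣ q ∣) (ℚ.∣p+q∣≤∣p∣+∣q∣ (p ℚ.- q) q) ⟩
      (ℚ.∣ p ℚ.- q ∣ ℚ.+ ℚ.∣ q ∣) ℚ.- ℚ.∣ q ∣
        ≡⟨ cancel ℚ.∣ p ℚ.- q ∣ ℚ.∣ q ∣ ⟩
      ℚ.∣ p ℚ.- q ∣ ∎
      where
      open ℚ.≤-Reasoning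
      open +-*-Solver
      split : ∀ p q → p ≡ (p ℚ.- q) ℚ.+ q
      split = solve 2 (λ p q → p := (p :- q) :+ q) refl
      cancel : ∀ a b → (a ℚ.+ b) ℚ.- b ≡ a
      cancel = solve 2 (λ a b → (a :+ b) :- b := a) refl

    ∣∣p∣-∣q∣∣≤∣p-q∣ : ∀ p q → ℚ.∣ ℚ.∣ p ∣ ℚ.- ℚ.∣ q ∣ ∣ ℚ.≤ ℚ.∣ p ℚ.- q ∣
    ∣∣p∣-∣q∣∣≤∣p-q∣ p q with ℚ.∣p∣≡p∨∣p∣≡-p (ℚ.∣ p ∣ ℚ.- ℚ.∣ q ∣)
    ... | inj₁ eq = ℚ.≤-trans (ℚ.≤-reflexive eq) (∣p∣-∣q∣≤∣p-q∣ p q)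
    ... | inj₂ eq = begin
      ℚ.∣ ℚ.∣ p ∣ ℚ.- ℚ.∣ q ∣ ∣  ≡⟨ eq ⟩
      ℚ.- (ℚ.∣ p ∣ ℚ.- ℚ.∣ q ∣)  ≡⟨ swap ℚ.∣ p ∣ ℚ.∣ q ∣ ⟩
      ℚ.∣ q ∣ ℚ.- ℚ.∣ p ∣        ≤⟨ ∣p∣-∣q∣≤∣p-q∣ q p ⟩
      ℚ.∣ q ℚ.- p ∣              ≡⟨ sym (ℚ.∣-p∣≡∣p∣ (q ℚ.- p)) ⟩
      ℚ.∣ ℚ.- (q ℚ.- p) ∣        ≡⟨ cong ℚ.∣_∣ (swap q p) ⟩
      ℚ.∣ p ℚ.- q ∣              ∎
      where
      open ℚ.≤-Reasoning
      open +-*-Solver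
      swap : ∀ a b → ℚ.- (a ℚ.- b) ≡ b ℚ.- a
      swap = solve 2 (λ a b → :- (a :- b) := b :- a) refl

    abs-cauchy : ∀ x → IsCauchy x → IsCauchy (λ n → ℚ.∣ x n ∣)
    abs-cauchy x cx ε 0<ε with cx ε 0<ε
    ... | N , hx = N , λ m n m≥ n≥ →
      ℚ.≤-<-trans (∣∣p∣-∣q∣∣≤∣p-q∣ (x m) (x n)) (hx m n m≥ n≥)

    bounded : ∀ x → IsCauchy x →
      ∃ λ B → 0ℚ ℚ.< B × ∃ λ N → ∀ n → N ℕ.≤ n → ℚ.∣ x n ∣ ℚ.< B
    bounded x cx with cx 1ℚ (ℚ.positive⁻¹ 1ℚ)
    ... | N , hx = 1ℚ ℚ.+ ℚ.∣ x N ∣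
      , ℚ.+-mono-<-≤ {0ℚ} {1ℚ} {0ℚ} {ℚ.∣ x N ∣} (ℚ.positive⁻¹ 1ℚ) (ℚ.0≤∣p∣ (x N))
      , N , λ n n≥ → begin-strict
        ℚ.∣ x n ∣                          ≡⟨ cong ℚ.∣_∣ (split (x n) (x N)) ⟩
        ℚ.∣ (x n ℚ.- x N) ℚ.+ x N ∣        ≤⟨ ℚ.∣p+q∣≤∣p∣+∣q∣ (x n ℚ.- x N) (x N) ⟩
        ℚ.∣ x n ℚ.- x N ∣ ℚ.+ ℚ.∣ x N ∣    <⟨ ℚ.+-monoˡ-< ℚ.∣ x N ∣ (hx n N n≥ ℕ.≤-refl) ⟩
        1ℚ ℚ.+ ℚ.∣ x N ∣                   ∎
      where
      open ℚ.≤-Reasoning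
      split : ∀ p q → p ≡ (p ℚ.- q) ℚ.+ q
      split = solve 2 (λ p q → p := (p :- q) :+ q) refl
        where open +-*-Solver

    product< : ∀ {D δ} p q → 0ℚ ℚ.< D → ℚ.∣ p ∣ ℚ.< D → ℚ.∣ q ∣ ℚ.< δ →
      ℚ.∣ p ℚ.* q ∣ ℚ.< D ℚ.* δ
    product< {D} {δ} p q 0<D p<D q<δ = begin-strict
      ℚ.∣ p ℚ.* q ∣        ≡⟨ ℚ.∣p*q∣≡∣p∣*∣q∣ p q ⟩
      ℚ.∣ p ∣ ℚ.* ℚ.∣ q ∣  ≤⟨ ℚ.*-monoʳ-≤-nonNeg ℚ.∣ q ∣
                                {{ℚ.nonNegative (ℚ.0≤∣p∣ q)}} (ℚ.<⇒≤ p<D) ⟩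
      D ℚ.* ℚ.∣ q ∣        <⟨ ℚ.*-monoʳ-<-pos D {{ℚ.positive 0<D}} q<δ ⟩
      D ℚ.* δ              ∎
      where open ℚ.≤-Reasoning

    product-diff< : ∀ {B C δ} a b c d → 0ℚ ℚ.< B → 0ℚ ℚ.< C →
      ℚ.∣ a ∣ ℚ.< B → ℚ.∣ d ∣ ℚ.< C →
      ℚ.∣ b ℚ.- d ∣ ℚ.< δ → ℚ.∣ a ℚ.- c ∣ ℚ.< δ →
      ℚ.∣ a ℚ.* b ℚ.- c ℚ.* d ∣ ℚ.< (B ℚ.+ C) ℚ.* δ
    product-diff< {B} {C} {δ} a b c d 0<B 0<C a<B d<C bd ac = begin-strict
      ℚ.∣ a ℚ.* b ℚ.- c ℚ.* d ∣
        ≡⟨ cong ℚ.∣_∣ (rearrange a b c d) ⟩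
      ℚ.∣ a ℚ.* (b ℚ.- d) ℚ.+ d ℚ.* (a ℚ.- c) ∣
        ≤⟨ ℚ.∣p+q∣≤∣p∣+∣q∣ (a ℚ.* (b ℚ.- d)) (d ℚ.* (a ℚ.- c)) ⟩
      ℚ.∣ a ℚ.* (b ℚ.- d) ∣ ℚ.+ ℚ.∣ d ℚ.* (a ℚ.- c) ∣
        <⟨ ℚ.+-mono-< (product< a (b ℚ.- d) 0<B a<B bd)
                      (product< d (a ℚ.- c) 0<C d<C ac) ⟩
      B ℚ.* δ ℚ.+ C ℚ.* δ
        ≡⟨ sym (ℚ.*-distribʳ-+ δ B C) ⟩
      (B ℚ.+ C) ℚ.* δ ∎
      where
      open ℚ.≤-Reasoning
      rearrange : ∀ a b c d → a ℚ.* b ℚ.- c ℚ.* d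
                            ≡ a ℚ.* (b ℚ.- d) ℚ.+ d ℚ.* (a ℚ.- c)
      rearrange = solve 4 (λ a b c d →
        a :* b :- c :* d := a :* (b :- d) :+ d :* (a :- c)) refl
        where open +-*-Solver

    divide-pos : ∀ D ε → 0ℚ ℚ.< D → 0ℚ ℚ.< ε →
      ∃ λ δ → 0ℚ ℚ.< δ × D ℚ.* δ ≡ ε
    divide-pos D ε 0<D 0<ε = D⁻¹ ℚ.* ε
      , subst (ℚ._< D⁻¹ ℚ.* ε) (ℚ.*-zeroʳ D⁻¹)
          (ℚ.*-monoʳ-<-pos D⁻¹ {{ℚ.1/pos⇒pos D}} 0<ε)
      , trans (sym (ℚ.*-assoc D D⁻¹ ε))
          (trans (cong (ℚ._* ε) (ℚ.*-inverseʳ D)) (ℚ.*-identityˡ ε))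
      where
      instance
        D-pos : ℚ.Positive D
        D-pos = ℚ.positive 0<D
        D≢0 : ℚ.NonZero D
        D≢0 = ℚ.pos⇒nonZero D
      D⁻¹ : ℚ
      D⁻¹ = ℚ.1/ D

    *-cauchy : ∀ x y → IsCauchy x → IsCauchy y → IsCauchy (λ n → x n ℚ.* y n)
    *-cauchy x y cx cy ε 0<ε =
      let B , 0<B , K , bx = bounded x cx
          C , 0<C , L , by = bounded y cy
          0<B+C = ℚ.positive⁻¹ (B ℚ.+ C)
            {{ℚ.pos+pos⇒pos B {{ℚ.positive 0<B}} C {{ℚ.positive 0<C}}}}
          δ , 0<δ , eq = divide-pos (B ℚ.+ C) ε 0<B+C 0<ε
          P , hx = cx δ 0<δ
          Q , hy = cy δ 0<δ
      in combine B C δ 0<B 0<C eq K L P Q bx by hx hy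
      where
      combine : ∀ B C δ → 0ℚ ℚ.< B → 0ℚ ℚ.< C → (B ℚ.+ C) ℚ.* δ ≡ ε →
        ∀ K L P Q →
        (∀ n → K ℕ.≤ n → ℚ.∣ x n ∣ ℚ.< B) →
        (∀ n → L ℕ.≤ n → ℚ.∣ y n ∣ ℚ.< C) →
        (∀ m n → P ℕ.≤ m → P ℕ.≤ n → ℚ.∣ x m ℚ.- x n ∣ ℚ.< δ) →
        (∀ m n → Q ℕ.≤ m → Q ℕ.≤ n → ℚ.∣ y m ℚ.- y n ∣ ℚ.< δ) →
        ∃ λ N → ∀ m n → N ℕ.≤ m → N ℕ.≤ n →
          ℚ.∣ x m ℚ.* y m ℚ.- x n ℚ.* y n ∣ ℚ.< ε
      combine B C δ 0<B 0<C refl K L P Q bx by hx hy =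
        (K ℕ.⊔ L) ℕ.⊔ (P ℕ.⊔ Q) , λ m n m≥ n≥ →
          product-diff< (x m) (y m) (x n) (y n) 0<B 0<C
            (bx m (≤K m≥)) (by n (≤L n≥))
            (hy m n (≤Q m≥) (≤Q n≥)) (hx m n (≤P m≥) (≤P n≥))
        where
        ≤K : ∀ {m} → (K ℕ.⊔ L) ℕ.⊔ (P ℕ.⊔ Q) ℕ.≤ m → K ℕ.≤ m
        ≤K h = ℕ.m⊔n≤o⇒m≤o K L (ℕ.m⊔n≤o⇒m≤o (K ℕ.⊔ L) (P ℕ.⊔ Q) h)
        ≤L : ∀ {m} → (K ℕ.⊔ L) ℕ.⊔ (P ℕ.⊔ Q) ℕ.≤ m → L ℕ.≤ m
        ≤L h = ℕ.m⊔n≤o⇒n≤o K L (ℕ.m⊔n≤o⇒m≤o (K ℕ.⊔ L) (P ℕ.⊔ Q) h)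
        ≤P : ∀ {m} → (K ℕ.⊔ L) ℕ.⊔ (P ℕ.⊔ Q) ℕ.≤ m → P ℕ.≤ m
        ≤P h = ℕ.m⊔n≤o⇒m≤o P Q (ℕ.m⊔n≤o⇒n≤o (K ℕ.⊔ L) (P ℕ.⊔ Q) h)
        ≤Q : ∀ {m} → (K ℕ.⊔ L) ℕ.⊔ (P ℕ.⊔ Q) ℕ.≤ m → Q ℕ.≤ m
        ≤Q h = ℕ.m⊔n≤o⇒n≤o P Q (ℕ.m⊔n≤o⇒n≤o (K ℕ.⊔ L) (P ℕ.⊔ Q) h)

fromℚ : ℚ → ℝ
fromℚ q = mkℝ (λ _ → q) (const-cauchy q)

0ℝ 1ℝ : ℝ
0ℝ = fromℚ 0ℚ
1ℝ = fromℚ 1ℚ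

_+_ : ℝ → ℝ → ℝ
x + y = mkℝ (λ n → seq x n ℚ.+ seq y n)
            (+-cauchy (seq x) (seq y) (cauchy x) (cauchy y))

_*_ : ℝ → ℝ → ℝ
x * y = mkℝ (λ n → seq x n ℚ.* seq y n)
            (*-cauchy (seq x) (seq y) (cauchy x) (cauchy y))

-_ : ℝ → ℝ
- x = mkℝ (λ n → ℚ.- seq x n) (neg-cauchy (seq x) (cauchy x))

_-_ : ℝ → ℝ → ℝ
x - y = x + (- y)

∣_∣ : ℝ → ℝ
∣ x ∣ = mkℝ (λ n → ℚ.∣ seq x n ∣) (abs-cauchy (seq x) (cauchy x))

_/_ : ℝ → (n : ℕ) .{{_ : NonZero n}} → ℝ
x / n = x * fromℚ (ℤ.+ 1 ℚ./ n)

_⟶_ : ((n : ℕ) .{{_ : NonZero n}} → ℝ) → ℝ → Set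
u ⟶ a = ∀ ε → 0ℝ < ε →
  ∃ λ N → ∀ n .{{_ : NonZero n}} → N ℕ.≤ n → ∣ u n - a ∣ < ε

------------------------------------------------------------------------
-- Euclidean space

ℝ^_ : ℕ → Set
ℝ^ d = Vector ℝ d

_≋_ : ℝ^ d → ℝ^ d → Set
x ≋ y = ∀ i → x i ≈ y i

-- Distance x y r says that r is the nonnegative square root of the sum of
-- the squared coordinate differences, i.e. ‖ x - y ‖ = r.

Distance : ℝ^ d → ℝ^ d → ℝ → Set
Distance x y r = 0ℝ ≤ r × r * r ≈ Vector.foldr _+_ 0ℝ (λ i → (x i - y i) * (x i - y i))

------------------------------------------------------------------------
-- Labelled simple graphs on the vertex set Fin n

-- In N ∷ G the vertex zero is joined to the vertices suc i with i ∈ N, and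
-- G is the graph induced on the vertices suc i.  Each simple graph on Fin n
-- is thereby represented exactly once.

data Graph : ℕ → Set where
  []  : Graph 0
  _∷_ : Subset n → Graph n → Graph (suc n)

Adjacent : Graph n → Fin n → Fin n → Set
Adjacent (N ∷ G) zero    zero    = ⊥
Adjacent (N ∷ G) zero    (suc j) = j ∈ N
Adjacent (N ∷ G) (suc i) zero    = i ∈ N
Adjacent (N ∷ G) (suc i) (suc j) = Adjacent G i j

Adjacent-sym : (G : Graph n) → ∀ i j → Adjacent G i j → Adjacent G j i
Adjacent-sym (N ∷ G) zero    (suc j) a = a
Adjacent-sym (N ∷ G) (suc i) zero    a = a
Adjacent-sym (N ∷ G) (suc i) (suc j) a = Adjacent-sym G i j a

Adjacent-irrefl : (G : Graph n) → ∀ i → ¬ Adjacent G i i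
Adjacent-irrefl (N ∷ G) (suc i) a = Adjacent-irrefl G i a

Realizable : (d : ℕ) → Graph n → Set
Realizable {n} d G = Σ (Fin n → ℝ^ d) λ f →
  Injective _≡_ _≋_ f × (∀ i j → Adjacent G i j → Distance (f i) (f j) 1ℝ)

------------------------------------------------------------------------
-- The random graph G(n,p)

subsets : ∀ n → List (Subset n)
subsets zero    = [] ∷ []
subsets (suc n) =
  List.map (outside ∷_) (subsets n) ++ List.map (inside ∷_) (subsets n)

graphs : ∀ n → List (Graph n)
graphs zero    = [] ∷ []
graphs (suc n) = List.cartesianProductWith _∷_ (subsets n) (graphs n)

-- The product over all pairs of vertices of p (edge) or 1 - p (non-edge).

weight : ℝ → Graph n → ℝ
weight p []      = 1ℝ
weight p (N ∷ G) =
  Vec.foldr′ (λ edge w → (if edge then p else 1ℝ - p) * w) (weight p G) N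

-- A real-valued probability can be formed only for a decidable event.  The
-- value does not depend on the choice of decision procedure.

ℙ : (n : ℕ) (p : ℝ) {A : Pred (Graph n) ℓ} → Decidable A → ℝ
ℙ n p A? =
  List.foldr _+_ 0ℝ (List.map (weight p) (List.filter A? (graphs n)))

{-# OPTIONS --safe #-}
-- Call a path, together with one further edge from each of its two ends back into the path,
-- an obstruction: k vertices and k + 1 edges.
--
-- A graph without obstructions is drawn by induction on its set of vertices.  A vertex with
-- at most one neighbour is placed last, on the unit circle around that neighbour, away from
-- the finitely many points in use.  If every vertex has two neighbours, growing a path greedily
-- closes up a cycle, and any further edge at that cycle could be grown into an obstruction; so
-- the cycle is isolated and can be drawn as a polygon beside everything else.  All points are
-- (a + b √3 / 2 , y) with a, b, y rational, so that equality of points is decidable.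
--
-- There are at most nᵏ k² obstructions with k vertices, each contained in G(n, c/n) with
-- probability (c/n)ᵏ⁺¹, and the sum of k² cᵏ converges for c < 1; hence the probability of an
-- obstruction is O(1/n).

module Submission where

open import Defs
open import Data.Bool.Base using (Bool; true; false; if_then_else_)
open import Data.Empty using (⊥)
open import Data.Fin.Base using (Fin; zero; suc; toℕ)
import Data.Fin.Properties as Fin
open import Data.Fin.Subset as Subset using (Subset; inside; outside)
import Data.Fin.Subset.Properties as Subset
open import Data.List.Base as List using (List; []; _∷_; _++_; _∷ʳ_; length)
import Data.List.Properties as List
open import Data.List.Membership.Propositional using (_∈_; _∉_; find; lose)
import Data.List.Membership.Propositional.Properties as Mem
import Data.List.Membership.DecPropositional as DecMem
open import Data.List.Relation.Unary.All as All using (All; []; _∷_)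
import Data.List.Relation.Unary.All.Properties as All
open import Data.List.Relation.Unary.AllPairs using (AllPairs; []; _∷_)
open import Data.List.Relation.Unary.Any as Any using (Any; here; there)
import Data.List.Relation.Unary.Any.Properties as Any
open import Data.List.Relation.Unary.Unique.Propositional using (Unique)
import Data.List.Relation.Unary.Unique.Propositional.Properties as Unique
import Data.Integer.Base as ℤ
import Data.Integer.Properties as ℤ
import Data.Nat.Coprimality as Coprime
open import Data.Nat.Divisibility using (_∣_; divides)
open import Data.Nat.Primality using (Prime; prime?; euclidsLemma)
import Data.Nat.Solver as ℕSolver
open import Data.Nat.Induction using (<-wellFounded)
open import Data.Nat.Base as ℕ using (ℕ; zero; suc; NonZero; z≤n; s≤s)
import Data.Nat.Properties as ℕ
open import Data.Product using (∃; ∃₂; _×_; _,_; proj₁; proj₂; uncurry)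
open import Data.Rational.Base as ℚ using (ℚ; 0ℚ; 1ℚ; ½)
import Data.Rational.Properties as ℚ
import Data.Rational.Unnormalised.Base as ℚᵘ
import Data.Rational.Unnormalised.Properties as ℚᵘ
open import Data.Rational.Solver using (module +-*-Solver)
open import Data.Sum.Base as Sum using (_⊎_; inj₁; inj₂)
open import Data.Unit.Base using (⊤; tt)
open import Data.Vec.Base as Vec using ([]; _∷_)
open import Function.Base using (_∘_; id; case_of_)
open import Induction.WellFounded using (Acc; acc)
open import Function.Definitions using (Injective)
open import Level using (Level)
open import Relation.Binary.Definitions using (DecidableEquality; Tri; tri<; tri≈; tri>)
open import Relation.Binary.PropositionalEquality
open import Relation.Nullary using (¬_; Dec; yes; no; contradiction)
open import Relation.Nullary.Decidable using (from-yes; map′; _×-dec_; _→-dec_; _⊎-dec_; ¬?)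
open import Relation.Unary using (Pred; Decidable)

-- `ℙ` is formed from a decision procedure that comes as a hypothesis, so no appeal to excluded
-- middle is made: every graph has to yield either an actual drawing or an actual obstruction. Hence
-- all case distinctions are finite searches, and new points must be separated from the points in
-- use by a decidable test. Rational coordinates alone would be too few: the unit-distance graph of
-- the rational plane is bipartite, so it contains no odd cycle. One equilateral triangle per odd
-- cycle repairs this, which is where √3 / 2 enters. Paths chorded at both ends cover in one family
-- every minimal way to have more edges than vertices: two disjoint cycles joined by a path, two
-- cycles meeting in a vertex, and two cycles sharing a path. One family means one count. Reals are
-- Cauchy sequences with termwise operations, so the estimate is carried out for rational
-- approximations q of c. It must be uniform in q, which is why a fixed margin δ with q + δ ≤ 1
-- replaces the gap 1 - q.

private
  variable
    ℓ : Level
    A B : Set ℓ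
    n : ℕ

-- Rational arithmetic and finite sums

p≤q⇒0≤q-p : ∀ {p q} → p ℚ.≤ q → 0ℚ ℚ.≤ q ℚ.- p
p≤q⇒0≤q-p {p} {q} p≤q =
  ℚ.≤-trans (ℚ.≤-reflexive (sym (ℚ.+-inverseʳ p))) (ℚ.+-monoˡ-≤ (ℚ.- p) p≤q)

0≤q-p⇒p≤q : ∀ {p q} → 0ℚ ℚ.≤ q ℚ.- p → p ℚ.≤ q
0≤q-p⇒p≤q {p} {q} 0≤q-p = begin
  p                  ≡⟨ sym (ℚ.+-identityʳ p) ⟩
  p ℚ.+ 0ℚ           ≤⟨ ℚ.+-monoʳ-≤ p 0≤q-p ⟩
  p ℚ.+ (q ℚ.- p)    ≡⟨ cancel p q ⟩
  q                  ∎
  where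
  open ℚ.≤-Reasoning
  cancel : ∀ p q → p ℚ.+ (q ℚ.- p) ≡ q
  cancel = solve 2 (λ p q → p :+ (q :- p) := q) refl
    where open +-*-Solver

*-mono-≤ʳ : ∀ r {p q} → 0ℚ ℚ.≤ r → p ℚ.≤ q → r ℚ.* p ℚ.≤ r ℚ.* q
*-mono-≤ʳ r 0≤r = ℚ.*-monoˡ-≤-nonNeg r {{ℚ.nonNegative 0≤r}}

*-mono-≤ˡ : ∀ r {p q} → 0ℚ ℚ.≤ r → p ℚ.≤ q → p ℚ.* r ℚ.≤ q ℚ.* r
*-mono-≤ˡ r 0≤r = ℚ.*-monoʳ-≤-nonNeg r {{ℚ.nonNegative 0≤r}}

0≤* : ∀ {p q} → 0ℚ ℚ.≤ p → 0ℚ ℚ.≤ q → 0ℚ ℚ.≤ p ℚ.* q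
0≤* {p} {q} 0≤p 0≤q =
  ℚ.≤-trans (ℚ.≤-reflexive (sym (ℚ.*-zeroʳ p))) (*-mono-≤ʳ p 0≤p 0≤q)

0<* : ∀ {p q} → 0ℚ ℚ.< p → 0ℚ ℚ.< q → 0ℚ ℚ.< p ℚ.* q
0<* {p} {q} 0<p 0<q =
  ℚ.≤-<-trans (ℚ.≤-reflexive (sym (ℚ.*-zeroʳ p))) (ℚ.*-monoʳ-<-pos p {{ℚ.positive 0<p}} 0<q)

0≤+ : ∀ {p q} → 0ℚ ℚ.≤ p → 0ℚ ℚ.≤ q → 0ℚ ℚ.≤ p ℚ.+ q
0≤+ = ℚ.+-mono-≤ {0ℚ} {_} {0ℚ} {_}

0≤1 : 0ℚ ℚ.≤ 1ℚ
0≤1 = ℚ.nonNegative⁻¹ 1ℚ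

0<1 : 0ℚ ℚ.< 1ℚ
0<1 = ℚ.positive⁻¹ 1ℚ

∣∣<-intro : ∀ {p ε} → p ℚ.< ε → ℚ.- p ℚ.< ε → ℚ.∣ p ∣ ℚ.< ε
∣∣<-intro {p} p<ε -p<ε with ℚ.∣p∣≡p∨∣p∣≡-p p
... | inj₁ eq = subst (ℚ._< _) (sym eq) p<ε
... | inj₂ eq = subst (ℚ._< _) (sym eq) -p<ε

-- Built by adding `1ℚ` rather than as a normalised fraction, so that its arithmetic laws go by
-- induction; `toℚᵘ-fromℕ` reconnects it with fractions.
fromℕ : ℕ → ℚ
fromℕ zero    = 0ℚ
fromℕ (suc n) = 1ℚ ℚ.+ fromℕ n

fromℕ-nonNeg : ∀ n → 0ℚ ℚ.≤ fromℕ n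
fromℕ-nonNeg zero    = ℚ.≤-refl
fromℕ-nonNeg (suc n) = 0≤+ 0≤1 (fromℕ-nonNeg n)

fromℕ-+ : ∀ m n → fromℕ (m ℕ.+ n) ≡ fromℕ m ℚ.+ fromℕ n
fromℕ-+ zero    n = sym (ℚ.+-identityˡ (fromℕ n))
fromℕ-+ (suc m) n = trans (cong (1ℚ ℚ.+_) (fromℕ-+ m n)) (sym (ℚ.+-assoc 1ℚ (fromℕ m) (fromℕ n)))

fromℕ-* : ∀ m n → fromℕ (m ℕ.* n) ≡ fromℕ m ℚ.* fromℕ n
fromℕ-* zero    n = sym (ℚ.*-zeroˡ (fromℕ n))
fromℕ-* (suc m) n = begin
  fromℕ (n ℕ.+ m ℕ.* n)                ≡⟨ fromℕ-+ n (m ℕ.* n) ⟩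
  fromℕ n ℚ.+ fromℕ (m ℕ.* n)          ≡⟨ cong (fromℕ n ℚ.+_) (fromℕ-* m n) ⟩
  fromℕ n ℚ.+ fromℕ m ℚ.* fromℕ n      ≡⟨ factor (fromℕ n) (fromℕ m) ⟩
  (1ℚ ℚ.+ fromℕ m) ℚ.* fromℕ n         ∎
  where
  open ≡-Reasoning
  factor : ∀ a b → a ℚ.+ b ℚ.* a ≡ (1ℚ ℚ.+ b) ℚ.* a
  factor = solve 2 (λ a b → a :+ b :* a := (con 1ℚ :+ b) :* a) refl
    where open +-*-Solver

fromℕ-mono-≤ : ∀ {m n} → m ℕ.≤ n → fromℕ m ℚ.≤ fromℕ n
fromℕ-mono-≤ {n = n} z≤n = fromℕ-nonNeg n
fromℕ-mono-≤ (s≤s m≤n)   = ℚ.+-monoʳ-≤ 1ℚ (fromℕ-mono-≤ m≤n)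

fromℕ-mono-< : ∀ {m n} → m ℕ.< n → fromℕ m ℚ.< fromℕ n
fromℕ-mono-< {m} m<n = ℚ.<-≤-trans
  (ℚ.≤-<-trans (ℚ.≤-reflexive (sym (ℚ.+-identityˡ (fromℕ m)))) (ℚ.+-monoˡ-< (fromℕ m) 0<1))
  (fromℕ-mono-≤ m<n)

fromℕ-injective : ∀ {m n} → fromℕ m ≡ fromℕ n → m ≡ n
fromℕ-injective {m} {n} eq with ℕ.<-cmp m n
... | tri< m<n _ _ = contradiction eq (ℚ.<⇒≢ (fromℕ-mono-< m<n))
... | tri≈ _ m≡n _ = m≡n
... | tri> _ _ n<m = contradiction (sym eq) (ℚ.<⇒≢ (fromℕ-mono-< n<m))

toℚᵘ-fromℕ : ∀ n → ℚ.toℚᵘ (fromℕ n) ℚᵘ.≃ ℚᵘ.mkℚᵘ (ℤ.+ n) 0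
toℚᵘ-fromℕ zero    = ℚᵘ.≃-refl
toℚᵘ-fromℕ (suc n) = begin
  ℚ.toℚᵘ (1ℚ ℚ.+ fromℕ n)               ≈⟨ ℚ.toℚᵘ-homo-+ 1ℚ (fromℕ n) ⟩
  ℚᵘ.1ℚᵘ ℚᵘ.+ ℚ.toℚᵘ (fromℕ n)          ≈⟨ ℚᵘ.+-congʳ ℚᵘ.1ℚᵘ (toℚᵘ-fromℕ n) ⟩
  ℚᵘ.1ℚᵘ ℚᵘ.+ ℚᵘ.mkℚᵘ (ℤ.+ n) 0
    ≈⟨ ℚᵘ.*≡* (cong (ℤ._* ℤ.1ℤ) (cong (ℤ._+_ ℤ.1ℤ) (ℤ.*-identityʳ (ℤ.+ n)))) ⟩
  ℚᵘ.mkℚᵘ (ℤ.+ suc n) 0                 ∎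
  where open ℚᵘ.≃-Reasoning

fromℕ*1/n : ∀ n .{{_ : NonZero n}} → fromℕ n ℚ.* (ℤ.+ 1 ℚ./ n) ≡ 1ℚ
fromℕ*1/n (suc m) = ℚ.toℚᵘ-injective (begin
  ℚ.toℚᵘ (fromℕ (suc m) ℚ.* (ℤ.+ 1 ℚ./ suc m))
    ≈⟨ ℚ.toℚᵘ-homo-* (fromℕ (suc m)) (ℤ.+ 1 ℚ./ suc m) ⟩
  ℚ.toℚᵘ (fromℕ (suc m)) ℚᵘ.* ℚ.toℚᵘ (ℤ.+ 1 ℚ./ suc m)
    ≈⟨ ℚᵘ.*-cong (toℚᵘ-fromℕ (suc m)) (ℚ.toℚᵘ-fromℚᵘ (ℚᵘ.mkℚᵘ (ℤ.+ 1) m)) ⟩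
  ℚᵘ.mkℚᵘ (ℤ.+ suc m) 0 ℚᵘ.* ℚᵘ.mkℚᵘ (ℤ.+ 1) m
    ≈⟨ ℚᵘ.*≡* (trans (ℤ.*-identityʳ _) (trans (ℤ.*-identityʳ (ℤ.+ suc m))
      (sym (trans (ℤ.*-identityˡ _) (ℤ.*-identityˡ (ℤ.+ suc m)))))) ⟩
  ℚᵘ.1ℚᵘ ∎)
  where open ℚᵘ.≃-Reasoning

0<1/n : ∀ n .{{_ : NonZero n}} → 0ℚ ℚ.< ℤ.+ 1 ℚ./ n
0<1/n n = ℚ.positive⁻¹ (ℤ.+ 1 ℚ./ n) {{ℚ.normalize-pos 1 n}}

-- Since the denominator is at least 1, the absolute value of the numerator plus one already exceeds
-- `q`.
archimedean : ∀ q → ∃ λ N → q ℚ.< fromℕ N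
archimedean q@(ℚ.mkℚ i d-1 _) = suc ℤ.∣ i ∣ , ℚ.toℚᵘ-cancel-<
  (ℚᵘ.<-respʳ-≃ (ℚᵘ.≃-sym (toℚᵘ-fromℕ (suc ℤ.∣ i ∣)))
  (ℚᵘ.*<* (begin-strict
    i ℤ.* ℤ.1ℤ                        ≡⟨ ℤ.*-identityʳ i ⟩
    i                                 ≤⟨ i≤∣i∣ i ⟩
    ℤ.+ ℤ.∣ i ∣                       <⟨ ℤ.+<+ (ℕ.n<1+n ℤ.∣ i ∣) ⟩
    ℤ.+ suc ℤ.∣ i ∣                   ≤⟨ ℤ.+≤+ (ℕ.m≤m*n (suc ℤ.∣ i ∣) (suc d-1)) ⟩
    ℤ.+ (suc ℤ.∣ i ∣ ℕ.* suc d-1)     ≡⟨ ℤ.pos-* (suc ℤ.∣ i ∣) (suc d-1) ⟩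
    ℤ.+ suc ℤ.∣ i ∣ ℤ.* ℤ.+ suc d-1   ∎)))
  where
  open ℤ.≤-Reasoning
  i≤∣i∣ : ∀ i → i ℤ.≤ ℤ.+ ℤ.∣ i ∣
  i≤∣i∣ (ℤ.+ n)      = ℤ.≤-refl
  i≤∣i∣ (ℤ.-[1+ n ]) = ℤ.-≤+

infixr 8 _^_

_^_ : ℚ → ℕ → ℚ
q ^ zero  = 1ℚ
q ^ suc k = q ℚ.* q ^ k

^-nonNeg : ∀ {q} k → 0ℚ ℚ.≤ q → 0ℚ ℚ.≤ q ^ k
^-nonNeg zero    0≤q = 0≤1
^-nonNeg (suc k) 0≤q = 0≤* 0≤q (^-nonNeg k 0≤q)

^-distrib-* : ∀ p q k → (p ℚ.* q) ^ k ≡ p ^ k ℚ.* q ^ k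
^-distrib-* p q zero    = refl
^-distrib-* p q (suc k) = trans (cong (p ℚ.* q ℚ.*_) (^-distrib-* p q k)) (swap p q (p ^ k) (q ^ k))
  where
  swap : ∀ a b c d → a ℚ.* b ℚ.* (c ℚ.* d) ≡ a ℚ.* c ℚ.* (b ℚ.* d)
  swap = solve 4 (λ a b c d → a :* b :* (c :* d) := a :* c :* (b :* d)) refl
    where open +-*-Solver

^-+ : ∀ p j k → p ^ (j ℕ.+ k) ≡ p ^ j ℚ.* p ^ k
^-+ p zero    k = sym (ℚ.*-identityˡ (p ^ k))
^-+ p (suc j) k = trans (cong (p ℚ.*_) (^-+ p j k)) (sym (ℚ.*-assoc p (p ^ j) (p ^ k)))

fromℕ-^ : ∀ n k → fromℕ (n ℕ.^ k) ≡ fromℕ n ^ k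
fromℕ-^ n zero    = refl
fromℕ-^ n (suc k) = trans (fromℕ-* n (n ℕ.^ k)) (cong (fromℕ n ℚ.*_) (fromℕ-^ n k))

∑ : (A → ℚ) → List A → ℚ
∑ f []       = 0ℚ
∑ f (x ∷ xs) = f x ℚ.+ ∑ f xs

∑-++ : ∀ (f : A → ℚ) xs ys → ∑ f (xs ++ ys) ≡ ∑ f xs ℚ.+ ∑ f ys
∑-++ f []       ys = sym (ℚ.+-identityˡ (∑ f ys))
∑-++ f (x ∷ xs) ys = trans (cong (f x ℚ.+_) (∑-++ f xs ys)) (sym (ℚ.+-assoc (f x) (∑ f xs) (∑ f ys)))

∑-map : ∀ (f : B → ℚ) (g : A → B) xs → ∑ f (List.map g xs) ≡ ∑ (f ∘ g) xs
∑-map f g []       = refl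
∑-map f g (x ∷ xs) = cong (f (g x) ℚ.+_) (∑-map f g xs)

∑-cong : ∀ {f g : A → ℚ} → (∀ x → f x ≡ g x) → ∀ xs → ∑ f xs ≡ ∑ g xs
∑-cong f≗g []       = refl
∑-cong f≗g (x ∷ xs) = cong₂ ℚ._+_ (f≗g x) (∑-cong f≗g xs)

∑-*ˡ : ∀ r (f : A → ℚ) xs → ∑ (λ x → r ℚ.* f x) xs ≡ r ℚ.* ∑ f xs
∑-*ˡ r f []       = sym (ℚ.*-zeroʳ r)
∑-*ˡ r f (x ∷ xs) = trans (cong (r ℚ.* f x ℚ.+_) (∑-*ˡ r f xs)) (sym (ℚ.*-distribˡ-+ r (f x) (∑ f xs)))

∑-+ : ∀ (f g : A → ℚ) xs → ∑ (λ x → f x ℚ.+ g x) xs ≡ ∑ f xs ℚ.+ ∑ g xs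
∑-+ f g []       = refl
∑-+ f g (x ∷ xs) = trans (cong (f x ℚ.+ g x ℚ.+_) (∑-+ f g xs)) (interchange (f x) (g x) (∑ f xs) (∑ g xs))
  where
  interchange : ∀ a b c d → a ℚ.+ b ℚ.+ (c ℚ.+ d) ≡ a ℚ.+ c ℚ.+ (b ℚ.+ d)
  interchange = solve 4 (λ a b c d → a :+ b :+ (c :+ d) := a :+ c :+ (b :+ d)) refl
    where open +-*-Solver

∑-zero : ∀ (xs : List A) → ∑ (λ _ → 0ℚ) xs ≡ 0ℚ
∑-zero []       = refl
∑-zero (x ∷ xs) = trans (ℚ.+-identityˡ _) (∑-zero xs)

∑-swap : ∀ (f : A → B → ℚ) xs ys → ∑ (λ x → ∑ (f x) ys) xs ≡ ∑ (λ y → ∑ (λ x → f x y) xs) ys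
∑-swap f []       ys = sym (∑-zero ys)
∑-swap f (x ∷ xs) ys = trans (cong (∑ (f x) ys ℚ.+_) (∑-swap f xs ys))
  (sym (∑-+ (f x) (λ y → ∑ (λ x → f x y) xs) ys))

∑-nonNeg : ∀ {f : A → ℚ} → (∀ x → 0ℚ ℚ.≤ f x) → ∀ xs → 0ℚ ℚ.≤ ∑ f xs
∑-nonNeg 0≤f []       = ℚ.≤-refl
∑-nonNeg 0≤f (x ∷ xs) = 0≤+ (0≤f x) (∑-nonNeg 0≤f xs)

∑-member : ∀ {f : A → ℚ} → (∀ x → 0ℚ ℚ.≤ f x) → ∀ {x xs} → x ∈ xs → f x ℚ.≤ ∑ f xs
∑-member {f = f} 0≤f {x} {x ∷ xs} (here refl) =
  ℚ.≤-trans (ℚ.≤-reflexive (sym (ℚ.+-identityʳ (f x)))) (ℚ.+-monoʳ-≤ (f x) (∑-nonNeg 0≤f xs))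
∑-member {f = f} 0≤f {x} {y ∷ xs} (there x∈xs) =
  ℚ.≤-trans (∑-member 0≤f x∈xs)
    (ℚ.≤-trans (ℚ.≤-reflexive (sym (ℚ.+-identityˡ (∑ f xs)))) (ℚ.+-monoˡ-≤ (∑ f xs) (0≤f y)))

∑-const : ∀ {f : A → ℚ} {r} {xs} → All (λ x → f x ≡ r) xs → ∑ f xs ≡ fromℕ (length xs) ℚ.* r
∑-const {r = r} [] = sym (ℚ.*-zeroˡ r)
∑-const {f = f} {r} {x ∷ xs} (fx≡r ∷ eqs) = trans (cong₂ ℚ._+_ fx≡r (∑-const eqs))
  (factor r (fromℕ (length xs)))
  where
  factor : ∀ r m → r ℚ.+ m ℚ.* r ≡ (1ℚ ℚ.+ m) ℚ.* r
  factor = solve 2 (λ r m → r :+ m :* r := (con 1ℚ :+ m) :* r) refl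
    where open +-*-Solver

∑-filter-≤ : ∀ {P : Pred A ℓ} (P? : Decidable P) {f : A → ℚ} → (∀ x → 0ℚ ℚ.≤ f x) → ∀ xs →
  ∑ f (List.filter P? xs) ℚ.≤ ∑ f xs
∑-filter-≤ P? 0≤f [] = ℚ.≤-refl
∑-filter-≤ P? {f} 0≤f (x ∷ xs) with P? x
... | yes _ = ℚ.+-monoʳ-≤ (f x) (∑-filter-≤ P? 0≤f xs)
... | no  _ = ℚ.≤-trans (∑-filter-≤ P? 0≤f xs)
  (ℚ.≤-trans (ℚ.≤-reflexive (sym (ℚ.+-identityˡ (∑ f xs)))) (ℚ.+-monoˡ-≤ (∑ f xs) (0≤f x)))

∑-cartesianProductWith : ∀ {C : Set} (f : C → ℚ) (g : A → ℚ) (h : B → ℚ) (_∙_ : A → B → C) →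
  (∀ x y → f (x ∙ y) ≡ g x ℚ.* h y) →
  ∀ xs ys → ∑ f (List.cartesianProductWith _∙_ xs ys) ≡ ∑ g xs ℚ.* ∑ h ys
∑-cartesianProductWith f g h _∙_ f≡gh []       ys = sym (ℚ.*-zeroˡ (∑ h ys))
∑-cartesianProductWith f g h _∙_ f≡gh (x ∷ xs) ys = begin
  ∑ f (List.map (x ∙_) ys ++ List.cartesianProductWith _∙_ xs ys)
    ≡⟨ ∑-++ f (List.map (x ∙_) ys) _ ⟩
  ∑ f (List.map (x ∙_) ys) ℚ.+ ∑ f (List.cartesianProductWith _∙_ xs ys)
    ≡⟨ cong₂ ℚ._+_ (trans (∑-map f (x ∙_) ys) (trans (∑-cong (f≡gh x) ys) (∑-*ˡ (g x) h ys)))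
                   (∑-cartesianProductWith f g h _∙_ f≡gh xs ys) ⟩
  g x ℚ.* ∑ h ys ℚ.+ ∑ g xs ℚ.* ∑ h ys
    ≡⟨ sym (ℚ.*-distribʳ-+ (∑ h ys) (g x) (∑ g xs)) ⟩
  (g x ℚ.+ ∑ g xs) ℚ.* ∑ h ys ∎
  where open ≡-Reasoning

∑< : ℕ → (ℕ → ℚ) → ℚ
∑< zero    f = 0ℚ
∑< (suc K) f = ∑< K f ℚ.+ f K

-- The tail from K of the series ∑ k² qᵏ is q ^ K * tail / (1 - q)³, which makes the
-- partial sums telescope.
∑k²qᵏ-telescopes : ∀ q K → let d = 1ℚ ℚ.- q; x = fromℕ K in
  d ℚ.* d ℚ.* d ℚ.* ∑< K (λ k → fromℕ k ℚ.* fromℕ k ℚ.* q ^ k) ℚ.+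
  q ^ K ℚ.* (d ℚ.* d ℚ.* x ℚ.* x ℚ.+ d ℚ.* q ℚ.* (x ℚ.+ x) ℚ.+ q ℚ.* (1ℚ ℚ.+ q))
  ≡ q ℚ.* (1ℚ ℚ.+ q)
∑k²qᵏ-telescopes q zero = base q
  where
  base : ∀ q → let d = 1ℚ ℚ.- q in
    d ℚ.* d ℚ.* d ℚ.* 0ℚ ℚ.+
    1ℚ ℚ.* (d ℚ.* d ℚ.* 0ℚ ℚ.* 0ℚ ℚ.+ d ℚ.* q ℚ.* (0ℚ ℚ.+ 0ℚ) ℚ.+ q ℚ.* (1ℚ ℚ.+ q))
    ≡ q ℚ.* (1ℚ ℚ.+ q)
  base = solve 1 (λ q → let d = con 1ℚ :- q in
    d :* d :* d :* con 0ℚ :+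
    con 1ℚ :* (d :* d :* con 0ℚ :* con 0ℚ :+ d :* q :* (con 0ℚ :+ con 0ℚ) :+ q :* (con 1ℚ :+ q))
    := q :* (con 1ℚ :+ q)) refl
    where open +-*-Solver
∑k²qᵏ-telescopes q (suc K) = trans (step q (fromℕ K) (q ^ K) (∑< K _)) (∑k²qᵏ-telescopes q K)
  where
  step : ∀ q x r s → let d = 1ℚ ℚ.- q; x′ = 1ℚ ℚ.+ x in
    d ℚ.* d ℚ.* d ℚ.* (s ℚ.+ x ℚ.* x ℚ.* r) ℚ.+
    q ℚ.* r ℚ.* (d ℚ.* d ℚ.* x′ ℚ.* x′ ℚ.+ d ℚ.* q ℚ.* (x′ ℚ.+ x′) ℚ.+ q ℚ.* (1ℚ ℚ.+ q))
    ≡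
    d ℚ.* d ℚ.* d ℚ.* s ℚ.+
    r ℚ.* (d ℚ.* d ℚ.* x ℚ.* x ℚ.+ d ℚ.* q ℚ.* (x ℚ.+ x) ℚ.+ q ℚ.* (1ℚ ℚ.+ q))
  step = solve 4 (λ q x r s → let d = con 1ℚ :- q; x′ = con 1ℚ :+ x in
    d :* d :* d :* (s :+ x :* x :* r) :+
    q :* r :* (d :* d :* x′ :* x′ :+ d :* q :* (x′ :+ x′) :+ q :* (con 1ℚ :+ q))
    :=
    d :* d :* d :* s :+
    r :* (d :* d :* x :* x :+ d :* q :* (x :+ x) :+ q :* (con 1ℚ :+ q))) refl
    where open +-*-Solver

∑k²qᵏ-bound : ∀ {q} K → 0ℚ ℚ.≤ q → q ℚ.≤ 1ℚ → let d = 1ℚ ℚ.- q in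
  d ℚ.* d ℚ.* d ℚ.* ∑< K (λ k → fromℕ k ℚ.* fromℕ k ℚ.* q ^ k) ℚ.≤ 1ℚ ℚ.+ 1ℚ
∑k²qᵏ-bound {q} K 0≤q q≤1 = begin
  s                         ≡⟨ sym (ℚ.+-identityʳ s) ⟩
  s ℚ.+ 0ℚ                  ≤⟨ ℚ.+-monoʳ-≤ s 0≤tail ⟩
  s ℚ.+ q ^ K ℚ.* tail      ≡⟨ ∑k²qᵏ-telescopes q K ⟩
  q ℚ.* (1ℚ ℚ.+ q)          ≤⟨ *-mono-≤ˡ (1ℚ ℚ.+ q) (0≤+ 0≤1 0≤q) q≤1 ⟩
  1ℚ ℚ.* (1ℚ ℚ.+ q)         ≡⟨ ℚ.*-identityˡ (1ℚ ℚ.+ q) ⟩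
  1ℚ ℚ.+ q                  ≤⟨ ℚ.+-monoʳ-≤ 1ℚ q≤1 ⟩
  1ℚ ℚ.+ 1ℚ                 ∎
  where
  open ℚ.≤-Reasoning
  d x s tail : ℚ
  d = 1ℚ ℚ.- q
  x = fromℕ K
  s = d ℚ.* d ℚ.* d ℚ.* ∑< K (λ k → fromℕ k ℚ.* fromℕ k ℚ.* q ^ k)
  tail = d ℚ.* d ℚ.* x ℚ.* x ℚ.+ d ℚ.* q ℚ.* (x ℚ.+ x) ℚ.+ q ℚ.* (1ℚ ℚ.+ q)
  0≤d : 0ℚ ℚ.≤ d
  0≤d = p≤q⇒0≤q-p q≤1
  0≤x : 0ℚ ℚ.≤ x
  0≤x = fromℕ-nonNeg K
  0≤tail : 0ℚ ℚ.≤ q ^ K ℚ.* tail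
  0≤tail = 0≤* (^-nonNeg K 0≤q)
    (0≤+ (0≤+ (0≤* (0≤* (0≤* 0≤d 0≤d) 0≤x) 0≤x) (0≤* (0≤* 0≤d 0≤q) (0≤+ 0≤x 0≤x))) (0≤* 0≤q (0≤+ 0≤1 0≤q)))

-- The weight of the graphs containing a given graph

weightℚ : ℚ → Graph n → ℚ
weightℚ p []      = 1ℚ
weightℚ p (N ∷ G) = Vec.foldr′ (λ edge w → (if edge then p else 1ℚ ℚ.- p) ℚ.* w) (weightℚ p G) N

-- Real operations act termwise, so each approximation of a weight is the weight at an approximation
-- of `p`. This moves the probabilistic estimate from reals to rationals.
seq-weight : ∀ p (G : Graph n) k → seq (weight p G) k ≡ weightℚ (seq p k) G
seq-weight p []      k = refl
seq-weight p (N ∷ G) k = row N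
  where
  row : ∀ {m} (M : Subset m) →
    seq (Vec.foldr′ (λ edge w → (if edge then p else 1ℝ - p) * w) (weight p G) M) k ≡
    Vec.foldr′ (λ edge w → (if edge then seq p k else 1ℚ ℚ.- seq p k) ℚ.* w) (weightℚ (seq p k) G) M
  row []          = seq-weight p G k
  row (true  ∷ M) = cong (seq p k ℚ.*_) (row M)
  row (false ∷ M) = cong ((1ℚ ℚ.- seq p k) ℚ.*_) (row M)

ℙℚ : (n : ℕ) (p : ℚ) {A : Pred (Graph n) ℓ} → Decidable A → ℚ
ℙℚ n p A? = ∑ (weightℚ p) (List.filter A? (graphs n))

seq-ℙ : ∀ n p {A : Pred (Graph n) ℓ} (A? : Decidable A) k → seq (ℙ n p A?) k ≡ ℙℚ n (seq p k) A?
seq-ℙ n p A? k = go (List.filter A? (graphs n))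
  where
  go : ∀ Gs → seq (List.foldr _+_ 0ℝ (List.map (weight p) Gs)) k ≡ ∑ (weightℚ (seq p k)) Gs
  go []       = refl
  go (G ∷ Gs) = cong₂ ℚ._+_ (seq-weight p G k) (go Gs)

size : Graph n → ℕ
size []      = 0
size (N ∷ G) = Subset.∣ N ∣ ℕ.+ size G

infix 4 _⊑_

_⊑_ : Graph n → Graph n → Set
X ⊑ G = ∀ i j → Adjacent X i j → Adjacent G i j

-- cover p X G is the weight of G when X ⊑ G, and zero otherwise.

edgeCover : ℚ → Bool → Bool → ℚ
edgeCover p true  true  = p
edgeCover p true  false = 0ℚ
edgeCover p false true  = p
edgeCover p false false = 1ℚ ℚ.- p

rowCover : ℚ → Subset n → Subset n → ℚ
rowCover p []      []      = 1ℚ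
rowCover p (x ∷ X) (y ∷ Y) = edgeCover p x y ℚ.* rowCover p X Y

cover : ℚ → Graph n → Graph n → ℚ
cover p []      []      = 1ℚ
cover p (M ∷ X) (N ∷ G) = rowCover p M N ℚ.* cover p X G

⊑⇒cover≡weight : ∀ p (X G : Graph n) → X ⊑ G → cover p X G ≡ weightℚ p G
⊑⇒cover≡weight p []      []      X⊑G = refl
⊑⇒cover≡weight p (M ∷ X) (N ∷ G) X⊑G = trans
  (cong (rowCover p M N ℚ.*_) (⊑⇒cover≡weight p X G (λ i j → X⊑G (suc i) (suc j))))
  (row M N (weightℚ p G) (λ {j} → X⊑G zero (suc j)))
  where
  row : ∀ {m} (M N : Subset m) w → M Subset.⊆ N →
    rowCover p M N ℚ.* w ≡ Vec.foldr′ (λ edge w → (if edge then p else 1ℚ ℚ.- p) ℚ.* w) w N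
  row []          []          w M⊆N = ℚ.*-identityˡ w
  row (true  ∷ M) (true  ∷ N) w M⊆N = trans (ℚ.*-assoc p (rowCover p M N) w)
    (cong (p ℚ.*_) (row M N w (Subset.drop-∷-⊆ M⊆N)))
  row (true  ∷ M) (false ∷ N) w M⊆N with () ← M⊆N Vec.here
  row (false ∷ M) (true  ∷ N) w M⊆N = trans (ℚ.*-assoc p (rowCover p M N) w)
    (cong (p ℚ.*_) (row M N w (Subset.drop-∷-⊆ M⊆N)))
  row (false ∷ M) (false ∷ N) w M⊆N = trans (ℚ.*-assoc (1ℚ ℚ.- p) (rowCover p M N) w)
    (cong ((1ℚ ℚ.- p) ℚ.*_) (row M N w (Subset.drop-∷-⊆ M⊆N)))

-- Summed over the two states of a pair, an edge of `X` contributes 0 + p and any other pair (1 - p)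
-- + p = 1. Only the factors p belonging to `X` survive.
∑-rowCover : ∀ p (X : Subset n) → ∑ (rowCover p X) (subsets n) ≡ p ^ Subset.∣ X ∣
∑-rowCover p [] = ℚ.+-identityʳ 1ℚ
∑-rowCover {suc n} p (x ∷ X) = begin
  ∑ (rowCover p (x ∷ X)) (List.map (outside ∷_) (subsets n) ++ List.map (inside ∷_) (subsets n))
    ≡⟨ ∑-++ _ (List.map (outside ∷_) (subsets n)) _ ⟩
  ∑ (rowCover p (x ∷ X)) (List.map (outside ∷_) (subsets n)) ℚ.+
  ∑ (rowCover p (x ∷ X)) (List.map (inside ∷_) (subsets n))
    ≡⟨ cong₂ ℚ._+_ (extend outside) (extend inside) ⟩
  edgeCover p x false ℚ.* p ^ Subset.∣ X ∣ ℚ.+ edgeCover p x true ℚ.* p ^ Subset.∣ X ∣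
    ≡⟨ total x ⟩
  p ^ Subset.∣ x ∷ X ∣ ∎
  where
  open ≡-Reasoning
  extend : ∀ b → ∑ (rowCover p (x ∷ X)) (List.map (b ∷_) (subsets n)) ≡ edgeCover p x b ℚ.* p ^ Subset.∣ X ∣
  extend b = trans (∑-map (rowCover p (x ∷ X)) (b ∷_) (subsets n))
    (trans (∑-*ˡ (edgeCover p x b) (rowCover p X) (subsets n))
           (cong (edgeCover p x b ℚ.*_) (∑-rowCover p X)))
  open +-*-Solver
  total : ∀ x → edgeCover p x false ℚ.* p ^ Subset.∣ X ∣ ℚ.+ edgeCover p x true ℚ.* p ^ Subset.∣ X ∣ ≡
    p ^ Subset.∣ x ∷ X ∣
  total true  = solve 2 (λ p r → con 0ℚ :* r :+ p :* r := p :* r) refl p (p ^ Subset.∣ X ∣)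
  total false = solve 2 (λ p r → (con 1ℚ :- p) :* r :+ p :* r := r) refl p (p ^ Subset.∣ X ∣)

∑-cover : ∀ p (X : Graph n) → ∑ (cover p X) (graphs n) ≡ p ^ size X
∑-cover p [] = ℚ.+-identityʳ 1ℚ
∑-cover {suc n} p (M ∷ X) = begin
  ∑ (cover p (M ∷ X)) (graphs (suc n))
    ≡⟨ ∑-cartesianProductWith (cover p (M ∷ X)) (rowCover p M) (cover p X) _∷_ (λ _ _ → refl) (subsets n)
      (graphs n) ⟩
  ∑ (rowCover p M) (subsets n) ℚ.* ∑ (cover p X) (graphs n)
    ≡⟨ cong₂ ℚ._*_ (∑-rowCover p M) (∑-cover p X) ⟩
  p ^ Subset.∣ M ∣ ℚ.* p ^ size X
    ≡⟨ sym (^-+ p Subset.∣ M ∣ (size X)) ⟩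
  p ^ size (M ∷ X) ∎
  where open ≡-Reasoning

∅ : ∀ n → Graph n
∅ zero    = []
∅ (suc n) = Subset.⊥ ∷ ∅ n

∅-nonAdjacent : ∀ (i j : Fin n) → ¬ Adjacent (∅ n) i j
∅-nonAdjacent zero    (suc j) = Subset.∉⊥
∅-nonAdjacent (suc i) zero    = Subset.∉⊥
∅-nonAdjacent (suc i) (suc j) = ∅-nonAdjacent i j

size-∅ : ∀ n → size (∅ n) ≡ 0
size-∅ zero    = refl
size-∅ (suc n) = cong₂ ℕ._+_ (Subset.∣⊥∣≡0 n) (size-∅ n)

-- The empty graph lies in every graph, so the total mass is the instance of `∑-cover` with no
-- prescribed edges.
∑-weight : ∀ n p → ∑ (weightℚ p) (graphs n) ≡ 1ℚ
∑-weight n p = begin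
  ∑ (weightℚ p) (graphs n)
    ≡⟨ ∑-cong (λ G → sym (⊑⇒cover≡weight p (∅ n) G (λ i j a → contradiction a (∅-nonAdjacent i j))))
      (graphs n) ⟩
  ∑ (cover p (∅ n)) (graphs n)     ≡⟨ ∑-cover p (∅ n) ⟩
  p ^ size (∅ n)                   ≡⟨ cong (p ^_) (size-∅ n) ⟩
  1ℚ                               ∎
  where open ≡-Reasoning

module _ {p} (0≤p : 0ℚ ℚ.≤ p) (p≤1 : p ℚ.≤ 1ℚ) where

  rowCover-nonNeg : ∀ (X Y : Subset n) → 0ℚ ℚ.≤ rowCover p X Y
  rowCover-nonNeg []      []      = 0≤1
  rowCover-nonNeg (x ∷ X) (y ∷ Y) = 0≤* (nonNeg x y) (rowCover-nonNeg X Y)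
    where
    nonNeg : ∀ x y → 0ℚ ℚ.≤ edgeCover p x y
    nonNeg true  true  = 0≤p
    nonNeg true  false = ℚ.≤-refl
    nonNeg false true  = 0≤p
    nonNeg false false = p≤q⇒0≤q-p p≤1

  cover-nonNeg : ∀ (X G : Graph n) → 0ℚ ℚ.≤ cover p X G
  cover-nonNeg []      []      = 0≤1
  cover-nonNeg (M ∷ X) (N ∷ G) = 0≤* (rowCover-nonNeg M N) (cover-nonNeg X G)

  weightℚ-nonNeg : ∀ (G : Graph n) → 0ℚ ℚ.≤ weightℚ p G
  weightℚ-nonNeg {n} G = subst (0ℚ ℚ.≤_)
    (⊑⇒cover≡weight p (∅ n) G (λ i j a → contradiction a (∅-nonAdjacent i j)))
    (cover-nonNeg (∅ n) G)

  ℙℚ≤1 : ∀ n {A : Pred (Graph n) ℓ} (A? : Decidable A) → ℙℚ n p A? ℚ.≤ 1ℚ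
  ℙℚ≤1 n A? = ℚ.≤-trans (∑-filter-≤ A? weightℚ-nonNeg (graphs n)) (ℚ.≤-reflexive (∑-weight n p))

  -- The weight of a graph outside the event equals its `cover` by some listed `X`, hence is at most
  -- the sum of all its covers. Exchanging the sums over `G` and `X` turns the covers into
  -- `p ^ size X`. Written with 1 on the left, the bound avoids forming the complementary event.
  union-bound : ∀ {A : Pred (Graph n) ℓ} (A? : Decidable A) (Xs : List (Graph n)) →
    (∀ G → ¬ A G → ∃ λ X → X ∈ Xs × X ⊑ G) →
    1ℚ ℚ.≤ ℙℚ n p A? ℚ.+ ∑ (λ X → p ^ size X) Xs
  union-bound {n} {A = A} A? Xs obstruct = begin
    1ℚ                                                       ≡⟨ sym (∑-weight n p) ⟩
    ∑ (weightℚ p) (graphs n)                                 ≤⟨ bound (graphs n) ⟩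
    ℙℚ n p A? ℚ.+ ∑ (λ G → ∑ (λ X → cover p X G) Xs) (graphs n)
      ≡⟨ cong (ℙℚ n p A? ℚ.+_) (∑-swap (λ G X → cover p X G) (graphs n) Xs) ⟩
    ℙℚ n p A? ℚ.+ ∑ (λ X → ∑ (cover p X) (graphs n)) Xs
      ≡⟨ cong (ℙℚ n p A? ℚ.+_) (∑-cong (∑-cover p) Xs) ⟩
    ℙℚ n p A? ℚ.+ ∑ (λ X → p ^ size X) Xs                    ∎
    where
    open ℚ.≤-Reasoning
    covers : Graph n → ℚ
    covers G = ∑ (λ X → cover p X G) Xs
    covers-nonNeg : ∀ G → 0ℚ ℚ.≤ covers G
    covers-nonNeg G = ∑-nonNeg (λ X → cover-nonNeg X G) Xs
    left : ∀ w a b c → 0ℚ ℚ.≤ c → a ℚ.≤ b ℚ.+ w → a ℚ.≤ b ℚ.+ (c ℚ.+ w)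
    left w a b c 0≤c a≤ = ℚ.≤-trans a≤
      (ℚ.+-monoʳ-≤ b (ℚ.≤-trans (ℚ.≤-reflexive (sym (ℚ.+-identityˡ w))) (ℚ.+-monoˡ-≤ w 0≤c)))
    open +-*-Solver
    bound : ∀ Gs → ∑ (weightℚ p) Gs ℚ.≤ ∑ (weightℚ p) (List.filter A? Gs) ℚ.+ ∑ covers Gs
    bound []       = ℚ.≤-refl
    bound (G ∷ Gs) with A? G
    ... | yes _  = ℚ.≤-trans (ℚ.+-monoʳ-≤ (weightℚ p G)
      (left (∑ covers Gs) _ (∑ (weightℚ p) (List.filter A? Gs)) (covers G) (covers-nonNeg G) (bound Gs)))
      (ℚ.≤-reflexive (sym (ℚ.+-assoc (weightℚ p G) (∑ (weightℚ p) (List.filter A? Gs))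
        (∑ covers (G ∷ Gs)))))
    ... | no ¬AG = ℚ.≤-trans (ℚ.+-mono-≤ weight≤ (bound Gs))
      (ℚ.≤-reflexive (move (covers G) (∑ (weightℚ p) (List.filter A? Gs)) (∑ covers Gs)))
      where
      move : ∀ a b c → a ℚ.+ (b ℚ.+ c) ≡ b ℚ.+ (a ℚ.+ c)
      move = solve 3 (λ a b c → a :+ (b :+ c) := b :+ (a :+ c)) refl
      weight≤ : weightℚ p G ℚ.≤ covers G
      weight≤ with X , X∈Xs , X⊑G ← obstruct G ¬AG =
        ℚ.≤-trans (ℚ.≤-reflexive (sym (⊑⇒cover≡weight p X G X⊑G)))
                  (∑-member (λ X → cover-nonNeg X G) X∈Xs)

-- Congruence of the reals and √3 / 2

half-pos : ∀ {ε} → 0ℚ ℚ.< ε → 0ℚ ℚ.< ½ ℚ.* ε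
half-pos = 0<* (ℚ.positive⁻¹ ½)

half+half : ∀ ε → ½ ℚ.* ε ℚ.+ ½ ℚ.* ε ≡ ε
half+half ε = trans (sym (ℚ.*-distribʳ-+ ε ½ ½)) (ℚ.*-identityˡ ε)

dist-triangle : ∀ {ε δ} p q r → ℚ.∣ p ℚ.- q ∣ ℚ.< ε → ℚ.∣ q ℚ.- r ∣ ℚ.< δ → ℚ.∣ p ℚ.- r ∣ ℚ.< ε ℚ.+ δ
dist-triangle p q r pq qr = ℚ.≤-<-trans
  (ℚ.≤-trans (ℚ.≤-reflexive (cong ℚ.∣_∣ (split p q r))) (ℚ.∣p+q∣≤∣p∣+∣q∣ (p ℚ.- q) (q ℚ.- r)))
  (ℚ.+-mono-< pq qr)
  where
  split : ∀ p q r → p ℚ.- r ≡ (p ℚ.- q) ℚ.+ (q ℚ.- r)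
  split = solve 3 (λ p q r → p :- r := (p :- q) :+ (q :- r)) refl
    where open +-*-Solver

pointwise⇒≈ : ∀ {x y} → (∀ k → seq x k ≡ seq y k) → x ≈ y
pointwise⇒≈ {x} {y} eq ε 0<ε = 0 , λ k _ → subst (λ r → ℚ.∣ r ∣ ℚ.< ε)
  (sym (trans (cong (ℚ._- seq y k) (eq k)) (ℚ.+-inverseʳ (seq y k)))) 0<ε

≈-sym : ∀ {x y} → x ≈ y → y ≈ x
≈-sym {x} {y} x≈y ε 0<ε with N , h ← x≈y ε 0<ε = N , λ k N≤k →
  subst (ℚ._< ε) (trans (sym (ℚ.∣-p∣≡∣p∣ (seq x k ℚ.- seq y k))) (cong ℚ.∣_∣ (swap (seq x k) (seq y k))))
    (h k N≤k)
  where
  swap : ∀ p q → ℚ.- (p ℚ.- q) ≡ q ℚ.- p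
  swap = solve 2 (λ p q → :- (p :- q) := q :- p) refl
    where open +-*-Solver

≈-trans : ∀ {x y z} → x ≈ y → y ≈ z → x ≈ z
≈-trans {x} {y} {z} x≈y y≈z ε 0<ε
  with M , hM ← x≈y (½ ℚ.* ε) (half-pos 0<ε)
     | N , hN ← y≈z (½ ℚ.* ε) (half-pos 0<ε) = M ℕ.⊔ N , λ k M⊔N≤k →
  subst (ℚ.∣ seq x k ℚ.- seq z k ∣ ℚ.<_) (half+half ε)
    (dist-triangle (seq x k) (seq y k) (seq z k)
      (hM k (ℕ.m⊔n≤o⇒m≤o M N M⊔N≤k)) (hN k (ℕ.m⊔n≤o⇒n≤o M N M⊔N≤k)))

+-cong : ∀ {x x′ y y′} → x ≈ x′ → y ≈ y′ → x + y ≈ x′ + y′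
+-cong {x} {x′} {y} {y′} x≈x′ y≈y′ ε 0<ε
  with M , hM ← x≈x′ (½ ℚ.* ε) (half-pos 0<ε)
     | N , hN ← y≈y′ (½ ℚ.* ε) (half-pos 0<ε) = M ℕ.⊔ N , λ k M⊔N≤k →
  subst (ℚ.∣ (seq x k ℚ.+ seq y k) ℚ.- (seq x′ k ℚ.+ seq y′ k) ∣ ℚ.<_) (half+half ε)
    (dist-triangle (seq x k ℚ.+ seq y k) (seq x′ k ℚ.+ seq y k) (seq x′ k ℚ.+ seq y′ k)
      (subst (λ r → ℚ.∣ r ∣ ℚ.< ½ ℚ.* ε) (cancelʳ (seq x k) (seq x′ k) (seq y k))
        (hM k (ℕ.m⊔n≤o⇒m≤o M N M⊔N≤k)))
      (subst (λ r → ℚ.∣ r ∣ ℚ.< ½ ℚ.* ε) (cancelˡ (seq x′ k) (seq y k) (seq y′ k))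
        (hN k (ℕ.m⊔n≤o⇒n≤o M N M⊔N≤k))))
  where
  open +-*-Solver
  cancelʳ : ∀ a b c → a ℚ.- b ≡ (a ℚ.+ c) ℚ.- (b ℚ.+ c)
  cancelʳ = solve 3 (λ a b c → a :- b := (a :+ c) :- (b :+ c)) refl
  cancelˡ : ∀ a b c → b ℚ.- c ≡ (a ℚ.+ b) ℚ.- (a ℚ.+ c)
  cancelˡ = solve 3 (λ a b c → b :- c := (a :+ b) :- (a :+ c)) refl

neg-cong : ∀ {x y} → x ≈ y → - x ≈ - y
neg-cong {x} {y} x≈y ε 0<ε with N , h ← x≈y ε 0<ε = N , λ k N≤k →
  subst (ℚ._< ε) (trans (sym (ℚ.∣-p∣≡∣p∣ (seq x k ℚ.- seq y k)))
    (cong ℚ.∣_∣ (ℚ.neg-distrib-+ (seq x k) (ℚ.- seq y k)))) (h k N≤k)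

eventually-bounded : ∀ x → ∃ λ B → 0ℚ ℚ.< B × ∃ λ N → ∀ k → N ℕ.≤ k → ℚ.∣ seq x k ∣ ℚ.≤ B
eventually-bounded x = let N , h = cauchy x 1ℚ 0<1 in
  1ℚ ℚ.+ ℚ.∣ seq x N ∣ ,
  ℚ.+-mono-<-≤ {0ℚ} {1ℚ} {0ℚ} {ℚ.∣ seq x N ∣} 0<1 (ℚ.0≤∣p∣ (seq x N)) ,
  N , λ k N≤k → begin
    ℚ.∣ seq x k ∣                              ≡⟨ cong ℚ.∣_∣ (split (seq x k) (seq x N)) ⟩
    ℚ.∣ (seq x k ℚ.- seq x N) ℚ.+ seq x N ∣    ≤⟨ ℚ.∣p+q∣≤∣p∣+∣q∣ (seq x k ℚ.- seq x N) (seq x N) ⟩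
    ℚ.∣ seq x k ℚ.- seq x N ∣ ℚ.+ ℚ.∣ seq x N ∣ ≤⟨ ℚ.+-monoˡ-≤ ℚ.∣ seq x N ∣ (ℚ.<⇒≤ (h k N N≤k ℕ.≤-refl)) ⟩
    1ℚ ℚ.+ ℚ.∣ seq x N ∣                       ∎
  where
  open ℚ.≤-Reasoning
  split : ∀ p q → p ≡ (p ℚ.- q) ℚ.+ q
  split = solve 2 (λ p q → p := (p :- q) :+ q) refl
    where open +-*-Solver

divide : ∀ {B ε} → 0ℚ ℚ.< B → 0ℚ ℚ.< ε → ∃ λ δ → 0ℚ ℚ.< δ × B ℚ.* δ ≡ ε
divide {B} {ε} 0<B 0<ε = B⁻¹ ℚ.* ε , 0<* (ℚ.positive⁻¹ B⁻¹ {{ℚ.1/pos⇒pos B}}) 0<ε ,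
  trans (sym (ℚ.*-assoc B B⁻¹ ε)) (trans (cong (ℚ._* ε) (ℚ.*-inverseʳ B)) (ℚ.*-identityˡ ε))
  where
  instance
    B-pos : ℚ.Positive B
    B-pos = ℚ.positive 0<B
    B≢0 : ℚ.NonZero B
    B≢0 = ℚ.pos⇒nonZero B
  B⁻¹ : ℚ
  B⁻¹ = ℚ.1/ B

*-congˡ : ∀ z {x y} → x ≈ y → z * x ≈ z * y
*-congˡ z {x} {y} x≈y ε 0<ε =
  let B , 0<B , M , hM = eventually-bounded z
      δ , 0<δ , Bδ≡ε   = divide 0<B 0<ε
      N , hN           = x≈y δ 0<δ
  in M ℕ.⊔ N , λ k M⊔N≤k → begin-strict
    ℚ.∣ seq z k ℚ.* seq x k ℚ.- seq z k ℚ.* seq y k ∣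
      ≡⟨ cong ℚ.∣_∣ (factor (seq z k) (seq x k) (seq y k)) ⟩
    ℚ.∣ seq z k ℚ.* (seq x k ℚ.- seq y k) ∣
      ≡⟨ ℚ.∣p*q∣≡∣p∣*∣q∣ (seq z k) (seq x k ℚ.- seq y k) ⟩
    ℚ.∣ seq z k ∣ ℚ.* ℚ.∣ seq x k ℚ.- seq y k ∣
      ≤⟨ *-mono-≤ˡ ℚ.∣ seq x k ℚ.- seq y k ∣ (ℚ.0≤∣p∣ (seq x k ℚ.- seq y k))
        (hM k (ℕ.m⊔n≤o⇒m≤o M N M⊔N≤k)) ⟩
    B ℚ.* ℚ.∣ seq x k ℚ.- seq y k ∣
      <⟨ ℚ.*-monoʳ-<-pos B {{ℚ.positive 0<B}} (hN k (ℕ.m⊔n≤o⇒n≤o M N M⊔N≤k)) ⟩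
    B ℚ.* δ
      ≡⟨ Bδ≡ε ⟩
    ε ∎
  where
  open ℚ.≤-Reasoning
  factor : ∀ a b c → a ℚ.* b ℚ.- a ℚ.* c ≡ a ℚ.* (b ℚ.- c)
  factor = solve 3 (λ a b c → a :* b :- a :* c := a :* (b :- c)) refl
    where open +-*-Solver

*-comm-≈ : ∀ x y → x * y ≈ y * x
*-comm-≈ x y = pointwise⇒≈ {x * y} {y * x} (λ k → ℚ.*-comm (seq x k) (seq y k))

*-cong : ∀ {x x′ y y′} → x ≈ x′ → y ≈ y′ → x * y ≈ x′ * y′
*-cong {x} {x′} {y} {y′} x≈x′ y≈y′ =
  ≈-trans {x * y} {x * y′} {x′ * y′} (*-congˡ x {y} {y′} y≈y′)
  (≈-trans {x * y′} {y′ * x} {x′ * y′} (*-comm-≈ x y′)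
  (≈-trans {y′ * x} {y′ * x′} {x′ * y′} (*-congˡ y′ {x} {x′} x≈x′) (*-comm-≈ y′ x′)))

≈-refl : ∀ {x} → x ≈ x
≈-refl {x} = pointwise⇒≈ {x} {x} (λ _ → refl)

weight-cong : ∀ {p q} → p ≈ q → ∀ (G : Graph n) → weight p G ≈ weight q G
weight-cong         p≈q []      = ≈-refl {1ℝ}
weight-cong {p = p} {q} p≈q (N ∷ G) = row N
  where
  rowWeight : ∀ {m} → ℝ → Subset m → ℝ
  rowWeight r = Vec.foldr′ (λ edge w → (if edge then r else 1ℝ - r) * w) (weight r G)
  row : ∀ {m} (M : Subset m) → rowWeight p M ≈ rowWeight q M
  row []          = weight-cong {p = p} {q} p≈q G
  row (true  ∷ M) = *-cong {p} {q} {rowWeight p M} {rowWeight q M} p≈q (row M)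
  row (false ∷ M) = *-cong {1ℝ - p} {1ℝ - q} {rowWeight p M} {rowWeight q M}
    (+-cong {1ℝ} {1ℝ} { - p} { - q} (≈-refl {1ℝ}) (neg-cong {p} {q} p≈q)) (row M)

ℙ-cong : ∀ n {p q} → p ≈ q → ∀ {A : Pred (Graph n) ℓ} (A? : Decidable A) → ℙ n p A? ≈ ℙ n q A?
ℙ-cong n {p} {q} p≈q A? = go (List.filter A? (graphs n))
  where
  total : ℝ → List (Graph n) → ℝ
  total r Gs = List.foldr _+_ 0ℝ (List.map (weight r) Gs)
  go : ∀ Gs → total p Gs ≈ total q Gs
  go []       = ≈-refl {0ℝ}
  go (G ∷ Gs) = +-cong {weight p G} {weight q G} {total p Gs} {total q Gs}
    (weight-cong {p = p} {q} p≈q G) (go Gs)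

∣p-q∣≤0⇒p≡q : ∀ {p q} → ℚ.∣ p ℚ.- q ∣ ℚ.≤ 0ℚ → p ≡ q
∣p-q∣≤0⇒p≡q {p} {q} ≤0 = begin
  p                    ≡⟨ split p q ⟩
  (p ℚ.- q) ℚ.+ q      ≡⟨ cong (ℚ._+ q) (ℚ.∣p∣≡0⇒p≡0 (p ℚ.- q) (ℚ.≤-antisym ≤0 (ℚ.0≤∣p∣ (p ℚ.- q)))) ⟩
  0ℚ ℚ.+ q             ≡⟨ ℚ.+-identityˡ q ⟩
  q                    ∎
  where
  open ≡-Reasoning
  split : ∀ p q → p ≡ (p ℚ.- q) ℚ.+ q
  split = solve 2 (λ p q → p := (p :- q) :+ q) refl
    where open +-*-Solver

fromℚ-injective : ∀ {p q} → fromℚ p ≈ fromℚ q → p ≡ q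
fromℚ-injective {p} {q} p≈q with ℚ.∣ p ℚ.- q ∣ ℚ.≤? 0ℚ
... | yes ≤0 = ∣p-q∣≤0⇒p≡q ≤0
... | no  ≰0 with N , h ← p≈q ℚ.∣ p ℚ.- q ∣ (ℚ.≰⇒> ≰0) = contradiction (h N ℕ.≤-refl) (ℚ.<-irrefl refl)

-- The reciprocal is given by its defining equation, so that the lemma serves both 1 / n and the
-- `error` of the convergents.
reciprocal-small : ∀ {ε} → 0ℚ ℚ.< ε → ∃ λ N → ∀ m → N ℕ.≤ m → ∀ {r} → 0ℚ ℚ.< r → fromℕ m ℚ.* r ≡ 1ℚ →
  r ℚ.< ε
reciprocal-small {ε} 0<ε
  with δ , 0<δ , εδ≡1 ← divide 0<ε 0<1
  with N , δ<N ← archimedean δ = N , λ m N≤m {r} 0<r mr≡1 → begin-strict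
    r                         ≡⟨ sym (ℚ.*-identityʳ r) ⟩
    r ℚ.* 1ℚ                  ≡⟨ cong (r ℚ.*_) (sym εδ≡1) ⟩
    r ℚ.* (ε ℚ.* δ)
      <⟨ ℚ.*-monoʳ-<-pos r {{ℚ.positive 0<r}} (ℚ.*-monoʳ-<-pos ε {{ℚ.positive 0<ε}} δ<N) ⟩
    r ℚ.* (ε ℚ.* fromℕ N)     ≤⟨ *-mono-≤ʳ r (ℚ.<⇒≤ 0<r) (*-mono-≤ʳ ε (ℚ.<⇒≤ 0<ε) (fromℕ-mono-≤ N≤m)) ⟩
    r ℚ.* (ε ℚ.* fromℕ m)     ≡⟨ rotate r ε (fromℕ m) ⟩
    ε ℚ.* (fromℕ m ℚ.* r)     ≡⟨ cong (ε ℚ.*_) mr≡1 ⟩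
    ε ℚ.* 1ℚ                  ≡⟨ ℚ.*-identityʳ ε ⟩
    ε                         ∎
  where
  open ℚ.≤-Reasoning
  rotate : ∀ a b c → a ℚ.* (b ℚ.* c) ≡ b ℚ.* (c ℚ.* a)
  rotate = solve 3 (λ a b c → a :* (b :* c) := b :* (c :* a)) refl
    where open +-*-Solver

-- The number √3 / 2 and its irrationality

¾ : ℚ
¾ = ℤ.+ 3 ℚ./ 4

-- The convergents a / 2b of √3 / 2, where (2 + √3) ^ (k + 1) = a + b √3 and b is stored
-- through its predecessor.

pell : ℕ → ℕ × ℕ
pell zero    = 2 , 0
pell (suc k) = let a , b-1 = pell k in 2 ℕ.* a ℕ.+ 3 ℕ.* suc b-1 , suc (a ℕ.+ 2 ℕ.* b-1)

pellA pellB : ℕ → ℕ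
pellA k = proj₁ (pell k)
pellB k = suc (proj₂ (pell k))

-- The norm a² - 3b² is multiplicative and 2 + √3 has norm 1. Over the naturals this reads: a² and
-- 3b² + 1 grow by the same amount `y` in each step.
pell-equation : ∀ k → pellA k ℕ.* pellA k ≡ 3 ℕ.* (pellB k ℕ.* pellB k) ℕ.+ 1
pell-equation zero    = refl
pell-equation (suc k) =
  trans (expandA a b) (trans (cong (ℕ._+ y) (pell-equation k)) (sym (expandB a b)))
  where
  a b y : ℕ
  a = pellA k
  b = proj₂ (pell k)
  y = 3 ℕ.* (a ℕ.* a) ℕ.+ 12 ℕ.* (a ℕ.* suc b) ℕ.+ 9 ℕ.* (suc b ℕ.* suc b)
  open ℕSolver.+-*-Solver
  expandA : ∀ a b → (2 ℕ.* a ℕ.+ 3 ℕ.* suc b) ℕ.* (2 ℕ.* a ℕ.+ 3 ℕ.* suc b) ≡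
    a ℕ.* a ℕ.+ (3 ℕ.* (a ℕ.* a) ℕ.+ 12 ℕ.* (a ℕ.* suc b) ℕ.+ 9 ℕ.* (suc b ℕ.* suc b))
  expandA = solve 2 (λ a b → let b′ = con 1 :+ b in
    (con 2 :* a :+ con 3 :* b′) :* (con 2 :* a :+ con 3 :* b′) :=
    a :* a :+ (con 3 :* (a :* a) :+ con 12 :* (a :* b′) :+ con 9 :* (b′ :* b′))) refl
  expandB : ∀ a b → 3 ℕ.* (suc (suc (a ℕ.+ 2 ℕ.* b)) ℕ.* suc (suc (a ℕ.+ 2 ℕ.* b))) ℕ.+ 1 ≡
    3 ℕ.* (suc b ℕ.* suc b) ℕ.+ 1 ℕ.+ (3 ℕ.* (a ℕ.* a) ℕ.+ 12 ℕ.* (a ℕ.* suc b) ℕ.+ 9 ℕ.* (suc b ℕ.* suc b))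
  expandB = solve 2 (λ a b → let b′ = con 1 :+ b; c = con 1 :+ (con 1 :+ (a :+ con 2 :* b)) in
    con 3 :* (c :* c) :+ con 1 :=
    con 3 :* (b′ :* b′) :+ con 1 :+ (con 3 :* (a :* a) :+ con 12 :* (a :* b′) :+ con 9 :* (b′ :* b′))) refl

pellB≤pellA : ∀ k → pellB k ℕ.≤ pellA k
pellB≤pellA zero    = s≤s z≤n
pellB≤pellA (suc k) = begin
  suc (suc (a ℕ.+ 2 ℕ.* b))                                     ≤⟨ ℕ.m≤m+n _ (a ℕ.+ b ℕ.+ 1) ⟩
  suc (suc (a ℕ.+ 2 ℕ.* b)) ℕ.+ (a ℕ.+ b ℕ.+ 1)                 ≡⟨ regroup a b ⟩
  2 ℕ.* a ℕ.+ 3 ℕ.* suc b                                       ∎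
  where
  open ℕ.≤-Reasoning
  a b : ℕ
  a = pellA k
  b = proj₂ (pell k)
  open ℕSolver.+-*-Solver
  regroup : ∀ a b → suc (suc (a ℕ.+ 2 ℕ.* b)) ℕ.+ (a ℕ.+ b ℕ.+ 1) ≡ 2 ℕ.* a ℕ.+ 3 ℕ.* suc b
  regroup = solve 2 (λ a b → con 1 :+ (con 1 :+ (a :+ con 2 :* b)) :+ (a :+ b :+ con 1) :=
    con 2 :* a :+ con 3 :* (con 1 :+ b)) refl

k≤pellB : ∀ k → k ℕ.≤ pellB k
k≤pellB zero    = z≤n
k≤pellB (suc k) = begin
  suc k                                 ≤⟨ s≤s (k≤pellB k) ⟩
  suc (suc b)
    ≤⟨ s≤s (s≤s (ℕ.≤-trans (ℕ.m≤m+n b (b ℕ.+ 0)) (ℕ.m≤n+m (2 ℕ.* b) a))) ⟩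
  suc (suc (a ℕ.+ 2 ℕ.* b))             ∎
  where
  open ℕ.≤-Reasoning
  a b : ℕ
  a = pellA k
  b = proj₂ (pell k)

error convergent : ℕ → ℚ
error k = ℤ.+ 1 ℚ./ (2 ℕ.* pellB k)
convergent k = fromℕ (pellA k) ℚ.* error k

error-pos : ∀ k → 0ℚ ℚ.< error k
error-pos k = 0<1/n (2 ℕ.* pellB k)

pellB*error : ∀ k → fromℕ (pellB k) ℚ.* error k ≡ ½
pellB*error k = begin
  b ℚ.* error k                           ≡⟨ halve b (error k) ⟩
  ½ ℚ.* ((1ℚ ℚ.+ (1ℚ ℚ.+ 0ℚ)) ℚ.* b ℚ.* error k)
    ≡⟨ cong (λ r → ½ ℚ.* (r ℚ.* error k)) (sym (fromℕ-* 2 (pellB k))) ⟩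
  ½ ℚ.* (fromℕ (2 ℕ.* pellB k) ℚ.* error k) ≡⟨ cong (½ ℚ.*_) (fromℕ*1/n (2 ℕ.* pellB k)) ⟩
  ½ ℚ.* 1ℚ                            ≡⟨ ℚ.*-identityʳ ½ ⟩
  ½                                   ∎
  where
  open ≡-Reasoning
  b : ℚ
  b = fromℕ (pellB k)
  halve : ∀ b s → b ℚ.* s ≡ ½ ℚ.* ((1ℚ ℚ.+ (1ℚ ℚ.+ 0ℚ)) ℚ.* b ℚ.* s)
  halve = solve 2 (λ b s → b :* s := con ½ :* ((con 1ℚ :+ (con 1ℚ :+ con 0ℚ)) :* b :* s)) refl
    where open +-*-Solver

-- This is the Pell equation divided by (2b)²: since b times `error k` is ½, the term 3b² becomes ¾
-- and the 1 becomes the square of the error.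
convergent²≡¾+error² : ∀ k → convergent k ℚ.* convergent k ≡ ¾ ℚ.+ error k ℚ.* error k
convergent²≡¾+error² k = begin
  a ℚ.* error k ℚ.* (a ℚ.* error k)                       ≡⟨ regroup a (error k) ⟩
  (a ℚ.* a) ℚ.* (error k ℚ.* error k)                     ≡⟨ cong (ℚ._* (error k ℚ.* error k)) a²≡3b²+1 ⟩
  (fromℕ 3 ℚ.* (b ℚ.* b) ℚ.+ fromℕ 1) ℚ.* (error k ℚ.* error k) ≡⟨ expand b (error k) ⟩
  fromℕ 3 ℚ.* ((b ℚ.* error k) ℚ.* (b ℚ.* error k)) ℚ.+ error k ℚ.* error k
    ≡⟨ cong (λ r → fromℕ 3 ℚ.* (r ℚ.* r) ℚ.+ error k ℚ.* error k) (pellB*error k) ⟩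
  ¾ ℚ.+ error k ℚ.* error k                               ∎
  where
  open ≡-Reasoning
  a b : ℚ
  a = fromℕ (pellA k)
  b = fromℕ (pellB k)
  a²≡3b²+1 : a ℚ.* a ≡ fromℕ 3 ℚ.* (b ℚ.* b) ℚ.+ fromℕ 1
  a²≡3b²+1 = begin
    a ℚ.* a                                             ≡⟨ sym (fromℕ-* (pellA k) (pellA k)) ⟩
    fromℕ (pellA k ℕ.* pellA k)                         ≡⟨ cong fromℕ (pell-equation k) ⟩
    fromℕ (3 ℕ.* (pellB k ℕ.* pellB k) ℕ.+ 1)           ≡⟨ fromℕ-+ (3 ℕ.* (pellB k ℕ.* pellB k)) 1 ⟩
    fromℕ (3 ℕ.* (pellB k ℕ.* pellB k)) ℚ.+ fromℕ 1
      ≡⟨ cong (ℚ._+ fromℕ 1) (trans (fromℕ-* 3 (pellB k ℕ.* pellB k))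
        (cong (fromℕ 3 ℚ.*_) (fromℕ-* (pellB k) (pellB k)))) ⟩
    fromℕ 3 ℚ.* (b ℚ.* b) ℚ.+ fromℕ 1                   ∎
  open +-*-Solver
  regroup : ∀ a s → a ℚ.* s ℚ.* (a ℚ.* s) ≡ (a ℚ.* a) ℚ.* (s ℚ.* s)
  regroup = solve 2 (λ a s → a :* s :* (a :* s) := (a :* a) :* (s :* s)) refl
  expand : ∀ b s → (fromℕ 3 ℚ.* (b ℚ.* b) ℚ.+ fromℕ 1) ℚ.* (s ℚ.* s) ≡
    fromℕ 3 ℚ.* ((b ℚ.* s) ℚ.* (b ℚ.* s)) ℚ.+ s ℚ.* s
  expand = solve 2 (λ b s → (con (fromℕ 3) :* (b :* b) :+ con (fromℕ 1)) :* (s :* s) :=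
    con (fromℕ 3) :* ((b :* s) :* (b :* s)) :+ s :* s) refl

½≤convergent : ∀ k → ½ ℚ.≤ convergent k
½≤convergent k = subst (ℚ._≤ convergent k) (pellB*error k)
  (*-mono-≤ˡ (error k) (ℚ.<⇒≤ (error-pos k)) (fromℕ-mono-≤ (pellB≤pellA k)))

error²≤error : ∀ k → error k ℚ.* error k ℚ.≤ error k
error²≤error k = begin
  error k ℚ.* error k          ≤⟨ *-mono-≤ˡ (error k) (ℚ.<⇒≤ (error-pos k)) s≤1 ⟩
  1ℚ ℚ.* error k           ≡⟨ ℚ.*-identityˡ (error k) ⟩
  error k                  ∎
  where
  open ℚ.≤-Reasoning
  s≤1 : error k ℚ.≤ 1ℚ
  s≤1 = begin
    error k                            ≡⟨ sym (ℚ.*-identityˡ (error k)) ⟩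
    1ℚ ℚ.* error k
      ≤⟨ *-mono-≤ˡ (error k) (ℚ.<⇒≤ (error-pos k)) (fromℕ-mono-≤ {1} {2 ℕ.* pellB k} (s≤s z≤n)) ⟩
    fromℕ (2 ℕ.* pellB k) ℚ.* error k  ≡⟨ fromℕ*1/n (2 ℕ.* pellB k) ⟩
    1ℚ                             ∎

error-small : ∀ {ε} → 0ℚ ℚ.< ε → ∃ λ N → ∀ k → N ℕ.≤ k → error k ℚ.< ε
error-small 0<ε = let N , h = reciprocal-small 0<ε in N , λ k N≤k →
  h (2 ℕ.* pellB k) (ℕ.≤-trans N≤k (ℕ.≤-trans (k≤pellB k) (ℕ.m≤m+n (pellB k) (pellB k ℕ.+ 0))))
    (error-pos k) (fromℕ*1/n (2 ℕ.* pellB k))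

-- Convergents are at least ½, so the sum of two is at least 1 and their difference is bounded by
-- the difference of their squares. In the latter ¾ cancels and only squared errors remain.
convergent-cauchy : IsCauchy convergent
convergent-cauchy ε 0<ε = let N , h = error-small (half-pos 0<ε) in N , λ m n N≤m N≤n →
  let open ℚ.≤-Reasoning
      d = convergent m ℚ.- convergent n
      1≤t+t : 1ℚ ℚ.≤ ℚ.∣ convergent m ℚ.+ convergent n ∣
      1≤t+t = ℚ.≤-trans (ℚ.+-mono-≤ (½≤convergent m) (½≤convergent n))
        (p≤∣p∣ (convergent m ℚ.+ convergent n))
  in begin-strict
    ℚ.∣ d ∣                                            ≡⟨ sym (ℚ.*-identityʳ ℚ.∣ d ∣) ⟩
    ℚ.∣ d ∣ ℚ.* 1ℚ                                     ≤⟨ *-mono-≤ʳ ℚ.∣ d ∣ (ℚ.0≤∣p∣ d) 1≤t+t ⟩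
    ℚ.∣ d ∣ ℚ.* ℚ.∣ convergent m ℚ.+ convergent n ∣
      ≡⟨ sym (ℚ.∣p*q∣≡∣p∣*∣q∣ d (convergent m ℚ.+ convergent n)) ⟩
    ℚ.∣ d ℚ.* (convergent m ℚ.+ convergent n) ∣
      ≡⟨ cong ℚ.∣_∣ (difference-of-squares (convergent m) (convergent n)) ⟩
    ℚ.∣ convergent m ℚ.* convergent m ℚ.- convergent n ℚ.* convergent n ∣
      ≡⟨ cong ℚ.∣_∣ (cong₂ ℚ._-_ (convergent²≡¾+error² m) (convergent²≡¾+error² n)) ⟩
    ℚ.∣ (¾ ℚ.+ error m ℚ.* error m) ℚ.- (¾ ℚ.+ error n ℚ.* error n) ∣
      ≡⟨ cong ℚ.∣_∣ (cancel ¾ (error m ℚ.* error m) (error n ℚ.* error n)) ⟩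
    ℚ.∣ error m ℚ.* error m ℚ.- error n ℚ.* error n ∣
      ≤⟨ ℚ.∣p-q∣≤∣p∣+∣q∣ (error m ℚ.* error m) (error n ℚ.* error n) ⟩
    ℚ.∣ error m ℚ.* error m ∣ ℚ.+ ℚ.∣ error n ℚ.* error n ∣
      ≤⟨ ℚ.+-mono-≤ (∣error²∣≤error m) (∣error²∣≤error n) ⟩
    error m ℚ.+ error n                                        <⟨ ℚ.+-mono-< (h m N≤m) (h n N≤n) ⟩
    ½ ℚ.* ε ℚ.+ ½ ℚ.* ε                                ≡⟨ half+half ε ⟩
    ε                                                  ∎
  where
  open +-*-Solver
  difference-of-squares : ∀ p q → (p ℚ.- q) ℚ.* (p ℚ.+ q) ≡ p ℚ.* p ℚ.- q ℚ.* q
  difference-of-squares = solve 2 (λ p q → (p :- q) :* (p :+ q) := p :* p :- q :* q) refl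
  cancel : ∀ a b c → (a ℚ.+ b) ℚ.- (a ℚ.+ c) ≡ b ℚ.- c
  cancel = solve 3 (λ a b c → (a :+ b) :- (a :+ c) := b :- c) refl
  p≤∣p∣ : ∀ p → p ℚ.≤ ℚ.∣ p ∣
  p≤∣p∣ p with ℚ.≤-total 0ℚ p
  ... | inj₁ 0≤p = ℚ.≤-reflexive (sym (ℚ.0≤p⇒∣p∣≡p 0≤p))
  ... | inj₂ p≤0 = ℚ.≤-trans p≤0 (ℚ.0≤∣p∣ p)
  ∣error²∣≤error : ∀ k → ℚ.∣ error k ℚ.* error k ∣ ℚ.≤ error k
  ∣error²∣≤error k = ℚ.≤-trans (ℚ.≤-reflexive (ℚ.0≤p⇒∣p∣≡p
    (0≤* (ℚ.<⇒≤ (error-pos k)) (ℚ.<⇒≤ (error-pos k))))) (error²≤error k)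

√3/2 : ℝ
√3/2 = mkℝ convergent convergent-cauchy

√3/2-squared : √3/2 * √3/2 ≈ fromℚ ¾
√3/2-squared ε 0<ε = let N , h = error-small 0<ε in N , λ k N≤k →
  let open ℚ.≤-Reasoning in begin-strict
    ℚ.∣ convergent k ℚ.* convergent k ℚ.- ¾ ∣
      ≡⟨ cong (λ r → ℚ.∣ r ℚ.- ¾ ∣) (convergent²≡¾+error² k) ⟩
    ℚ.∣ (¾ ℚ.+ error k ℚ.* error k) ℚ.- ¾ ∣    ≡⟨ cong ℚ.∣_∣ (cancel ¾ (error k ℚ.* error k)) ⟩
    ℚ.∣ error k ℚ.* error k ∣
      ≡⟨ ℚ.0≤p⇒∣p∣≡p (0≤* (ℚ.<⇒≤ (error-pos k)) (ℚ.<⇒≤ (error-pos k))) ⟩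
    error k ℚ.* error k                        ≤⟨ error²≤error k ⟩
    error k                                <⟨ h k N≤k ⟩
    ε                                  ∎
  where
  cancel : ∀ a b → (a ℚ.+ b) ℚ.- a ≡ b
  cancel = solve 2 (λ a b → (a :+ b) :- a := b) refl
    where open +-*-Solver

prime-3 : Prime 3
prime-3 = from-yes (prime? 3)

no-rational-√3 : ∀ q → ¬ q ℚ.* q ≡ fromℕ 3
no-rational-√3 q@(ℚ.mkℚ i d-1 coprime) q²≡3 = contradiction (Coprime.recompute coprime (3∣i , 3∣d)) λ()
  where
  d : ℕ
  d = suc d-1
  i²≡3d² : ℤ.∣ i ∣ ℕ.* ℤ.∣ i ∣ ≡ 3 ℕ.* (d ℕ.* d)
  i²≡3d² with ℚᵘ.*≡* eq ← ℚᵘ.≃-trans (ℚᵘ.≃-sym (ℚ.toℚᵘ-homo-* q q)) (ℚ.toℚᵘ-cong q²≡3) =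
    begin
      ℤ.∣ i ∣ ℕ.* ℤ.∣ i ∣                 ≡⟨ sym (ℤ.abs-* i i) ⟩
      ℤ.∣ i ℤ.* i ∣                       ≡⟨ cong ℤ.∣_∣ (trans (sym (ℤ.*-identityʳ (i ℤ.* i))) eq) ⟩
      ℤ.∣ ℤ.+ 3 ℤ.* (ℤ.+ (d ℕ.* d)) ∣     ≡⟨ ℤ.abs-* (ℤ.+ 3) (ℤ.+ (d ℕ.* d)) ⟩
      3 ℕ.* (d ℕ.* d)                     ∎
    where open ≡-Reasoning
  3∣square : ∀ m → 3 ∣ m ℕ.* m → 3 ∣ m
  3∣square m 3∣m² with euclidsLemma m m prime-3 3∣m²
  ... | inj₁ 3∣m = 3∣m
  ... | inj₂ 3∣m = 3∣m
  3∣i : 3 ∣ ℤ.∣ i ∣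
  3∣i = 3∣square ℤ.∣ i ∣ (divides (d ℕ.* d) (trans i²≡3d² (ℕ.*-comm 3 (d ℕ.* d))))
  3∣d : 3 ∣ d
  3∣d with divides k i≡k*3 ← 3∣i = 3∣square d (divides (k ℕ.* k) (ℕ.*-cancelˡ-≡ (d ℕ.* d) (k ℕ.* k ℕ.* 3) 3
    (trans (sym i²≡3d²) (trans (cong₂ ℕ._*_ i≡k*3 i≡k*3) (regroup k)))))
    where
    regroup : ∀ k → k ℕ.* 3 ℕ.* (k ℕ.* 3) ≡ 3 ℕ.* (k ℕ.* k ℕ.* 3)
    regroup = solve 1 (λ k → k :* con 3 :* (k :* con 3) := con 3 :* (k :* k :* con 3)) refl
      where open ℕSolver.+-*-Solver

a²≡¾b²⇒b≡0 : ∀ a b → a ℚ.* a ≡ ¾ ℚ.* (b ℚ.* b) → b ≡ 0ℚ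
a²≡¾b²⇒b≡0 a b a²≡¾b² with b ℚ.≟ 0ℚ
... | yes b≡0 = b≡0
-- If `b` were nonzero, 2a / b would be a rational square root of 4 · ¾ = 3.
... | no  b≢0 = contradiction q²≡3 (no-rational-√3 (fromℕ 2 ℚ.* a ℚ.* b⁻¹))
  where
  instance
    b-nonZero : ℚ.NonZero b
    b-nonZero = ℚ.≢-nonZero b≢0
  b⁻¹ : ℚ
  b⁻¹ = ℚ.1/ b
  open ≡-Reasoning
  open +-*-Solver
  regroup : ∀ a c → fromℕ 2 ℚ.* a ℚ.* c ℚ.* (fromℕ 2 ℚ.* a ℚ.* c) ≡ fromℕ 4 ℚ.* (a ℚ.* a) ℚ.* (c ℚ.* c)
  regroup = solve 2 (λ a c → con (fromℕ 2) :* a :* c :* (con (fromℕ 2) :* a :* c) := con (fromℕ 4) :*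
    (a :* a) :* (c :* c)) refl
  regroup′ : ∀ b c → fromℕ 4 ℚ.* (¾ ℚ.* (b ℚ.* b)) ℚ.* (c ℚ.* c) ≡ fromℕ 3 ℚ.* ((b ℚ.* c) ℚ.* (b ℚ.* c))
  regroup′ = solve 2 (λ b c → con (fromℕ 4) :* (con ¾ :* (b :* b)) :* (c :* c) := con (fromℕ 3) :*
    ((b :* c) :* (b :* c))) refl
  q²≡3 : fromℕ 2 ℚ.* a ℚ.* b⁻¹ ℚ.* (fromℕ 2 ℚ.* a ℚ.* b⁻¹) ≡ fromℕ 3
  q²≡3 = begin
    fromℕ 2 ℚ.* a ℚ.* b⁻¹ ℚ.* (fromℕ 2 ℚ.* a ℚ.* b⁻¹)        ≡⟨ regroup a b⁻¹ ⟩
    fromℕ 4 ℚ.* (a ℚ.* a) ℚ.* (b⁻¹ ℚ.* b⁻¹)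
      ≡⟨ cong (λ r → fromℕ 4 ℚ.* r ℚ.* (b⁻¹ ℚ.* b⁻¹)) a²≡¾b² ⟩
    fromℕ 4 ℚ.* (¾ ℚ.* (b ℚ.* b)) ℚ.* (b⁻¹ ℚ.* b⁻¹)          ≡⟨ regroup′ b b⁻¹ ⟩
    fromℕ 3 ℚ.* ((b ℚ.* b⁻¹) ℚ.* (b ℚ.* b⁻¹))
      ≡⟨ cong (λ r → fromℕ 3 ℚ.* (r ℚ.* r)) (ℚ.*-inverseʳ b) ⟩
    fromℕ 3                                                  ∎

-- Points of the plane

-- ⟨ a , b , y ⟩ stands for the point (a + b √3 / 2 , y).

record Point : Set where
  constructor ⟨_,_,_⟩
  field
    rational surd height : ℚ

open Point

⟨⟩-cong : ∀ {a a′ b b′ y y′} → a ≡ a′ → b ≡ b′ → y ≡ y′ → ⟨ a , b , y ⟩ ≡ ⟨ a′ , b′ , y′ ⟩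
⟨⟩-cong refl refl refl = refl

infix 4 _≟_

_≟_ : DecidableEquality Point
⟨ a , b , y ⟩ ≟ ⟨ a′ , b′ , y′ ⟩ = map′
  (λ { (a≡ , b≡ , y≡) → ⟨⟩-cong a≡ b≡ y≡ }) (λ { refl → refl , refl , refl })
  (a ℚ.≟ a′ ×-dec b ℚ.≟ b′ ×-dec y ℚ.≟ y′)

embed : Point → ℝ^ 2
embed P zero       = fromℚ (rational P) + fromℚ (surd P) * √3/2
embed P (suc zero) = fromℚ (height P)

-- The squared distance is Δa² + ¾ Δb² + Δy² + √3 Δa Δb.

infixr 4 _,_

record Unit (P Q : Point) : Set where
  constructor _,_
  Δa = rational P ℚ.- rational Q
  Δb = surd P ℚ.- surd Q
  Δy = height P ℚ.- height Q
  field
    norm  : Δa ℚ.* Δa ℚ.+ ¾ ℚ.* (Δb ℚ.* Δb) ℚ.+ Δy ℚ.* Δy ≡ 1ℚ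
    mixed : Δa ℚ.* Δb ≡ 0ℚ

Unit-sym : ∀ {P Q} → Unit P Q → Unit Q P
Unit-sym {⟨ a , b , y ⟩} {⟨ a′ , b′ , y′ ⟩} (norm , mixed) =
  trans (flip-norm a a′ b b′ y y′) norm , trans (flip-mixed a a′ b b′) mixed
  where
  open +-*-Solver
  flip-norm : ∀ a a′ b b′ y y′ →
    (a′ ℚ.- a) ℚ.* (a′ ℚ.- a) ℚ.+ ¾ ℚ.* ((b′ ℚ.- b) ℚ.* (b′ ℚ.- b)) ℚ.+ (y′ ℚ.- y) ℚ.* (y′ ℚ.- y) ≡
    (a ℚ.- a′) ℚ.* (a ℚ.- a′) ℚ.+ ¾ ℚ.* ((b ℚ.- b′) ℚ.* (b ℚ.- b′)) ℚ.+ (y ℚ.- y′) ℚ.* (y ℚ.- y′)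
  flip-norm = solve 6 (λ a a′ b b′ y y′ →
    (a′ :- a) :* (a′ :- a) :+ con ¾ :* ((b′ :- b) :* (b′ :- b)) :+ (y′ :- y) :* (y′ :- y) :=
    (a :- a′) :* (a :- a′) :+ con ¾ :* ((b :- b′) :* (b :- b′)) :+ (y :- y′) :* (y :- y′)) refl
  flip-mixed : ∀ a a′ b b′ → (a′ ℚ.- a) ℚ.* (b′ ℚ.- b) ≡ (a ℚ.- a′) ℚ.* (b ℚ.- b′)
  flip-mixed = solve 4 (λ a a′ b b′ → (a′ :- a) :* (b′ :- b) := (a :- a′) :* (b :- b′)) refl

-- At each approximation t of √3 / 2 the squared distance is exactly 1 - ¾D + D t², by `norm` and
-- `mixed`; this is the real `u`. Passing to the limit enters only in replacing t² by ¾.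
Unit⇒Distance : ∀ {P Q} → Unit P Q → Distance (embed P) (embed Q) 1ℝ
Unit⇒Distance {P@(⟨ a , b , y ⟩)} {Q@(⟨ a′ , b′ , y′ ⟩)} (norm , mixed) =
  (λ ε 0<ε → 0 , λ _ _ → ℚ.+-mono-< {0ℚ} {1ℚ} {0ℚ} {ε} 0<1 0<ε) ,
  ≈-trans {1ℝ * 1ℝ} {u} {sum-of-squares}
    (≈-trans {1ℝ * 1ℝ} {fromℚ (1ℚ ℚ.- ¾ ℚ.* D) + fromℚ D * fromℚ ¾} {u}
      (pointwise⇒≈ {1ℝ * 1ℝ} {fromℚ (1ℚ ℚ.- ¾ ℚ.* D) + fromℚ D * fromℚ ¾} (λ _ → collapse ¾ D))
      (+-cong {fromℚ (1ℚ ℚ.- ¾ ℚ.* D)} {fromℚ (1ℚ ℚ.- ¾ ℚ.* D)} {fromℚ D * fromℚ ¾} {fromℚ D *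
        (√3/2 * √3/2)}
        (≈-refl {fromℚ (1ℚ ℚ.- ¾ ℚ.* D)})
        (*-congˡ (fromℚ D) {fromℚ ¾} {√3/2 * √3/2} (≈-sym {√3/2 * √3/2} {fromℚ ¾} √3/2-squared))))
    (pointwise⇒≈ {u} {sum-of-squares} (λ k → sym (begin
      seq sum-of-squares k
        ≡⟨ expand a a′ b b′ y y′ (convergent k) ⟩
      (a ℚ.- a′) ℚ.* (a ℚ.- a′) ℚ.+ ¾ ℚ.* D ℚ.+ (y ℚ.- y′) ℚ.* (y ℚ.- y′) ℚ.- ¾ ℚ.* D ℚ.+
      (D ℚ.* (convergent k ℚ.* convergent k) ℚ.+ fromℕ 2 ℚ.* ((a ℚ.- a′) ℚ.* (b ℚ.- b′)) ℚ.* convergent k)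
        ≡⟨ cong₂ (λ p q → p ℚ.- ¾ ℚ.* D ℚ.+ (D ℚ.*
          (convergent k ℚ.* convergent k) ℚ.+ fromℕ 2 ℚ.* q ℚ.* convergent k)) norm mixed ⟩
      1ℚ ℚ.- ¾ ℚ.* D ℚ.+ (D ℚ.* (convergent k ℚ.* convergent k) ℚ.+ 0ℚ ℚ.* convergent k)
        ≡⟨ cong (λ r → 1ℚ ℚ.- ¾ ℚ.* D ℚ.+ r) (trans
          (cong (D ℚ.* (convergent k ℚ.* convergent k) ℚ.+_) (ℚ.*-zeroˡ (convergent k)))
            (ℚ.+-identityʳ (D ℚ.* (convergent k ℚ.* convergent k)))) ⟩
      seq u k ∎)))
  where
  D : ℚ
  D = (b ℚ.- b′) ℚ.* (b ℚ.- b′)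
  u sum-of-squares : ℝ
  u = fromℚ (1ℚ ℚ.- ¾ ℚ.* D) + fromℚ D * (√3/2 * √3/2)
  sum-of-squares = (embed P zero - embed Q zero) * (embed P zero - embed Q zero) +
    ((embed P (suc zero) - embed Q (suc zero)) * (embed P (suc zero) - embed Q (suc zero)) + 0ℝ)
  open ≡-Reasoning
  open +-*-Solver
  collapse : ∀ c d → 1ℚ ≡ 1ℚ ℚ.- c ℚ.* d ℚ.+ d ℚ.* c
  collapse = solve 2 (λ c d → con 1ℚ := con 1ℚ :- c :* d :+ d :* c) refl
  expand : ∀ a a′ b b′ y y′ t →
    (a ℚ.+ b ℚ.* t ℚ.- (a′ ℚ.+ b′ ℚ.* t)) ℚ.* (a ℚ.+ b ℚ.* t ℚ.- (a′ ℚ.+ b′ ℚ.* t)) ℚ.+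
    ((y ℚ.- y′) ℚ.* (y ℚ.- y′) ℚ.+ 0ℚ) ≡
    (a ℚ.- a′) ℚ.* (a ℚ.- a′) ℚ.+ ¾ ℚ.* ((b ℚ.- b′) ℚ.* (b ℚ.- b′)) ℚ.+ (y ℚ.- y′) ℚ.* (y ℚ.- y′)
    ℚ.- ¾ ℚ.* ((b ℚ.- b′) ℚ.* (b ℚ.- b′)) ℚ.+
    ((b ℚ.- b′) ℚ.* (b ℚ.- b′) ℚ.* (t ℚ.* t) ℚ.+ fromℕ 2 ℚ.* ((a ℚ.- a′) ℚ.* (b ℚ.- b′)) ℚ.* t)
  expand = solve 7 (λ a a′ b b′ y y′ t →
    (a :+ b :* t :- (a′ :+ b′ :* t)) :* (a :+ b :* t :- (a′ :+ b′ :* t)) :+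
    ((y :- y′) :* (y :- y′) :+ con 0ℚ) :=
    (a :- a′) :* (a :- a′) :+ con ¾ :* ((b :- b′) :* (b :- b′)) :+ (y :- y′) :* (y :- y′)
    :- con ¾ :* ((b :- b′) :* (b :- b′)) :+
    ((b :- b′) :* (b :- b′) :* (t :* t) :+ con (fromℕ 2) :* ((a :- a′) :* (b :- b′)) :* t)) refl

p-q≡0⇒p≡q : ∀ {p q} → p ℚ.- q ≡ 0ℚ → p ≡ q
p-q≡0⇒p≡q eq = ∣p-q∣≤0⇒p≡q (ℚ.≤-reflexive (cong ℚ.∣_∣ eq))

p²≡0⇒p≡0 : ∀ {p} → p ℚ.* p ≡ 0ℚ → p ≡ 0ℚ
p²≡0⇒p≡0 {p} p²≡0 with ℚ.<-cmp p 0ℚ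
... | tri≈ _ p≡0 _ = p≡0
... | tri> _ _ 0<p = contradiction (sym p²≡0) (ℚ.<⇒≢ (0<* 0<p 0<p))
... | tri< p<0 _ _ = contradiction (sym p²≡0) (ℚ.<⇒≢
  (ℚ.positive⁻¹ (p ℚ.* p) {{ℚ.neg*neg⇒pos p {{ℚ.negative p<0}} p {{ℚ.negative p<0}}}}))

-- Equal abscissae give Δb · √3 / 2 ≈ - Δa. Squaring removes the surd and leaves the rational
-- equation Δa² = ¾ Δb², which the irrationality of √3 allows only for Δb = 0; then Δa vanishes too.
embed-injective : Injective _≡_ _≋_ embed
embed-injective {⟨ a , b , y ⟩} {⟨ a′ , b′ , y′ ⟩} P≋Q =
  ⟨⟩-cong (p-q≡0⇒p≡q (p²≡0⇒p≡0 Δa²≡0)) (p-q≡0⇒p≡q Δb≡0) (fromℚ-injective (P≋Q (suc zero)))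
  where
  Δa Δb : ℚ
  Δa = a ℚ.- a′
  Δb = b ℚ.- b′
  u v : ℝ
  u = fromℚ Δb * √3/2
  v = fromℚ (ℚ.- Δa)
  open +-*-Solver
  u≈v : u ≈ v
  u≈v ε 0<ε = let N , h = P≋Q zero ε 0<ε in N , λ k N≤k →
    subst (λ r → ℚ.∣ r ∣ ℚ.< ε) (collect a a′ b b′ (convergent k)) (h k N≤k)
    where
    collect : ∀ a a′ b b′ t → (a ℚ.+ b ℚ.* t) ℚ.- (a′ ℚ.+ b′ ℚ.* t) ≡ (b ℚ.- b′) ℚ.* t ℚ.- (ℚ.- (a ℚ.- a′))
    collect = solve 5 (λ a a′ b b′ t → (a :+ b :* t) :- (a′ :+ b′ :* t) := (b :- b′) :* t :-
      (:- (a :- a′))) refl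
  u² v² w : ℝ
  u² = fromℚ (Δb ℚ.* Δb) * (√3/2 * √3/2)
  v² = fromℚ (Δa ℚ.* Δa)
  w  = fromℚ (¾ ℚ.* (Δb ℚ.* Δb))
  squareᵤ : ∀ b t → b ℚ.* t ℚ.* (b ℚ.* t) ≡ b ℚ.* b ℚ.* (t ℚ.* t)
  squareᵤ = solve 2 (λ b t → b :* t :* (b :* t) := b :* b :* (t :* t)) refl
  squareᵥ : ∀ a → a ℚ.* a ≡ (ℚ.- a) ℚ.* (ℚ.- a)
  squareᵥ = solve 1 (λ a → a :* a := (:- a) :* (:- a)) refl
  v²≈w : v² ≈ w
  v²≈w = ≈-trans {v²} {v * v} {w} (pointwise⇒≈ {v²} {v * v} (λ _ → squareᵥ Δa))
    (≈-trans {v * v} {u * u} {w} (*-cong {v} {u} {v} {u} (≈-sym {u} {v} u≈v) (≈-sym {u} {v} u≈v))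
    (≈-trans {u * u} {u²} {w} (pointwise⇒≈ {u * u} {u²} (λ k → squareᵤ Δb (convergent k)))
    (≈-trans {u²} {fromℚ (Δb ℚ.* Δb) * fromℚ ¾} {w}
      (*-congˡ (fromℚ (Δb ℚ.* Δb)) {√3/2 * √3/2} {fromℚ ¾} √3/2-squared)
      (*-comm-≈ (fromℚ (Δb ℚ.* Δb)) (fromℚ ¾)))))
  Δa²≡¾Δb² : Δa ℚ.* Δa ≡ ¾ ℚ.* (Δb ℚ.* Δb)
  Δa²≡¾Δb² = fromℚ-injective v²≈w
  Δb≡0 : Δb ≡ 0ℚ
  Δb≡0 = a²≡¾b²⇒b≡0 Δa Δb Δa²≡¾Δb²
  Δa²≡0 : Δa ℚ.* Δa ≡ 0ℚ
  Δa²≡0 = trans Δa²≡¾Δb² (cong (λ r → ¾ ℚ.* (r ℚ.* r)) Δb≡0)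

-- The rational points of the unit circle, parametrised by the slope k.

spoke : Point → ℕ → Point
spoke ⟨ a , b , y ⟩ k = ⟨ a ℚ.+ (fromℕ 2 ℚ.* c ℚ.- 1ℚ) , b , y ℚ.+ fromℕ 2 ℚ.* fromℕ k ℚ.* c ⟩
  where
  c : ℚ
  c = ℤ.+ 1 ℚ./ suc (k ℕ.* k)

-- With c = 1 / (1 + k²) the offset (2c - 1 , 2kc) is the classical point ((1 - k²) / (1 + k²) , 2k
-- / (1 + k²)). Its squared length exceeds 1 by 4c ((1 + k²) c - 1), which is zero.
spoke-Unit : ∀ P k → Unit P (spoke P k)
spoke-Unit ⟨ a , b , y ⟩ k =
  trans (norm a b y (fromℕ k) c) (trans (cong (λ r → 1ℚ ℚ.+ fromℕ 4 ℚ.* c ℚ.* (r ℚ.- 1ℚ)) cx≡1)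
    (trans (cong (λ r → 1ℚ ℚ.+ r) (ℚ.*-zeroʳ (fromℕ 4 ℚ.* c))) refl)) ,
  mixed a b (a ℚ.+ (fromℕ 2 ℚ.* c ℚ.- 1ℚ))
  where
  c : ℚ
  c = ℤ.+ 1 ℚ./ suc (k ℕ.* k)
  cx≡1 : (1ℚ ℚ.+ fromℕ k ℚ.* fromℕ k) ℚ.* c ≡ 1ℚ
  cx≡1 = trans (cong (λ r → (1ℚ ℚ.+ r) ℚ.* c) (sym (fromℕ-* k k))) (fromℕ*1/n (suc (k ℕ.* k)))
  open +-*-Solver
  norm : ∀ a b y k c → let a′ = a ℚ.+ (fromℕ 2 ℚ.* c ℚ.- 1ℚ); y′ = y ℚ.+ fromℕ 2 ℚ.* k ℚ.* c in
    (a ℚ.- a′) ℚ.* (a ℚ.- a′) ℚ.+ ¾ ℚ.* ((b ℚ.- b) ℚ.* (b ℚ.- b)) ℚ.+ (y ℚ.- y′) ℚ.* (y ℚ.- y′) ≡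
    1ℚ ℚ.+ fromℕ 4 ℚ.* c ℚ.* ((1ℚ ℚ.+ k ℚ.* k) ℚ.* c ℚ.- 1ℚ)
  norm = solve 5 (λ a b y k c → let a′ = a :+ (con (fromℕ 2) :* c :- con 1ℚ); y′ = y :+ con (fromℕ 2) :* k :* c in
    (a :- a′) :* (a :- a′) :+ con ¾ :* ((b :- b) :* (b :- b)) :+ (y :- y′) :* (y :- y′) :=
    con 1ℚ :+ con (fromℕ 4) :* c :* ((con 1ℚ :+ k :* k) :* c :- con 1ℚ)) refl
  mixed : ∀ a b a′ → (a ℚ.- a′) ℚ.* (b ℚ.- b) ≡ 0ℚ
  mixed = solve 3 (λ a b a′ → (a :- a′) :* (b :- b) := con 0ℚ) refl

square-injective : ∀ {j k} → j ℕ.* j ≡ k ℕ.* k → j ≡ k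
square-injective {j} {k} eq with ℕ.<-cmp j k
... | tri< j<k _ _ = contradiction eq (ℕ.<⇒≢ (ℕ.*-mono-< j<k j<k))
... | tri≈ _ j≡k _ = j≡k
... | tri> _ _ k<j = contradiction (sym eq) (ℕ.<⇒≢ (ℕ.*-mono-< k<j k<j))

1/-injective : ∀ m n → (ℤ.+ 1 ℚ./ suc m) ≡ (ℤ.+ 1 ℚ./ suc n) → m ≡ n
1/-injective m n eq = ℕ.suc-injective (fromℕ-injective (begin
  x                          ≡⟨ sym (ℚ.*-identityʳ x) ⟩
  x ℚ.* 1ℚ                   ≡⟨ cong (x ℚ.*_) (sym (fromℕ*1/n (suc n))) ⟩
  x ℚ.* (y ℚ.* 1/y)          ≡⟨ cong (λ r → x ℚ.* (y ℚ.* r)) (sym eq) ⟩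
  x ℚ.* (y ℚ.* 1/x)          ≡⟨ rotate x y 1/x ⟩
  y ℚ.* (x ℚ.* 1/x)          ≡⟨ cong (y ℚ.*_) (fromℕ*1/n (suc m)) ⟩
  y ℚ.* 1ℚ                   ≡⟨ ℚ.*-identityʳ y ⟩
  y                          ∎))
  where
  open ≡-Reasoning
  x y 1/x 1/y : ℚ
  x = fromℕ (suc m)
  y = fromℕ (suc n)
  1/x = ℤ.+ 1 ℚ./ suc m
  1/y = ℤ.+ 1 ℚ./ suc n
  rotate : ∀ a b c → a ℚ.* (b ℚ.* c) ≡ b ℚ.* (a ℚ.* c)
  rotate = solve 3 (λ a b c → a :* (b :* c) := b :* (a :* c)) refl
    where open +-*-Solver

-- The abscissa alone determines c, hence k², hence the natural number k.
spoke-injective : ∀ P {j k} → spoke P j ≡ spoke P k → j ≡ k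
spoke-injective ⟨ a , b , y ⟩ {j} {k} eq = square-injective (1/-injective (j ℕ.* j) (k ℕ.* k)
  (trans (recover a _) (trans (cong (λ r → ½ ℚ.* (r ℚ.- a ℚ.+ 1ℚ)) (cong rational eq))
    (sym (recover a _)))))
  where
  recover : ∀ a c → c ≡ ½ ℚ.* (a ℚ.+ (fromℕ 2 ℚ.* c ℚ.- 1ℚ) ℚ.- a ℚ.+ 1ℚ)
  recover = solve 2 (λ a c → c := con ½ :* (a :+ (con (fromℕ 2) :* c :- con 1ℚ) :- a :+ con 1ℚ)) refl
    where open +-*-Solver

-- If the first `suc (length xs)` values of `g` all occurred in `xs`, two of them would occupy the
-- same place; the search among these values is finite.
∃-avoiding : {g : ℕ → A} → Injective _≡_ _≡_ g → DecidableEquality A → ∀ xs → ∃ λ k → g k ∉ xs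
∃-avoiding {A = A} {g} g-injective _≟′_ xs with Fin.any?
  (λ (k : Fin (suc (length xs))) → ¬? (DecMem._∈?_ _≟′_ (g (toℕ k)) xs))
... | yes (k , g[k]∉xs) = toℕ k , g[k]∉xs
... | no  ¬∃            = contradiction i≡j (Fin.<⇒≢ i<j)
  where
  g∈xs : ∀ k → g (toℕ k) ∈ xs
  g∈xs k with DecMem._∈?_ _≟′_ (g (toℕ k)) xs
  ... | yes g[k]∈xs = g[k]∈xs
  ... | no  g[k]∉xs = contradiction (k , g[k]∉xs) ¬∃
  collision : ∃₂ λ i j → toℕ i ℕ.< toℕ j × Any.index (g∈xs i) ≡ Any.index (g∈xs j)
  collision = Fin.pigeonhole (ℕ.n<1+n (length xs)) (Any.index ∘ g∈xs)
  i j : Fin (suc (length xs))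
  i = proj₁ collision
  j = proj₁ (proj₂ collision)
  i<j : toℕ i ℕ.< toℕ j
  i<j = proj₁ (proj₂ (proj₂ collision))
  i≡j : i ≡ j
  i≡j = Fin.toℕ-injective (g-injective (trans (Any.lookup-index (g∈xs i))
    (trans (cong (List.lookup xs) (proj₂ (proj₂ (proj₂ collision)))) (sym (Any.lookup-index (g∈xs j))))))

-- An m-cycle is drawn as the boundary of a 1 × h rectangle of unit squares when m is even,
-- with one of its vertical sides replaced by two sides of an equilateral triangle when m is odd.

bottom apex top : ℕ → Point
bottom k = ⟨ fromℕ k , 0ℚ , 0ℚ ⟩
apex   k = ⟨ fromℕ k , 1ℚ , ½ ⟩
top    k = ⟨ fromℕ k , 0ℚ , 1ℚ ⟩

-- The walk runs along the bottom and returns along the top, where vertex i stands at abscissa m - 1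
-- - i, so that vertex m - 1 ends above vertex 0. For m = 2i + 1 the middle vertex i is the apex;
-- the last bottom vertex is then i - 1, whence the predecessor.
polygonVertex : ∀ {i m} → Tri (suc (i ℕ.+ i) ℕ.< m) (suc (i ℕ.+ i) ≡ m) (m ℕ.< suc (i ℕ.+ i)) → Point
polygonVertex {i}     (tri< _ _ _) = bottom i
polygonVertex {i}     (tri≈ _ _ _) = apex (ℕ.pred i)
polygonVertex {i} {m} (tri> _ _ _) = top (m ℕ.∸ suc i)

polygon : ℕ → ℕ → Point
polygon m i = polygonVertex {i} {m} (ℕ.<-cmp (suc (i ℕ.+ i)) m)

bottom-apex : ∀ k → Unit (bottom k) (apex k)
bottom-apex k = solve 1 (λ k → (k :- k) :* (k :- k) :+ con (¾ ℚ.* 1ℚ) :+ con (½ ℚ.* ½) := con 1ℚ) refl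
  (fromℕ k) ,
  solve 1 (λ k → (k :- k) :* con (ℚ.- 1ℚ) := con 0ℚ) refl (fromℕ k)
  where open +-*-Solver

apex-top : ∀ k → Unit (apex k) (top k)
apex-top k = solve 1 (λ k → (k :- k) :* (k :- k) :+ con (¾ ℚ.* 1ℚ) :+ con (½ ℚ.* ½) := con 1ℚ) refl
  (fromℕ k) ,
  solve 1 (λ k → (k :- k) :* con 1ℚ := con 0ℚ) refl (fromℕ k)
  where open +-*-Solver

top-bottom : ∀ k → Unit (top k) (bottom k)
top-bottom k = solve 1 (λ k → (k :- k) :* (k :- k) :+ con 0ℚ :+ con 1ℚ := con 1ℚ) refl (fromℕ k) ,
  ℚ.*-zeroʳ (fromℕ k ℚ.- fromℕ k)
  where open +-*-Solver

bottom-bottom : ∀ k → Unit (bottom k) (bottom (suc k))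
bottom-bottom k =
  solve 1 (λ k → (k :- (con 1ℚ :+ k)) :* (k :- (con 1ℚ :+ k)) :+ con 0ℚ :+ con 0ℚ := con 1ℚ) refl
    (fromℕ k) ,
  ℚ.*-zeroʳ (fromℕ k ℚ.- fromℕ (suc k))
  where open +-*-Solver

top-top : ∀ k → Unit (top (suc k)) (top k)
top-top k =
  solve 1 (λ k → ((con 1ℚ :+ k) :- k) :* ((con 1ℚ :+ k) :- k) :+ con 0ℚ :+ con 0ℚ := con 1ℚ) refl
    (fromℕ k) ,
  ℚ.*-zeroʳ (fromℕ (suc k) ℚ.- fromℕ k)
  where open +-*-Solver

polygon-step : ∀ {m i} → suc i ℕ.< m → Unit (polygon m i) (polygon m (suc i))
polygon-step {m} {i} 1+i<m with ℕ.<-cmp (suc (i ℕ.+ i)) m | ℕ.<-cmp (suc (suc i ℕ.+ suc i)) m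
... | tri< _ _ _    | tri< _ _ _   = bottom-bottom i
... | tri< _ _ _    | tri≈ _ _ _   = bottom-apex i
-- The turn of an even polygon: here m = 2i + 2, and the vertex after `bottom i` is `top i`.
... | tri< lt _ _   | tri> _ _ gt  =
  subst (λ k → Unit (bottom i) (top k)) i≡m∸2+i (Unit-sym {top i} {bottom i} (top-bottom i))
  where
  m≡ : 2 ℕ.+ (i ℕ.+ i) ≡ m
  m≡ = ℕ.≤-antisym lt (ℕ.s≤s⁻¹ (subst (suc m ℕ.≤_) (cong (λ k → suc (suc k)) (ℕ.+-suc i i)) gt))
  i≡m∸2+i : i ≡ m ℕ.∸ suc (suc i)
  i≡m∸2+i = trans (sym (ℕ.m+n∸m≡n (2 ℕ.+ i) i)) (cong (ℕ._∸ suc (suc i)) m≡)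
... | tri≈ _ refl _ | tri< lt _ _  = contradiction lt (ℕ.≤⇒≯ (s≤s (ℕ.+-mono-≤ (ℕ.n≤1+n i) (ℕ.n≤1+n i))))
... | tri≈ _ refl _ | tri≈ _ eq _  = contradiction (sym eq)
  (ℕ.<⇒≢ (s≤s (ℕ.+-mono-<-≤ (ℕ.n<1+n i) (ℕ.n≤1+n i))))
-- The turn of an odd polygon: here m = 2i + 1, and the apex is joined to the top vertex at abscissa
-- i - 1.
... | tri≈ _ refl _ | tri> _ _ _   = subst (λ k → Unit (apex (ℕ.pred i)) (top k)) (pred≡ i)
  (apex-top (ℕ.pred i))
  where
  pred≡ : ∀ i → ℕ.pred i ≡ i ℕ.+ i ℕ.∸ suc i
  pred≡ zero    = refl
  pred≡ (suc i) = sym (trans (cong (ℕ._∸ suc i) (ℕ.+-suc i i)) (ℕ.m+n∸m≡n i i))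
... | tri> _ _ gt   | tri< lt _ _  = contradiction
  (ℕ.<-trans gt (ℕ.≤-<-trans (s≤s (ℕ.+-mono-≤ (ℕ.n≤1+n i) (ℕ.n≤1+n i))) lt)) (ℕ.<-irrefl refl)
... | tri> _ _ gt   | tri≈ _ refl _ = contradiction gt (ℕ.≤⇒≯ (s≤s (ℕ.+-mono-≤ (ℕ.n≤1+n i) (ℕ.n≤1+n i))))
... | tri> _ _ _    | tri> _ _ _   =
  subst (λ k → Unit (top k) (top (m ℕ.∸ suc (suc i)))) (sym (ℕ.+-∸-assoc 1 1+i<m))
    (top-top (m ℕ.∸ suc (suc i)))

polygon-close : ∀ {l} → 1 ℕ.≤ l → Unit (polygon (suc l) l) (polygon (suc l) 0)
polygon-close {l} 1≤l with ℕ.<-cmp (suc (l ℕ.+ l)) (suc l) | ℕ.<-cmp 1 (suc l)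
... | tri< lt _ _ | _           = contradiction lt (ℕ.≤⇒≯ (s≤s (ℕ.m≤m+n l l)))
... | tri≈ _ eq _ | _           = contradiction (sym eq) (ℕ.<⇒≢ (s≤s (ℕ.m<m+n l 1≤l)))
... | tri> _ _ _  | tri< _ _ _  = subst (λ k → Unit (top k) (bottom 0)) (sym (ℕ.n∸n≡0 l)) (top-bottom 0)
... | tri> _ _ _  | tri≈ _ eq _ = contradiction (s≤s 1≤l) (ℕ.<-irrefl eq)
... | tri> _ _ _  | tri> _ _ gt = contradiction gt (ℕ.≤⇒≯ (s≤s z≤n))

double-injective : ∀ {i j} → i ℕ.+ i ≡ j ℕ.+ j → i ≡ j
double-injective {i} {j} eq with ℕ.<-cmp i j
... | tri< i<j _ _ = contradiction eq (ℕ.<⇒≢ (ℕ.+-mono-< i<j i<j))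
... | tri≈ _ i≡j _ = i≡j
... | tri> _ _ j<i = contradiction (sym eq) (ℕ.<⇒≢ (ℕ.+-mono-< j<i j<i))

polygon-injective : ∀ {m i j} → i ℕ.< m → j ℕ.< m → polygon m i ≡ polygon m j → i ≡ j
polygon-injective {m} {i} {j} i<m j<m eq with ℕ.<-cmp (suc (i ℕ.+ i)) m | ℕ.<-cmp (suc (j ℕ.+ j)) m
... | tri< _ _ _  | tri< _ _ _   = fromℕ-injective (cong rational eq)
... | tri< _ _ _  | tri≈ _ _ _   = contradiction (cong surd eq) λ()
... | tri< _ _ _  | tri> _ _ _   = contradiction (cong height eq) λ()
... | tri≈ _ _ _  | tri< _ _ _   = contradiction (cong surd eq) λ()
... | tri≈ _ eᵢ _ | tri≈ _ eⱼ _  = double-injective (ℕ.suc-injective (trans eᵢ (sym eⱼ)))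
... | tri≈ _ _ _  | tri> _ _ _   = contradiction (cong surd eq) λ()
... | tri> _ _ _  | tri< _ _ _   = contradiction (cong height eq) λ()
... | tri> _ _ _  | tri≈ _ _ _   = contradiction (cong surd eq) λ()
... | tri> _ _ _  | tri> _ _ _   = ℕ.suc-injective
  (ℕ.∸-cancelˡ-≡ i<m j<m (fromℕ-injective (cong rational eq)))

translate : ℚ → Point → Point
translate q ⟨ a , b , y ⟩ = ⟨ q ℚ.+ a , b , y ⟩

translate-Unit : ∀ q {P Q} → Unit P Q → Unit (translate q P) (translate q Q)
translate-Unit q {⟨ a , b , y ⟩} {⟨ a′ , b′ , y′ ⟩} (norm , mixed) =
  trans (cong (λ r → r ℚ.* r ℚ.+ ¾ ℚ.* ((b ℚ.- b′) ℚ.* (b ℚ.- b′)) ℚ.+ (y ℚ.- y′) ℚ.* (y ℚ.- y′))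
    (cancel q a a′)) norm ,
  trans (cong (ℚ._* (b ℚ.- b′)) (cancel q a a′)) mixed
  where
  cancel : ∀ q a a′ → (q ℚ.+ a) ℚ.- (q ℚ.+ a′) ≡ a ℚ.- a′
  cancel = solve 3 (λ q a a′ → (q :+ a) :- (q :+ a′) := a :- a′) refl
    where open +-*-Solver

q+a-a≡q : ∀ q a → (q ℚ.+ a) ℚ.- a ≡ q
q+a-a≡q = solve 2 (λ q a → (q :+ a) :- a := q) refl
  where open +-*-Solver

translate-injective : ∀ q {P Q} → translate q P ≡ translate q Q → P ≡ Q
translate-injective q {⟨ a , b , y ⟩} {⟨ a′ , b′ , y′ ⟩} eq
  = ⟨⟩-cong (trans (sym (cancel q a)) (trans (cong (ℚ._- q) (cong rational eq)) (cancel q a′)))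
            (cong surd eq) (cong height eq)
  where
  cancel : ∀ q a → (q ℚ.+ a) ℚ.- q ≡ a
  cancel = solve 2 (λ q a → (q :+ a) :- q := a) refl
    where open +-*-Solver

-- A shift can move P onto Q only if it equals the difference of their rational coordinates, so
-- finitely many natural shifts are bad.
∃-translate-avoiding : ∀ (Ps Qs : List Point) → ∃ λ q → ∀ {P Q} → P ∈ Ps → Q ∈ Qs → translate q P ≢ Q
∃-translate-avoiding Ps Qs
  with k , k∉ ← ∃-avoiding {g = fromℕ} fromℕ-injective ℚ._≟_
         (List.cartesianProductWith (λ P Q → rational Q ℚ.- rational P) Ps Qs) =
  fromℕ k , λ {P} {Q} P∈Ps Q∈Qs eq → k∉ (subst (_∈ _)
    (trans (cong (ℚ._- rational P) (sym (cong rational eq))) (q+a-a≡q (fromℕ k) (rational P)))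
    (Mem.∈-cartesianProductWith⁺ (λ P Q → rational Q ℚ.- rational P) P∈Ps Q∈Qs))

-- Lassos with two chords

Edge : ℕ → Set
Edge n = Fin n × Fin n

SameEdge : Edge n → Edge n → Set
SameEdge (a , b) (c , d) = (a ≡ c × b ≡ d) ⊎ (a ≡ d × b ≡ c)

sameEdge? : ∀ (e f : Edge n) → Dec (SameEdge e f)
sameEdge? (a , b) (c , d) = (a Fin.≟ c ×-dec b Fin.≟ d) ⊎-dec (a Fin.≟ d ×-dec b Fin.≟ c)

SameEdge-sym : ∀ {e f : Edge n} → SameEdge e f → SameEdge f e
SameEdge-sym (inj₁ (refl , refl)) = inj₁ (refl , refl)
SameEdge-sym (inj₂ (refl , refl)) = inj₂ (refl , refl)

SameEdge-swap : ∀ {a b : Fin n} {e} → SameEdge (a , b) e → SameEdge (b , a) e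
SameEdge-swap (inj₁ (p , q)) = inj₂ (q , p)
SameEdge-swap (inj₂ (p , q)) = inj₁ (q , p)

adjacent? : ∀ (G : Graph n) i j → Dec (Adjacent G i j)
adjacent? (N ∷ G) zero    zero    = no λ()
adjacent? (N ∷ G) zero    (suc j) = j Subset.∈? N
adjacent? (N ∷ G) (suc i) zero    = i Subset.∈? N
adjacent? (N ∷ G) (suc i) (suc j) = adjacent? G i j

insert : Fin n → Fin n → Graph n → Graph n
insert zero    zero    G       = G
insert zero    (suc j) (N ∷ G) = (N Vec.[ j ]≔ inside) ∷ G
insert (suc i) zero    (N ∷ G) = (N Vec.[ i ]≔ inside) ∷ G
insert (suc i) (suc j) (N ∷ G) = N ∷ insert i j G

∈-insert⁻ : ∀ (N : Subset n) j {k} → k Subset.∈ (N Vec.[ j ]≔ inside) → j ≡ k ⊎ k Subset.∈ N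
∈-insert⁻ (x ∷ N) zero    {zero}  k∈            = inj₁ refl
∈-insert⁻ (x ∷ N) zero    {suc k} (Vec.there k∈) = inj₂ (Vec.there k∈)
∈-insert⁻ (x ∷ N) (suc j) {zero}  Vec.here      = inj₂ Vec.here
∈-insert⁻ (x ∷ N) (suc j) {suc k} (Vec.there k∈) = Sum.map (cong suc) Vec.there (∈-insert⁻ N j k∈)

∣insert∣ : ∀ (N : Subset n) j → j Subset.∉ N → Subset.∣ N Vec.[ j ]≔ inside ∣ ≡ suc Subset.∣ N ∣
∣insert∣ (true  ∷ N) zero    j∉N = contradiction Vec.here j∉N
∣insert∣ (false ∷ N) zero    j∉N = refl
∣insert∣ (true  ∷ N) (suc j) j∉N = cong suc (∣insert∣ N j (j∉N ∘ Vec.there))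
∣insert∣ (false ∷ N) (suc j) j∉N = ∣insert∣ N j (j∉N ∘ Vec.there)

adjacent-insert⁻ : ∀ i j (G : Graph n) a b → Adjacent (insert i j G) a b → SameEdge (i , j) (a , b) ⊎
  Adjacent G a b
adjacent-insert⁻ zero    zero    G       a       b       adj = inj₂ adj
adjacent-insert⁻ zero    (suc j) (N ∷ G) zero    (suc b) adj =
  Sum.map₁ (λ j≡b → inj₁ (refl , cong suc j≡b)) (∈-insert⁻ N j adj)
adjacent-insert⁻ zero    (suc j) (N ∷ G) (suc a) zero    adj =
  Sum.map₁ (λ j≡a → inj₂ (refl , cong suc j≡a)) (∈-insert⁻ N j adj)
adjacent-insert⁻ zero    (suc j) (N ∷ G) (suc a) (suc b) adj = inj₂ adj
adjacent-insert⁻ (suc i) zero    (N ∷ G) zero    (suc b) adj =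
  Sum.map₁ (λ i≡b → inj₂ (cong suc i≡b , refl)) (∈-insert⁻ N i adj)
adjacent-insert⁻ (suc i) zero    (N ∷ G) (suc a) zero    adj =
  Sum.map₁ (λ i≡a → inj₁ (cong suc i≡a , refl)) (∈-insert⁻ N i adj)
adjacent-insert⁻ (suc i) zero    (N ∷ G) (suc a) (suc b) adj = inj₂ adj
adjacent-insert⁻ (suc i) (suc j) (N ∷ G) zero    (suc b) adj = inj₂ adj
adjacent-insert⁻ (suc i) (suc j) (N ∷ G) (suc a) zero    adj = inj₂ adj
adjacent-insert⁻ (suc i) (suc j) (N ∷ G) (suc a) (suc b) adj =
  Sum.map₁ (Sum.map (λ (p , q) → cong suc p , cong suc q) (λ (p , q) → cong suc p , cong suc q))
    (adjacent-insert⁻ i j G a b adj)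

size-insert : ∀ i j (G : Graph n) → i ≢ j → ¬ Adjacent G i j → size (insert i j G) ≡ suc (size G)
size-insert zero    zero    G       i≢j ¬adj = contradiction refl i≢j
size-insert zero    (suc j) (N ∷ G) i≢j ¬adj = cong (ℕ._+ size G) (∣insert∣ N j ¬adj)
size-insert (suc i) zero    (N ∷ G) i≢j ¬adj = cong (ℕ._+ size G) (∣insert∣ N i ¬adj)
size-insert (suc i) (suc j) (N ∷ G) i≢j ¬adj =
  trans (cong (Subset.∣ N ∣ ℕ.+_) (size-insert i j G (i≢j ∘ cong suc) ¬adj)) (ℕ.+-suc Subset.∣ N ∣ (size G))

toGraph : List (Edge n) → Graph n
toGraph {n} []         = ∅ n
toGraph ((i , j) ∷ es) = insert i j (toGraph es)

adjacent-toGraph⁻ : ∀ (es : List (Edge n)) {a b} → Adjacent (toGraph es) a b →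
  Any (λ e → SameEdge e (a , b)) es
adjacent-toGraph⁻ []             {a} {b} adj = contradiction adj (∅-nonAdjacent a b)
adjacent-toGraph⁻ ((i , j) ∷ es) {a} {b} adj with adjacent-insert⁻ i j (toGraph es) a b adj
... | inj₁ same = here same
... | inj₂ adj′ = there (adjacent-toGraph⁻ es adj′)

DistinctEdges : List (Edge n) → Set
DistinctEdges = AllPairs (λ e f → ¬ SameEdge e f)

toGraph-⊑ : ∀ (G : Graph n) {es} → All (uncurry (Adjacent G)) es → toGraph es ⊑ G
toGraph-⊑ G {es} adjs a b adj with e , e∈es , same ← find
  (adjacent-toGraph⁻ es adj) with All.lookup adjs e∈es | same
... | adj′ | inj₁ (refl , refl) = adj′
... | adj′ | inj₂ (refl , refl) = Adjacent-sym G b a adj′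

-- Every insertion really adds an edge: edges of `G` are not loops, and distinctness as unordered
-- pairs means that none is already present.
size-toGraph : ∀ (G : Graph n) {es} → All (uncurry (Adjacent G)) es → DistinctEdges es →
  size (toGraph es) ≡ length es
size-toGraph {n} G []           []               = size-∅ n
size-toGraph G {(i , j) ∷ es} (adj ∷ adjs) (e≠es ∷ distinct) =
  trans (size-insert i j (toGraph es) i≢j ¬adj) (cong suc (size-toGraph G adjs distinct))
  where
  i≢j : i ≢ j
  i≢j refl = Adjacent-irrefl G i adj
  ¬adj : ¬ Adjacent (toGraph es) i j
  ¬adj adj′ = All.All¬⇒¬Any e≠es (Any.map (λ {e} → SameEdge-sym {e = e}) (adjacent-toGraph⁻ es adj′))

-- Paths as lists of vertices

edges : A → List A → List (A × A)
edges x []       = []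
edges x (y ∷ ys) = (x , y) ∷ edges y ys

end : A → List A → A
end x []       = x
end x (y ∷ ys) = end y ys

length-edges : ∀ (x : A) xs → length (edges x xs) ≡ length xs
length-edges x []       = refl
length-edges x (y ∷ ys) = cong suc (length-edges y ys)

end∈ : ∀ (x : A) xs → end x xs ∈ x ∷ xs
end∈ x []       = here refl
end∈ x (y ∷ ys) = there (end∈ y ys)

edges-endpoints : ∀ (x : A) xs → All (λ (a , b) → a ∈ x ∷ xs × b ∈ x ∷ xs) (edges x xs)
edges-endpoints x []       = []
edges-endpoints x (y ∷ ys) = (here refl , there (here refl)) ∷
  All.map (λ (a∈ , b∈) → there a∈ , there b∈) (edges-endpoints y ys)

edges-++ : ∀ (x : A) xs y ys → edges x (xs ++ y ∷ ys) ≡ edges x (xs ∷ʳ y) ++ edges y ys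
edges-++ x []       y ys = refl
edges-++ x (z ∷ xs) y ys = cong ((x , z) ∷_) (edges-++ z xs y ys)

edges-∷ʳ : ∀ (x : A) xs y → edges x (xs ∷ʳ y) ≡ edges x xs ∷ʳ (end x xs , y)
edges-∷ʳ x []       y = refl
edges-∷ʳ x (z ∷ xs) y = cong ((x , z) ∷_) (edges-∷ʳ z xs y)

end-∷ʳ : ∀ (x : A) xs y → end x (xs ∷ʳ y) ≡ y
end-∷ʳ x []       y = refl
end-∷ʳ x (z ∷ xs) y = end-∷ʳ z xs y

Unique-∉ : ∀ {x : A} {xs} → All (x ≢_) xs → x ∉ xs
Unique-∉ x≢xs x∈xs = All.lookup x≢xs x∈xs refl

Unique-++⁻ˡ : ∀ (xs : List A) {ys} → Unique (xs ++ ys) → Unique xs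
Unique-++⁻ˡ []       unique            = []
Unique-++⁻ˡ (x ∷ xs) (x≢ ∷ unique) = All.++⁻ˡ xs x≢ ∷ Unique-++⁻ˡ xs unique

Unique-∷ʳ : ∀ {x : A} {xs} → Unique (x ∷ xs) → Unique (xs ∷ʳ x)
Unique-∷ʳ (x≢ ∷ unique) = Unique.++⁺ unique ([] ∷ []) (λ { (v∈ , here refl) → Unique-∉ x≢ v∈ })

Unique-lookup-injective : ∀ {xs : List A} → Unique xs → ∀ {i j} → List.lookup xs i ≡
  List.lookup xs j → i ≡ j
Unique-lookup-injective (x≢ ∷ unique) {zero}  {zero}  eq = refl
Unique-lookup-injective (x≢ ∷ unique) {zero}  {suc j} eq = contradiction eq (All.lookup x≢ (Mem.∈-lookup j))
Unique-lookup-injective (x≢ ∷ unique) {suc i} {zero}  eq =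
  contradiction (sym eq) (All.lookup x≢ (Mem.∈-lookup i))
Unique-lookup-injective (x≢ ∷ unique) {suc i} {suc j} eq = cong suc (Unique-lookup-injective unique eq)

Unique-length : ∀ {xs : List (Fin n)} → Unique xs → length xs ℕ.≤ n
Unique-length unique = Fin.injective⇒≤ (Unique-lookup-injective unique)

fresh-edge : ∀ {x z y : Fin n} {ys} → x ∉ y ∷ ys → All (λ e → ¬ SameEdge (x , z) e) (edges y ys)
fresh-edge {y = y} {ys} x∉ = All.map
  (λ { (a∈ , b∈) (inj₁ (refl , _)) → x∉ a∈ ; (a∈ , b∈) (inj₂ (refl , _)) → x∉ b∈ }) (edges-endpoints y ys)

edges-distinct : ∀ {x : Fin n} {xs} → Unique (x ∷ xs) → DistinctEdges (edges x xs)
edges-distinct {xs = []}     unique        = []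
edges-distinct {xs = y ∷ ys} (x≢ ∷ unique) = fresh-edge (Unique-∉ x≢) ∷ edges-distinct unique

-- A path meets its first vertex `x` only in its first edge, so an edge at `x` is new as soon as it
-- does not lead to `y`.
chord-fresh : ∀ {x y z : Fin n} {ys} → Unique (x ∷ y ∷ ys) → z ≢ y →
  All (λ e → ¬ SameEdge (x , z) e) (edges x (y ∷ ys))
chord-fresh ((x≢y ∷ x≢ys) ∷ unique) z≢y =
  (λ { (inj₁ (_ , z≡y)) → z≢y z≡y ; (inj₂ (x≡y , _)) → x≢y x≡y }) ∷ fresh-edge (Unique-∉ (x≢y ∷ x≢ys))

-- Counting the lassos

words : List A → ℕ → List (List A)
words as zero    = [] ∷ []
words as (suc k) = List.cartesianProductWith _∷_ as (words as k)

∈-words : ∀ {as : List A} xs → All (_∈ as) xs → xs ∈ words as (length xs)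
∈-words []       []           = here refl
∈-words (x ∷ xs) (x∈ ∷ xs∈) = Mem.∈-cartesianProductWith⁺ _∷_ x∈ (∈-words xs xs∈)

words-length : ∀ (as : List A) k → All (λ xs → length xs ≡ k) (words as k)
words-length as zero    = refl ∷ []
words-length as (suc k) = All.cartesianProductWith⁺ (setoid _) (setoid _) _∷_ as (words as k)
  (λ _ xs∈ → cong suc (All.lookup (words-length as k) xs∈))

length-cartesianProductWith : ∀ {C : Set} (f : A → B → C) xs ys →
  length (List.cartesianProductWith f xs ys) ≡ length xs ℕ.* length ys
length-cartesianProductWith f []       ys = refl
length-cartesianProductWith f (x ∷ xs) ys = trans (List.length-++ (List.map (f x) ys))
  (cong₂ ℕ._+_ (List.length-map (f x) ys) (length-cartesianProductWith f xs ys))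

length-words : ∀ (as : List (Fin n)) k → length (words as k) ≡ length as ℕ.^ k
length-words as zero    = refl
length-words as (suc k) = trans (length-cartesianProductWith _∷_ as (words as k))
  (cong (length as ℕ.*_) (length-words as k))

length-concatMap : ∀ {f : A → List B} {m xs} → All (λ x → length (f x) ≡ m) xs →
  length (List.concatMap f xs) ≡ length xs ℕ.* m
length-concatMap                    []           = refl
length-concatMap {f = f} {xs = x ∷ xs} (eq ∷ eqs) =
  trans (List.length-++ (f x)) (cong₂ ℕ._+_ eq (length-concatMap eqs))

-- `z` and `w` are the far ends of the extra edges at the first and the last vertex of the path.
-- Nothing forces the entries of the word to be distinct, which makes the family a plain product and
-- easy to count.
lasso : List (Fin n) → Fin n → Fin n → Graph n
lasso {n} []   z w = ∅ n
lasso (x ∷ xs) z w = toGraph ((x , z) ∷ (end x xs , w) ∷ edges x xs)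

lassos : ∀ n → ℕ → List (Graph n)
lassos n k = List.concatMap (λ xs → List.cartesianProductWith (lasso xs) xs xs) (words (List.allFin n) k)

length-lassos : ∀ n k → length (lassos n k) ≡ n ℕ.^ k ℕ.* (k ℕ.* k)
length-lassos n k = begin
  length (lassos n k)
    ≡⟨ length-concatMap (All.map (λ {xs} → per-word xs) (words-length (List.allFin n) k)) ⟩
  length (words (List.allFin n) k) ℕ.* (k ℕ.* k) ≡⟨ cong (ℕ._* (k ℕ.* k)) (length-words (List.allFin n) k) ⟩
  length (List.allFin n) ℕ.^ k ℕ.* (k ℕ.* k)
    ≡⟨ cong (λ m → m ℕ.^ k ℕ.* (k ℕ.* k)) (List.length-tabulate {n = n} id) ⟩
  n ℕ.^ k ℕ.* (k ℕ.* k)                          ∎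
  where
  open ≡-Reasoning
  per-word : ∀ (xs : List (Fin n)) → length xs ≡ k →
    length (List.cartesianProductWith (lasso xs) xs xs) ≡ k ℕ.* k
  per-word xs len = trans (length-cartesianProductWith (lasso xs) xs xs) (cong₂ ℕ._*_ len len)

-- A lasso in which edges coincide or degenerate to loops has too few edges and would be too likely.
-- Filtering by `size` removes these, so that every listed graph has probability exactly
-- `p ^ suc k`; the count of lassos remains an upper bound.
obstructions : ∀ n → ℕ → List (Graph n)
obstructions n k = List.filter (λ X → size X ℕ.≟ suc k) (lassos n k)

obstructions-size : ∀ n k → All (λ X → size X ≡ suc k) (obstructions n k)
obstructions-size n k = All.all-filter (λ X → size X ℕ.≟ suc k) (lassos n k)

length-obstructions : ∀ n k → length (obstructions n k) ℕ.≤ n ℕ.^ k ℕ.* (k ℕ.* k)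
length-obstructions n k =
  ℕ.≤-trans (List.length-filter (λ X → size X ℕ.≟ suc k) (lassos n k)) (ℕ.≤-reflexive (length-lassos n k))

Obstructed : Graph n → Set
Obstructed {n} G = ∃₂ λ k X → k ℕ.≤ n × X ∈ obstructions n k × X ⊑ G

-- Placing a graph without obstructions

closedEdges : List A → List (A × A)
closedEdges []       = []
closedEdges (x ∷ xs) = edges x (xs ∷ʳ x)

-- The edge predicate is a parameter so that, besides adjacency, it can record that a given further
-- edge differs from every edge of the cycle; rotation then preserves this too.
record Cyclic (P : Pred (Edge n) _) (R : Pred (Fin n) _) (xs : List (Fin n)) : Set where
  field
    unique      : Unique xs
    edges-P     : All P (closedEdges xs)
    vertices-R  : All R xs

rotate : ∀ {P R x} {xs : List (Fin n)} → Cyclic P R (x ∷ xs) → Cyclic P R (xs ∷ʳ x)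
rotate {xs = []}             c = c
rotate {P = P} {x = x} {y ∷ ys} c = record
  { unique     = Unique-∷ʳ unique
  ; edges-P    = subst (All _) (sym (edges-∷ʳ y (ys ∷ʳ x) y))
      (All.∷ʳ⁺ (All.tail edges-P) (subst (λ v → P (v , y)) (sym (end-∷ʳ y ys x)) (All.head edges-P)))
  ; vertices-R = All.∷ʳ⁺ (All.tail vertices-R) (All.head vertices-R)
  }
  where open Cyclic c

length-∷ʳ : ∀ (xs : List A) x → length (xs ∷ʳ x) ≡ suc (length xs)
length-∷ʳ xs x = trans (List.length-++ xs) (ℕ.+-comm (length xs) 1)

-- An extra edge may leave the cycle at any vertex; rotation makes that vertex the first one, the
-- place where the cycle is later cut open. The length is tracked because cycles must keep at least
-- three vertices.
rotate-to : ∀ {P R} {u : Fin n} as bs → Cyclic P R (as ++ u ∷ bs) →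
  ∃ λ cs → Cyclic P R (u ∷ cs) × suc (length cs) ≡ length (as ++ u ∷ bs)
rotate-to         []       bs c = bs , c , refl
rotate-to {P = P} {R} {u} (a ∷ as) bs c
  with cs , c′ , len ← rotate-to as (bs ∷ʳ a) (subst (Cyclic P R) (List.++-assoc as (u ∷ bs) (a ∷ []))
    (rotate c)) =
  cs , c′ , trans len (trans (cong length (sym (List.++-assoc as (u ∷ bs) (a ∷ []))))
    (length-∷ʳ (as ++ u ∷ bs) a))

module _ (G : Graph n) where

  Adj : Fin n → Fin n → Set
  Adj = Adjacent G

  -- The three freshness hypotheses make all k + 1 edges distinct, which carries the lasso through
  -- the `size` filter. Distinctness of the vertices bounds k by `n`.
  obstructed : ∀ {x xs z w} → Unique (x ∷ xs) → All (uncurry Adj) (edges x xs) →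
    z ∈ x ∷ xs → w ∈ x ∷ xs → Adj x z → Adj (end x xs) w →
    ¬ SameEdge (x , z) (end x xs , w) →
    All (λ e → ¬ SameEdge (x , z) e) (edges x xs) →
    All (λ e → ¬ SameEdge (end x xs , w) e) (edges x xs) →
    Obstructed G
  obstructed {x} {xs} {z} {w} unique linked z∈ w∈ xz ew xz≠ew xz≠ ew≠ =
    length (x ∷ xs) , lasso (x ∷ xs) z w , Unique-length unique ,
    Mem.∈-filter⁺ (λ X → size X ℕ.≟ suc (length (x ∷ xs)))
      (Mem.∈-concatMap⁺ (λ ys → List.cartesianProductWith (lasso ys) ys ys)
        (lose (∈-words (x ∷ xs) (All.tabulate (λ {v} _ → Mem.∈-allFin v)))
              (Mem.∈-cartesianProductWith⁺ (lasso (x ∷ xs)) z∈ w∈)))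
      (trans (size-toGraph G adjs distinct) (cong (2 ℕ.+_) (length-edges x xs))) ,
    toGraph-⊑ G adjs
    where
    adjs : All (uncurry Adj) ((x , z) ∷ (end x xs , w) ∷ edges x xs)
    adjs = xz ∷ ew ∷ linked
    distinct : DistinctEdges ((x , z) ∷ (end x xs , w) ∷ edges x xs)
    distinct = (xz≠ew ∷ xz≠) ∷ ew≠ ∷ edges-distinct unique

  -- Placements of part of the vertices, and their extension

  record Placement (S : List (Fin n)) : Set where
    field
      position  : Fin n → Point
      injective : ∀ {i j} → i ∈ S → j ∈ S → position i ≡ position j → i ≡ j
      unit      : ∀ {i j} → i ∈ S → j ∈ S → Adj i j → Unit (position i) (position j)

  infix 4 _∈?_
  _∈?_ : ∀ (i : Fin n) xs → Dec (i ∈ xs)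
  _∈?_ = DecMem._∈?_ Fin._≟_

  _∖_ : List (Fin n) → List (Fin n) → List (Fin n)
  S ∖ C = List.filter (λ i → ¬? (i ∈? C)) S

  ∖-shorter : ∀ S {C v} → v ∈ S → v ∈ C → length (S ∖ C) ℕ.< length S
  ∖-shorter S {C} v∈S v∈C = List.filter-notAll (λ i → ¬? (i ∈? C)) S (lose v∈S (λ v∉C → v∉C v∈C))

  extend-placement : ∀ {S} C (p : Placement (S ∖ C)) (g : Fin n → Point) → let open Placement p in
    (∀ {i j} → i ∈ C → j ∈ C → g i ≡ g j → i ≡ j) →
    (∀ {i j} → i ∈ C → j ∈ S ∖ C → g i ≢ position j) →
    (∀ {i j} → i ∈ C → j ∈ C → j ∈ S → Adj i j → Unit (g i) (g j)) →
    (∀ {i j} → i ∈ C → j ∈ S ∖ C → Adj i j → Unit (g i) (position j)) →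
    Placement S
  extend-placement {S} C p g g-injective g-avoids g-unit g-unit′ = record
    { position  = λ i → merge (i ∈? C)
    ; injective = λ {i} {j} i∈S j∈S → merge-injective (i ∈? C) (j ∈? C) i∈S j∈S
    ; unit      = λ {i} {j} i∈S j∈S → merge-unit (i ∈? C) (j ∈? C) i∈S j∈S
    }
    where
    open Placement p
    merge : ∀ {i} → Dec (i ∈ C) → Point
    merge {i} (yes _) = g i
    merge {i} (no  _) = position i
    rest : ∀ {i} → i ∈ S → i ∉ C → i ∈ S ∖ C
    rest = Mem.∈-filter⁺ (λ i → ¬? (i ∈? C))
    merge-injective : ∀ {i j} (i∈C? : Dec (i ∈ C)) (j∈C? : Dec (j ∈ C)) → i ∈ S → j ∈ S →
      merge i∈C? ≡ merge j∈C? → i ≡ j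
    merge-injective (yes i∈C) (yes j∈C) i∈S j∈S eq = g-injective i∈C j∈C eq
    merge-injective (yes i∈C) (no  j∉C) i∈S j∈S eq = contradiction eq (g-avoids i∈C (rest j∈S j∉C))
    merge-injective (no  i∉C) (yes j∈C) i∈S j∈S eq = contradiction (sym eq) (g-avoids j∈C (rest i∈S i∉C))
    merge-injective (no  i∉C) (no  j∉C) i∈S j∈S eq = injective (rest i∈S i∉C) (rest j∈S j∉C) eq
    merge-unit : ∀ {i j} (i∈C? : Dec (i ∈ C)) (j∈C? : Dec (j ∈ C)) → i ∈ S → j ∈ S → Adj i j →
      Unit (merge i∈C?) (merge j∈C?)
    merge-unit (yes i∈C) (yes j∈C) i∈S j∈S ij = g-unit i∈C j∈C j∈S ij
    merge-unit (yes i∈C) (no  j∉C) i∈S j∈S ij = g-unit′ i∈C (rest j∈S j∉C) ij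
    merge-unit {i} {j} (no i∉C) (yes j∈C) i∈S j∈S ij =
      Unit-sym {g j} {position i} (g-unit′ j∈C (rest i∈S i∉C) (Adjacent-sym G i j ij))
    merge-unit (no  i∉C) (no  j∉C) i∈S j∈S ij = unit (rest i∈S i∉C) (rest j∈S j∉C) ij

  -- Isolated vertices and leaves are treated alike: `u` is the only candidate for a neighbour. If
  -- `v` has no neighbour in `S`, then `u` may lie outside the placed set, and its position is just
  -- some point to draw a circle around.
  attach-leaf : ∀ {S v u} → (∀ {x} → x ∈ S → Adj v x → x ≡ u) → Placement (S ∖ (v ∷ [])) → Placement S
  attach-leaf {S} {v} {u} leaf p =
    extend-placement (v ∷ []) p (λ _ → spoke (position u) k)
      (λ { (here refl) (here refl) _ → refl })
      (λ _ j∈ eq → avoids (subst (_∈ List.map position (S ∖ (v ∷ []))) (sym eq) (Mem.∈-map⁺ position j∈)))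
      (λ { (here refl) (here refl) _ vv → contradiction vv (Adjacent-irrefl G v) })
      (λ { (here refl) j∈ vj → subst (λ x → Unit (spoke (position u) k) (position x))
             (sym (leaf (proj₁ (Mem.∈-filter⁻ (λ i → ¬? (i ∈? (v ∷ []))) {xs = S} j∈)) vj))
             (Unit-sym {position u} {spoke (position u) k} (spoke-Unit (position u) k)) })
    where
    open Placement p
    free : ∃ λ k → spoke (position u) k ∉ List.map position (S ∖ (v ∷ []))
    free = ∃-avoiding (spoke-injective (position u)) _≟_ (List.map position (S ∖ (v ∷ [])))
    k : ℕ
    k = proj₁ free
    avoids : spoke (position u) k ∉ List.map position (S ∖ (v ∷ []))
    avoids = proj₂ free

  assign : List (Fin n) → (ℕ → Point) → Fin n → Point
  -- A default; `extend-placement` evaluates the assignment only at vertices of the list.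
  assign []       h i = h 0
  assign (c ∷ cs) h i with i Fin.≟ c
  ... | yes _ = h 0
  ... | no  _ = assign cs (h ∘ suc) i

  assign-head : ∀ c cs h → assign (c ∷ cs) h c ≡ h 0
  assign-head c cs h with c Fin.≟ c
  ... | yes _  = refl
  ... | no c≢c = contradiction refl c≢c

  assign-tail : ∀ {c cs i} h → c ∉ cs → i ∈ cs → assign (c ∷ cs) h i ≡ assign cs (h ∘ suc) i
  assign-tail {c} {i = i} h c∉cs i∈cs with i Fin.≟ c
  ... | yes refl = contradiction i∈cs c∉cs
  ... | no  _    = refl

  assign-index : ∀ {cs i} h → i ∈ cs → ∃ λ k → k ℕ.< length cs × assign cs h i ≡ h k
  assign-index {c ∷ cs} {i} h i∈ with i Fin.≟ c
  assign-index h i∈           | yes _  = 0 , s≤s z≤n , refl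
  assign-index h (here i≡c)   | no i≢c = contradiction i≡c i≢c
  assign-index h (there i∈cs) | no _   with k , k< , eq ← assign-index (h ∘ suc) i∈cs = suc k , s≤s k< , eq

  assign-injective : ∀ {cs i j} h → (∀ {k l} → k ℕ.< length cs → l ℕ.< length cs → h k ≡ h l → k ≡ l) →
    i ∈ cs → j ∈ cs → assign cs h i ≡ assign cs h j → i ≡ j
  assign-injective {c ∷ cs} {i} {j} h h-injective i∈ j∈ eq with i Fin.≟ c | j Fin.≟ c
  assign-injective h h-injective i∈           j∈           eq | yes refl | yes refl = refl
  assign-injective h h-injective i∈           (here j≡c)   eq | yes _    | no j≢c   = contradiction j≡c j≢c
  assign-injective h h-injective i∈           (there j∈)   eq | yes _    | no _
    with k , k< , eq′ ← assign-index (h ∘ suc) j∈ =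
      contradiction (h-injective (s≤s z≤n) (s≤s k<) (trans eq eq′)) λ()
  assign-injective h h-injective (here i≡c)   j∈           eq | no i≢c   | _        = contradiction i≡c i≢c
  assign-injective h h-injective (there i∈)   j∈           eq | no _     | yes _
    with k , k< , eq′ ← assign-index (h ∘ suc) i∈ =
      contradiction (h-injective (s≤s k<) (s≤s z≤n) (trans (sym eq′) eq)) λ()
  assign-injective h h-injective (there i∈)   (here j≡c)   eq | no _     | no j≢c   = contradiction j≡c j≢c
  assign-injective h h-injective (there i∈)   (there j∈)   eq | no _     | no _     =
    assign-injective (h ∘ suc) (λ k< l< e → ℕ.suc-injective (h-injective (s≤s k<) (s≤s l<) e)) i∈ j∈ eq

  assign-edges : ∀ {c cs} h → Unique (c ∷ cs) → (∀ {k} → k ℕ.< length cs → Unit (h k) (h (suc k))) →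
    All (λ (i , j) → Unit (assign (c ∷ cs) h i) (assign (c ∷ cs) h j)) (edges c cs)
  assign-edges {c} {[]}     h unique h-unit = []
  assign-edges {c} {d ∷ ds} h (c≢ ∷ unique) h-unit =
    subst₂ Unit (sym (assign-head c (d ∷ ds) h))
      (sym (trans (assign-tail h c∉ (here refl)) (assign-head d ds (h ∘ suc)))) (h-unit (s≤s z≤n)) ∷
    All.zipWith (λ ((i∈ , j∈) , u) → subst₂ Unit (sym (assign-tail h c∉ i∈)) (sym (assign-tail h c∉ j∈)) u)
      (edges-endpoints d ds , assign-edges (h ∘ suc) unique (h-unit ∘ s≤s))
    where
    c∉ : c ∉ d ∷ ds
    c∉ = Unique-∉ c≢

  assign-end : ∀ c cs h → Unique (c ∷ cs) → assign (c ∷ cs) h (end c cs) ≡ h (length cs)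
  assign-end c []       h unique        = assign-head c [] h
  assign-end c (d ∷ ds) h (c≢ ∷ unique) =
    trans (assign-tail h (Unique-∉ c≢) (end∈ d ds)) (assign-end d ds (h ∘ suc) unique)

  -- An edge from the cycle to the rest of `S` would be a cycle edge and hence end on the cycle. So
  -- the polygon has only to avoid the points in use, and a horizontal translation achieves this.
  attach-cycle : ∀ {S c cs} → Unique (c ∷ cs) → 1 ℕ.≤ length cs →
    (∀ {i j} → i ∈ c ∷ cs → j ∈ S → Adj i j → Any (SameEdge (i , j)) (closedEdges (c ∷ cs))) →
    Placement (S ∖ (c ∷ cs)) → Placement S
  attach-cycle {S} {c} {cs} unique 1≤ isolated p =
    extend-placement C p (translate q ∘ assign C (polygon m))
      (λ i∈ j∈ eq → assign-injective (polygon m) polygon-injective i∈ j∈ (translate-injective q eq))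
      (λ i∈ j∈ → avoids (vertex∈ i∈) (Mem.∈-map⁺ position j∈))
      (λ i∈ j∈ j∈S ij → translate-Unit q (edge-unit (isolated i∈ j∈S ij)))
      (λ i∈ j∈ ij → let j∈S , j∉C = Mem.∈-filter⁻ (λ i → ¬? (i ∈? C)) {xs = S} j∈ in
        contradiction (closed-endpoint (isolated i∈ j∈S ij)) j∉C)
    where
    open Placement p
    C : List (Fin n)
    C = c ∷ cs
    m : ℕ
    m = suc (length cs)
    free : ∃ λ q → ∀ {P Q} → P ∈ List.map (polygon m) (List.upTo m) → Q ∈ List.map position (S ∖ C) →
      translate q P ≢ Q
    free = ∃-translate-avoiding (List.map (polygon m) (List.upTo m)) (List.map position (S ∖ C))
    q : ℚ
    q = proj₁ free
    avoids : ∀ {P Q} → P ∈ List.map (polygon m) (List.upTo m) → Q ∈ List.map position (S ∖ C) →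
      translate q P ≢ Q
    avoids = proj₂ free
    vertex∈ : ∀ {i} → i ∈ C → assign C (polygon m) i ∈ List.map (polygon m) (List.upTo m)
    vertex∈ i∈ with k , k< , eq ← assign-index (polygon m) i∈ =
      subst (_∈ List.map (polygon m) (List.upTo m)) (sym eq) (Mem.∈-map⁺ (polygon m) (Mem.∈-upTo⁺ k<))
    closed-endpoints : All (λ (i , j) → i ∈ C × j ∈ C) (closedEdges C)
    closed-endpoints = subst (All _) (sym (edges-∷ʳ c cs c))
      (All.∷ʳ⁺ (edges-endpoints c cs) (end∈ c cs , here refl))
    closed-endpoint : ∀ {i j} → Any (SameEdge (i , j)) (closedEdges C) → j ∈ C
    closed-endpoint same with e , e∈ , same′ ← find same with All.lookup closed-endpoints e∈ | same′
    ... | a∈ , b∈ | inj₁ (refl , refl) = b∈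
    ... | a∈ , b∈ | inj₂ (refl , refl) = a∈
    closed-unit : All (λ (i , j) → Unit (assign C (polygon m) i) (assign C (polygon m) j)) (closedEdges C)
    closed-unit = subst (All _) (sym (edges-∷ʳ c cs c)) (All.∷ʳ⁺
      (assign-edges (polygon m) unique (λ {k} k< → polygon-step {m} {k} (s≤s k<)))
      (subst₂ Unit (sym (assign-end c cs (polygon m) unique)) (sym (assign-head c cs (polygon m)))
        (polygon-close 1≤)))
    edge-unit : ∀ {i j} → Any (SameEdge (i , j)) (closedEdges C) →
      Unit (assign C (polygon m) i) (assign C (polygon m) j)
    edge-unit {i} {j} same with e , e∈ , same′ ← find same with All.lookup closed-unit e∈ | same′
    ... | u | inj₁ (refl , refl) = u
    ... | u | inj₂ (refl , refl) = Unit-sym {assign C (polygon m) j} {assign C (polygon m) i} u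

  -- `branch` expresses minimum degree two inside `S` without counting: whichever vertex a path came
  -- from, it can leave by another edge.
  module Core (S : List (Fin n)) (branch : ∀ {v} → v ∈ S → ∀ u → ∃ λ x → x ∈ S × Adj v x × x ≢ u) where

    record Path (x : Fin n) (xs : List (Fin n)) : Set where
      field
        unique : Unique (x ∷ xs)
        linked : All (uncurry Adj) (edges x xs)
        inside-S : All (_∈ S) (x ∷ xs)

    cons : ∀ {x xs y} → Path x xs → y ∉ x ∷ xs → y ∈ S → Adj x y → Path y (x ∷ xs)
    cons {x} {y = y} p y∉ y∈S xy = record
      { unique   = All.¬Any⇒All¬ _ y∉ ∷ Path.unique p
      ; linked   = Adjacent-sym G x y xy ∷ Path.linked p
      ; inside-S = y∈S ∷ Path.inside-S p
      }

    Chord : Fin n → List (Fin n) → Set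
    Chord x []       = ⊥
    Chord x (y ∷ ys) = ∃ λ z → z ∈ y ∷ ys × z ≢ y × Adj x z

    -- Each round finds a chord at the head or prepends a new vertex. Path vertices are distinct,
    -- hence at most `n`, so the fuel cannot run out. `Q` carries along what is known about the far
    -- end of the path, which never moves.
    grow : ∀ (Q : Fin n → List (Fin n) → Set) → (∀ {x xs y} → Q x xs → y ∉ x ∷ xs → Q y (x ∷ xs)) →
      ∀ fuel {x y ys} → n ℕ.< length (x ∷ y ∷ ys) ℕ.+ fuel → Path x (y ∷ ys) → Q x (y ∷ ys) →
      ∃₂ λ x′ xs′ → Path x′ xs′ × Q x′ xs′ × Chord x′ xs′
    grow Q Q-cons zero {x} {y} {ys} n< p q =
      contradiction (Unique-length (Path.unique p))
        (ℕ.<⇒≱ (subst (n ℕ.<_) (ℕ.+-identityʳ (length (x ∷ y ∷ ys))) n<))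
    grow Q Q-cons (suc fuel) {x} {y} {ys} n< p q
      with z , z∈S , xz , z≢y ← branch (All.head (Path.inside-S p)) y
      with z ∈? (x ∷ y ∷ ys)
    ... | yes (here refl) = contradiction xz (Adjacent-irrefl G x)
    ... | yes (there z∈)  = x , y ∷ ys , p , q , z , z∈ , z≢y , xz
    ... | no  z∉          = grow Q Q-cons fuel (subst (n ℕ.<_) (ℕ.+-suc (length (x ∷ y ∷ ys)) fuel) n<)
                              (cons p z∉ z∈S xz) (Q-cons q z∉)

    record Cycle : Set where
      field
        first    : Fin n
        others   : List (Fin n)
        cyclic   : Cyclic (uncurry Adj) (_∈ S) (first ∷ others)
        2≤length : 2 ℕ.≤ length others

    -- The chord closes the segment from `x` to `z` into a cycle. As `z` is not `y`, the vertex `y`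
    -- lies strictly between them, so there are at least three vertices.
    close-lasso : ∀ {x xs} → Path x xs → Chord x xs → Cycle
    close-lasso {x} {y ∷ ys} p (z , z∈ , z≢y , xz) with Mem.∈-∃++ z∈
    ... | []     , bs , refl = contradiction refl z≢y
    ... | y ∷ as , bs , refl = record
      { first    = x
      ; others   = (y ∷ as) ∷ʳ z
      ; cyclic   = record
        { unique     = Unique-++⁻ˡ (x ∷ (y ∷ as) ∷ʳ z) (subst (Unique ∘ (x ∷_)) split (Path.unique p))
        ; edges-P    = subst (All _) (sym (edges-∷ʳ x ((y ∷ as) ∷ʳ z) x)) (All.∷ʳ⁺
            (All.++⁻ˡ (edges x ((y ∷ as) ∷ʳ z)) (subst (All _) (edges-++ x (y ∷ as) z bs) (Path.linked p)))
            (subst (λ v → Adj v x) (sym (end-∷ʳ x (y ∷ as) z)) (Adjacent-sym G x z xz)))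
        ; vertices-R = All.++⁻ˡ (x ∷ (y ∷ as) ∷ʳ z) (subst (All (_∈ S) ∘ (x ∷_)) split (Path.inside-S p))
        }
      ; 2≤length = s≤s (subst (1 ℕ.≤_) (sym (length-∷ʳ as z)) (s≤s z≤n))
      }
      where
      split : (y ∷ as) ++ z ∷ bs ≡ ((y ∷ as) ∷ʳ z) ++ bs
      split = sym (List.++-assoc (y ∷ as) (z ∷ []) bs)

    find-cycle : ∀ {v} → v ∈ S → Cycle
    find-cycle {v} v∈S
      with y , y∈S , vy , y≢v ← branch v∈S v
      with x , xs , p , _ , chord ← grow (λ _ _ → ⊤) (λ _ _ → tt) n {y} {v} {[]} (s≤s (ℕ.n≤1+n n))
             (cons (record { unique = [] ∷ [] ; linked = [] ; inside-S = v∈S ∷ [] })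
               (λ { (here y≡v) → y≢v y≡v }) y∈S vy) tt =
      close-lasso p chord

    -- Neither end of this chord is x, so a chord at x is a different edge.
    EndChord : Fin n → List (Fin n) → Set
    EndChord x xs = end x xs ∈ xs × ∃ λ w → w ∈ xs × Adj (end x xs) w ×
      All (λ e → ¬ SameEdge (end x xs , w) e) (edges x xs)

    EndChord-cons : ∀ {x xs y} → EndChord x xs → y ∉ x ∷ xs → EndChord y (x ∷ xs)
    EndChord-cons (end∈xs , w , w∈ , ew , ew≠) y∉ = there end∈xs , w , there w∈ , ew ,
      (λ { (inj₁ (refl , _)) → y∉ (there end∈xs) ; (inj₂ (_ , refl)) → y∉ (there w∈) }) ∷ ew≠

    double-lasso : ∀ {x xs} → Path x xs → EndChord x xs → Chord x xs → Obstructed G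
    double-lasso {x} {y ∷ ys} p (end∈ys , w , w∈ , ew , ew≠)
      (z , z∈ , z≢y , xz) with x≢ ∷ _ ← Path.unique p =
      obstructed (Path.unique p) (Path.linked p) (there z∈) (there w∈) xz ew
        (λ { (inj₁ (x≡end , _)) → Unique-∉ x≢ (subst (_∈ y ∷ ys) (sym x≡end) end∈ys)
           ; (inj₂ (x≡w , _)) → Unique-∉ x≢ (subst (_∈ y ∷ ys) (sym x≡w) w∈) })
        (chord-fresh (Path.unique p) z≢y) ew≠

    -- Read backwards, the closing edge is a chord at `u`. With three or more vertices its other end
    -- is not the second vertex `v`, so `chord-fresh` applies.
    closing-fresh : ∀ (u : Fin n) cs → Unique (u ∷ cs) → 2 ℕ.≤ length cs →
      All (λ e → ¬ SameEdge (end u cs , u) e) (edges u cs)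
    closing-fresh u (v ∷ w ∷ ws) unique@(u≢ ∷ (v≢ ∷ _)) _ =
      All.map (λ {e} ≠e same → ≠e (SameEdge-swap {e = e} same)) (chord-fresh unique end≢v)
      where
      end≢v : end w ws ≢ v
      end≢v refl = Unique-∉ v≢ (end∈ w ws)
    closing-fresh u (_ ∷ []) _ (s≤s ())

    -- Cut the cycle at its closing edge, which becomes the chord at the far end of the path. If `y`
    -- is on the cycle, the extra edge is the chord at the head. Otherwise `y` is prepended and the
    -- path is grown until its new head has a chord.
    extra-edge : ∀ {u cs y} → 2 ℕ.≤ length cs →
      Cyclic (λ e → uncurry Adj e × ¬ SameEdge (u , y) e) (_∈ S) (u ∷ cs) →
      y ∈ S → Adj u y → Obstructed G
    extra-edge {u} {cs} {y} 2≤ c y∈S uy with y ∈? (u ∷ cs)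
      | All.∷ʳ⁻ (subst (All _) (edges-∷ʳ u cs u) (Cyclic.edges-P c))
    ... | yes y∈ | es , (cu , uy≠cu) = obstructed unique (All.map proj₁ es) y∈ (here refl) uy cu uy≠cu
      (All.map proj₂ es) (closing-fresh u cs unique 2≤)
      where open Cyclic c
    ... | no  y∉ | es , (cu , uy≠cu) = let
        x , xs , p , q , chord = grow EndChord EndChord-cons n
          {y} {u} {cs} (ℕ.≤-trans (ℕ.m≤n+m (suc n) 1) (s≤s (s≤s (ℕ.m≤n+m n (length cs)))))
          (cons (record { unique = unique ; linked = All.map proj₁ es ; inside-S = vertices-R }) y∉ y∈S uy)
          (end∈ u cs , u , here refl , cu ,
           (λ { (inj₁ (c≡y , _)) → y∉ (subst (_∈ u ∷ cs) c≡y (end∈ u cs)) ; (inj₂ (_ , u≡y)) →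
             y∉ (here (sym u≡y)) }) ∷
           closing-fresh u cs unique 2≤)
      in double-lasso p q chord
      where open Cyclic c

    isolate-or-obstruct : (C : Cycle) → let open Cycle C in
      (∀ {i j} → i ∈ first ∷ others → j ∈ S → Adj i j →
        Any (SameEdge (i , j)) (closedEdges (first ∷ others))) ⊎ Obstructed G
    isolate-or-obstruct C with Any.any? (λ i → Any.any? (λ j → adjacent? G i j ×-dec
        ¬? (Any.any? (sameEdge? (i , j)) (closedEdges (Cycle.first C ∷ Cycle.others C)))) S)
          (Cycle.first C ∷ Cycle.others C)
    ... | no ¬extra = inj₁ λ {i} {j} i∈ j∈ ij →
      case Any.any? (sameEdge? (i , j)) (closedEdges (first ∷ others)) of λ where
        (yes same) → same
        (no ¬same) → contradiction (lose i∈ (lose j∈ (ij , ¬same))) ¬extra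
      where open Cycle C
    ... | yes extra with u , u∈ , extra′ ← find extra with y , y∈S , uy , ¬same ← find extra′ with as ,
      bs , eq ← Mem.∈-∃++ u∈ =
      -- Once `u` comes first, the extra edge sits at the head of the opened cycle; that it differs
      -- from all cycle edges travels in the edge predicate.
      let cs , c , len = rotate-to as bs (subst (Cyclic _ _) eq (record
            { unique     = unique
            ; edges-P    = All.zip (edges-P , All.¬Any⇒All¬ _ ¬same)
            ; vertices-R = vertices-R }))
      in inj₂ (extra-edge (ℕ.s≤s⁻¹ (subst (3 ℕ.≤_) (trans (cong length eq) (sym len))
        (s≤s 2≤length))) c y∈S uy)
      where
      open Cycle C
      open Cyclic cyclic

  place : ∀ S → Acc ℕ._<_ (length S) → Placement S ⊎ Obstructed G
  place [] _ = inj₁ (record { position = λ _ → bottom 0 ; injective = λ () ; unit = λ () })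
  place S@(v ∷ _) (acc rec)
    -- Degree at most one within `S`, phrased as having a single possible neighbour `u`. Its failure
    -- at every vertex unfolds to `branch`.
    with Any.any? (λ v → Fin.any? (λ u → All.all? (λ x → adjacent? G v x →-dec x Fin.≟ u) S)) S
  ... | yes leaf with v , v∈S , u , only-u ← find leaf =
    Sum.map₁ (attach-leaf (λ x∈S → All.lookup only-u x∈S))
      (place (S ∖ (v ∷ [])) (rec (∖-shorter S v∈S (here refl))))
  ... | no ¬leaf = result
    where
    branch : ∀ {v} → v ∈ S → ∀ u → ∃ λ x → x ∈ S × Adj v x × x ≢ u
    branch {v} v∈S u with x , x∈S , ¬→ ← find (All.¬All⇒Any¬ (λ x → adjacent? G v x →-dec x Fin.≟ u) S
      (λ all → ¬leaf (lose v∈S (u , all))))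
      with adjacent? G v x | x Fin.≟ u
    ... | yes vx | no x≢u  = x , x∈S , vx , x≢u
    ... | yes vx | yes x≡u = contradiction (λ _ → x≡u) ¬→
    ... | no ¬vx | _       = contradiction (λ vx → contradiction vx ¬vx) ¬→
    open Core S branch
    C : Cycle
    C = find-cycle (here refl)
    open Cycle C
    open Cyclic cyclic
    result : Placement S ⊎ Obstructed G
    result with isolate-or-obstruct C
    ... | inj₂ obs      = inj₂ obs
    ... | inj₁ isolated = Sum.map₁ (attach-cycle unique (ℕ.≤-trans (s≤s z≤n) 2≤length) isolated)
      (place (S ∖ (first ∷ others)) (rec (∖-shorter S (All.head vertices-R) (here refl))))

  realizable-or-obstructed : Realizable 2 G ⊎ Obstructed G
  realizable-or-obstructed = Sum.map₁ realize (place (List.allFin n) (<-wellFounded _))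
    where
    realize : Placement (List.allFin n) → Realizable 2 G
    realize p = embed ∘ position ,
      (λ {i} {j} eq → injective (Mem.∈-allFin i) (Mem.∈-allFin j) (embed-injective eq)) ,
      (λ i j ij → Unit⇒Distance {position i} {position j} (unit (Mem.∈-allFin i) (Mem.∈-allFin j) ij))
      where open Placement p

-- The expected number of obstructions

-- The nᵏ words absorb k of the k + 1 edge factors, since n p = q. The surplus edge leaves one
-- factor p = q / n, the sole source of decay in n.
∑-obstructions : ∀ n k {q r} → fromℕ n ℚ.* r ≡ 1ℚ → 0ℚ ℚ.≤ q ℚ.* r → let p = q ℚ.* r in
  ∑ (λ X → p ^ size X) (obstructions n k) ℚ.≤ p ℚ.* (fromℕ k ℚ.* fromℕ k ℚ.* q ^ k)
∑-obstructions n k {q} {r} nr≡1 0≤p = begin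
  ∑ (λ X → p ^ size X) (obstructions n k)
    ≡⟨ ∑-const (All.map (cong (p ^_)) (obstructions-size n k)) ⟩
  fromℕ (length (obstructions n k)) ℚ.* p ^ suc k
    ≤⟨ *-mono-≤ˡ (p ^ suc k) (^-nonNeg (suc k) 0≤p) (fromℕ-mono-≤ (length-obstructions n k)) ⟩
  fromℕ (n ℕ.^ k ℕ.* (k ℕ.* k)) ℚ.* (p ℚ.* p ^ k)
    ≡⟨ cong (ℚ._* (p ℚ.* p ^ k)) (trans (fromℕ-* (n ℕ.^ k) (k ℕ.* k))
      (cong₂ ℚ._*_ (fromℕ-^ n k) (fromℕ-* k k))) ⟩
  fromℕ n ^ k ℚ.* (fromℕ k ℚ.* fromℕ k) ℚ.* (p ℚ.* p ^ k)
    ≡⟨ regroup (fromℕ n ^ k) (fromℕ k ℚ.* fromℕ k) p (p ^ k) ⟩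
  p ℚ.* (fromℕ k ℚ.* fromℕ k ℚ.* (fromℕ n ^ k ℚ.* p ^ k))
    ≡⟨ cong (λ s → p ℚ.* (fromℕ k ℚ.* fromℕ k ℚ.* s))
      (trans (sym (^-distrib-* (fromℕ n) p k)) (cong (_^ k) np≡q)) ⟩
  p ℚ.* (fromℕ k ℚ.* fromℕ k ℚ.* q ^ k) ∎
  where
  open ℚ.≤-Reasoning
  open +-*-Solver
  p : ℚ
  p = q ℚ.* r
  regroup : ∀ a b c d → a ℚ.* b ℚ.* (c ℚ.* d) ≡ c ℚ.* (b ℚ.* (a ℚ.* d))
  regroup = solve 4 (λ a b c d → a :* b :* (c :* d) := c :* (b :* (a :* d))) refl
  np≡q : fromℕ n ℚ.* (q ℚ.* r) ≡ q
  np≡q = trans (solve 3 (λ n q r → n :* (q :* r) := q :* (n :* r)) refl (fromℕ n) q r)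
    (trans (cong (q ℚ.*_) nr≡1) (ℚ.*-identityʳ q))

obstructionsBelow : ∀ n → ℕ → List (Graph n)
obstructionsBelow n zero    = []
obstructionsBelow n (suc K) = obstructionsBelow n K ++ obstructions n K

∈-obstructionsBelow : ∀ {n k K X} → k ℕ.< K → X ∈ obstructions n k → X ∈ obstructionsBelow n K
∈-obstructionsBelow {n} {k} {suc K} k<1+K X∈ with k ℕ.≟ K
... | yes refl = Mem.∈-++⁺ʳ (obstructionsBelow n K) X∈
... | no  k≢K  = Mem.∈-++⁺ˡ (∈-obstructionsBelow (ℕ.≤∧≢⇒< (ℕ.s≤s⁻¹ k<1+K) k≢K) X∈)

∑-obstructionsBelow : ∀ n K {q r} → fromℕ n ℚ.* r ≡ 1ℚ → 0ℚ ℚ.≤ q ℚ.* r → let p = q ℚ.* r in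
  ∑ (λ X → p ^ size X) (obstructionsBelow n K) ℚ.≤ p ℚ.* ∑< K (λ k → fromℕ k ℚ.* fromℕ k ℚ.* q ^ k)
∑-obstructionsBelow n zero    {q} {r} nr≡1 0≤p = ℚ.≤-reflexive (sym (ℚ.*-zeroʳ (q ℚ.* r)))
∑-obstructionsBelow n (suc K) {q} {r} nr≡1 0≤p = begin
  ∑ f (obstructionsBelow n K ++ obstructions n K)
    ≡⟨ ∑-++ f (obstructionsBelow n K) (obstructions n K) ⟩
  ∑ f (obstructionsBelow n K) ℚ.+ ∑ f (obstructions n K)
    ≤⟨ ℚ.+-mono-≤ (∑-obstructionsBelow n K {q} nr≡1 0≤p) (∑-obstructions n K {q} nr≡1 0≤p) ⟩
  p ℚ.* ∑< K g ℚ.+ p ℚ.* g K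
    ≡⟨ sym (ℚ.*-distribˡ-+ p (∑< K g) (g K)) ⟩
  p ℚ.* (∑< K g ℚ.+ g K) ∎
  where
  open ℚ.≤-Reasoning
  p : ℚ
  p = q ℚ.* r
  f : Graph n → ℚ
  f X = p ^ size X
  g : ℕ → ℚ
  g k = fromℕ k ℚ.* fromℕ k ℚ.* q ^ k

-- As δ ≤ 1 - q, δ³ may replace (1 - q)³ in the series bound, so one margin serves all `q`. The
-- factor 2 is inherited from that bound, and p ≤ r supplies the rest.
ℙℚ-realizable-bound : ∀ {n q r δ} → 0ℚ ℚ.≤ δ → 0ℚ ℚ.≤ q → q ℚ.+ δ ℚ.≤ 1ℚ → 0ℚ ℚ.≤ r → r ℚ.≤ 1ℚ →
  fromℕ n ℚ.* r ≡ 1ℚ →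
  (realizable? : Decidable (Realizable {n} 2)) →
  ∃ λ E → 1ℚ ℚ.≤ ℙℚ n (q ℚ.* r) realizable? ℚ.+ E × δ ℚ.* δ ℚ.* δ ℚ.* E ℚ.≤ fromℕ 2 ℚ.* r ×
          ℙℚ n (q ℚ.* r) realizable? ℚ.≤ 1ℚ
ℙℚ-realizable-bound {n} {q} {r} {δ} 0≤δ 0≤q q+δ≤1 0≤r r≤1 nr≡1 realizable? =
  E , union-bound 0≤p p≤1 realizable? (obstructionsBelow n (suc n)) obstruct , (begin
    δ ℚ.* δ ℚ.* δ ℚ.* E
      ≤⟨ *-mono-≤ʳ (δ ℚ.* δ ℚ.* δ) (0≤* (0≤* 0≤δ 0≤δ) 0≤δ) (∑-obstructionsBelow n (suc n) {q} nr≡1 0≤p) ⟩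
    δ ℚ.* δ ℚ.* δ ℚ.* (p ℚ.* s)  ≡⟨ swap (δ ℚ.* δ ℚ.* δ) p s ⟩
    p ℚ.* (δ ℚ.* δ ℚ.* δ ℚ.* s)  ≤⟨ *-mono-≤ʳ p 0≤p (*-mono-≤ˡ s 0≤s δ³≤d³) ⟩
    p ℚ.* (d ℚ.* d ℚ.* d ℚ.* s)  ≤⟨ *-mono-≤ʳ p 0≤p (∑k²qᵏ-bound (suc n) 0≤q q≤1) ⟩
    p ℚ.* fromℕ 2                ≤⟨ *-mono-≤ˡ (fromℕ 2) (fromℕ-nonNeg 2) p≤r ⟩
    r ℚ.* fromℕ 2                ≡⟨ ℚ.*-comm r (fromℕ 2) ⟩
    fromℕ 2 ℚ.* r                ∎) ,
  ℙℚ≤1 0≤p p≤1 n realizable?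
  where
  open ℚ.≤-Reasoning
  p d s E : ℚ
  p = q ℚ.* r
  d = 1ℚ ℚ.- q
  s = ∑< (suc n) (λ k → fromℕ k ℚ.* fromℕ k ℚ.* q ^ k)
  E = ∑ (λ X → p ^ size X) (obstructionsBelow n (suc n))
  swap : ∀ a b c → a ℚ.* (b ℚ.* c) ≡ b ℚ.* (a ℚ.* c)
  swap = solve 3 (λ a b c → a :* (b :* c) := b :* (a :* c)) refl
    where open +-*-Solver
  q≤1 : q ℚ.≤ 1ℚ
  q≤1 = ℚ.≤-trans (ℚ.≤-reflexive (sym (ℚ.+-identityʳ q))) (ℚ.≤-trans (ℚ.+-monoʳ-≤ q 0≤δ) q+δ≤1)
  0≤p : 0ℚ ℚ.≤ p
  0≤p = 0≤* 0≤q 0≤r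
  p≤r : p ℚ.≤ r
  p≤r = ℚ.≤-trans (*-mono-≤ˡ r 0≤r q≤1) (ℚ.≤-reflexive (ℚ.*-identityˡ r))
  p≤1 : p ℚ.≤ 1ℚ
  p≤1 = ℚ.≤-trans p≤r r≤1
  0≤d : 0ℚ ℚ.≤ d
  0≤d = p≤q⇒0≤q-p q≤1
  δ≤d : δ ℚ.≤ d
  δ≤d = 0≤q-p⇒p≤q (subst (0ℚ ℚ.≤_) (regroup q δ) (p≤q⇒0≤q-p q+δ≤1))
    where
    regroup : ∀ q δ → 1ℚ ℚ.- (q ℚ.+ δ) ≡ 1ℚ ℚ.- q ℚ.- δ
    regroup = solve 2 (λ q δ → con 1ℚ :- (q :+ δ) := con 1ℚ :- q :- δ) refl
      where open +-*-Solver
  δ³≤d³ : δ ℚ.* δ ℚ.* δ ℚ.≤ d ℚ.* d ℚ.* d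
  δ³≤d³ = ℚ.≤-trans (*-mono-≤ˡ δ 0≤δ (ℚ.≤-trans (*-mono-≤ˡ δ 0≤δ δ≤d) (*-mono-≤ʳ d 0≤d δ≤d)))
    (*-mono-≤ʳ (d ℚ.* d) (0≤* 0≤d 0≤d) δ≤d)
  terms-nonNeg : ∀ K → 0ℚ ℚ.≤ ∑< K (λ k → fromℕ k ℚ.* fromℕ k ℚ.* q ^ k)
  terms-nonNeg zero    = ℚ.≤-refl
  terms-nonNeg (suc K) = 0≤+ (terms-nonNeg K) (0≤* (0≤* (fromℕ-nonNeg K) (fromℕ-nonNeg K)) (^-nonNeg K 0≤q))
  0≤s : 0ℚ ℚ.≤ s
  0≤s = terms-nonNeg (suc n)
  obstruct : ∀ G → ¬ Realizable 2 G → ∃ λ X → X ∈ obstructionsBelow n (suc n) × X ⊑ G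
  obstruct G ¬realizable = Sum.[ (λ realizable → contradiction realizable ¬realizable) ,
    (λ (k , X , k≤n , X∈ , X⊑G) → X , ∈-obstructionsBelow (s≤s k≤n) X∈ , X⊑G) ]′
      (realizable-or-obstructed G)

-- `N` is chosen before `q`, because all approximations of c must share it. Since δ³ E ≤ 2 / n,
-- taking 1 / n below δ³ ε / 2 brings E below ε.
ℙℚ-realizable⟶1 : ∀ {ε δ} → 0ℚ ℚ.< ε → 0ℚ ℚ.< δ → ∃ λ N → ∀ n .{{_ : NonZero n}} → N ℕ.≤ n →
  ∀ {q} → 0ℚ ℚ.≤ q → q ℚ.+ δ ℚ.≤ 1ℚ → (realizable? : Decidable (Realizable {n} 2)) →
  ℚ.∣ ℙℚ n (q ℚ.* (ℤ.+ 1 ℚ./ n)) realizable? ℚ.- 1ℚ ∣ ℚ.< ε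
ℙℚ-realizable⟶1 {ε} {δ} 0<ε 0<δ =
  let N , small = reciprocal-small (half-pos (0<* 0<δ³ 0<ε)) in N , λ n N≤n {q} 0≤q q+δ≤1 realizable? →
  let r = ℤ.+ 1 ℚ./ n
      0<r = 0<1/n n
      E , 1≤ℙ+E , δ³E≤2r , ℙ≤1 = ℙℚ-realizable-bound (ℚ.<⇒≤ 0<δ) 0≤q q+δ≤1 (ℚ.<⇒≤ 0<r) (1/n≤1 n)
        (fromℕ*1/n n) realizable?
      E<ε : E ℚ.< ε
      E<ε = ℚ.*-cancelˡ-<-nonNeg (δ ℚ.* δ ℚ.* δ) {{ℚ.nonNegative (ℚ.<⇒≤ 0<δ³)}} (ℚ.≤-<-trans δ³E≤2r
        (ℚ.<-≤-trans (ℚ.*-monoʳ-<-pos (fromℕ 2) (small n N≤n 0<r (fromℕ*1/n n)))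
          (ℚ.≤-reflexive (double (δ ℚ.* δ ℚ.* δ ℚ.* ε)))))
  in dist<ε (ℙℚ n (q ℚ.* r) realizable?) E 1≤ℙ+E ℙ≤1 E<ε
  where
  open +-*-Solver
  0<δ³ : 0ℚ ℚ.< δ ℚ.* δ ℚ.* δ
  0<δ³ = 0<* (0<* 0<δ 0<δ) 0<δ
  double : ∀ a → fromℕ 2 ℚ.* (½ ℚ.* a) ≡ a
  double = solve 1 (λ a → con (fromℕ 2) :* (con ½ :* a) := a) refl
  1/n≤1 : ∀ n .{{_ : NonZero n}} → ℤ.+ 1 ℚ./ n ℚ.≤ 1ℚ
  1/n≤1 (suc m) = begin
    r                          ≡⟨ sym (ℚ.*-identityˡ r) ⟩
    1ℚ ℚ.* r                   ≤⟨ *-mono-≤ˡ r (ℚ.<⇒≤ (0<1/n (suc m))) (fromℕ-mono-≤ {1} {suc m} (s≤s z≤n)) ⟩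
    fromℕ (suc m) ℚ.* r        ≡⟨ fromℕ*1/n (suc m) ⟩
    1ℚ                         ∎
    where
    open ℚ.≤-Reasoning
    r : ℚ
    r = ℤ.+ 1 ℚ./ suc m
  dist<ε : ∀ P E → 1ℚ ℚ.≤ P ℚ.+ E → P ℚ.≤ 1ℚ → E ℚ.< ε → ℚ.∣ P ℚ.- 1ℚ ∣ ℚ.< ε
  dist<ε P E 1≤P+E P≤1 E<ε = ∣∣<-intro
    (ℚ.≤-<-trans (0≤q-p⇒p≤q (subst (0ℚ ℚ.≤_) (solve 1
      (λ P → con 1ℚ :- P := con 0ℚ :- (P :- con 1ℚ)) refl P) (p≤q⇒0≤q-p P≤1))) 0<ε)
    (ℚ.≤-<-trans (0≤q-p⇒p≤q (subst (0ℚ ℚ.≤_) (solve 2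
      (λ P E → P :+ E :- con 1ℚ := E :- (:- (P :- con 1ℚ))) refl P E) (p≤q⇒0≤q-p 1≤P+E))) E<ε)

-- From rational approximations back to reals

-- A nonnegative real may have negative approximations, for which the weights are not
-- probabilities; its absolute value does not.

0≤x⇒x≈∣x∣ : ∀ {x} → 0ℝ ≤ x → x ≈ ∣ x ∣
0≤x⇒x≈∣x∣ {x} 0≤x ε 0<ε = let N , h = 0≤x (½ ℚ.* ε) (half-pos 0<ε) in N , λ k N≤k → close (seq x k) (h k N≤k)
  where
  close : ∀ p → 0ℚ ℚ.< p ℚ.+ ½ ℚ.* ε → ℚ.∣ p ℚ.- ℚ.∣ p ∣ ∣ ℚ.< ε
  close p 0<p+ε/2 with ℚ.≤-total 0ℚ p
  ... | inj₁ 0≤p = subst (λ r → ℚ.∣ r ∣ ℚ.< ε)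
    (sym (trans (cong (λ r → p ℚ.- r) (ℚ.0≤p⇒∣p∣≡p 0≤p)) (ℚ.+-inverseʳ p))) 0<ε
  ... | inj₂ p≤0 = subst (λ r → ℚ.∣ p ℚ.- r ∣ ℚ.< ε) (sym ∣p∣≡-p) (∣∣<-intro
      (ℚ.≤-<-trans (0≤q-p⇒p≤q (subst (0ℚ ℚ.≤_) (negate p) (0≤+ 0≤-p 0≤-p))) 0<ε)
      (subst₂ ℚ._<_ (drop p) (trans (sum p (½ ℚ.* ε)) (half+half ε))
        (ℚ.+-monoʳ-< (ℚ.- p ℚ.- p) (ℚ.+-mono-< 0<p+ε/2 0<p+ε/2))))
    where
    open +-*-Solver
    0≤-p : 0ℚ ℚ.≤ ℚ.- p
    0≤-p = ℚ.neg-antimono-≤ p≤0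
    ∣p∣≡-p : ℚ.∣ p ∣ ≡ ℚ.- p
    ∣p∣≡-p = trans (sym (ℚ.∣-p∣≡∣p∣ p)) (ℚ.0≤p⇒∣p∣≡p 0≤-p)
    negate : ∀ p → ℚ.- p ℚ.+ ℚ.- p ≡ 0ℚ ℚ.- (p ℚ.- ℚ.- p)
    negate = solve 1 (λ p → (:- p) :+ (:- p) := con 0ℚ :- (p :- (:- p))) refl
    drop : ∀ p → (ℚ.- p ℚ.- p) ℚ.+ (0ℚ ℚ.+ 0ℚ) ≡ ℚ.- (p ℚ.- ℚ.- p)
    drop = solve 1 (λ p → ((:- p) :- p) :+ (con 0ℚ :+ con 0ℚ) := :- (p :- (:- p))) refl
    sum : ∀ p h → (ℚ.- p ℚ.- p) ℚ.+ ((p ℚ.+ h) ℚ.+ (p ℚ.+ h)) ≡ h ℚ.+ h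
    sum = solve 2 (λ p h → ((:- p) :- p) :+ ((p :+ h) :+ (p :+ h)) := h :+ h) refl

-- A nonnegative `p` keeps the margin δ. A negative one lies above - ½, so its absolute value keeps
-- the margin ½.
∣p∣+δ≤1 : ∀ {p δ} → p ℚ.+ δ ℚ.< 1ℚ → 0ℚ ℚ.< p ℚ.+ ½ → ℚ.∣ p ∣ ℚ.+ δ ℚ.⊓ ½ ℚ.≤ 1ℚ
∣p∣+δ≤1 {p} {δ} p+δ<1 0<p+½ with ℚ.∣p∣≡p∨∣p∣≡-p p
... | inj₁ eq = subst (λ r → r ℚ.+ δ ℚ.⊓ ½ ℚ.≤ 1ℚ) (sym eq)
  (ℚ.≤-trans (ℚ.+-monoʳ-≤ p (ℚ.p⊓q≤p δ ½)) (ℚ.<⇒≤ p+δ<1))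
... | inj₂ eq = subst (λ r → r ℚ.+ δ ℚ.⊓ ½ ℚ.≤ 1ℚ) (sym eq) (ℚ.≤-trans (ℚ.+-monoʳ-≤ (ℚ.- p) (ℚ.p⊓q≤q δ ½))
  (0≤q-p⇒p≤q (subst (0ℚ ℚ.≤_) (regroup p) (ℚ.<⇒≤ 0<p+½))))
  where
  regroup : ∀ p → p ℚ.+ ½ ≡ 1ℚ ℚ.- (ℚ.- p ℚ.+ ½)
  regroup = solve 1 (λ p → p :+ con ½ := con 1ℚ :- ((:- p) :+ con ½)) refl
    where open +-*-Solver

theorem5 : (c : ℝ) → 0ℝ ≤ c → c < 1ℝ →
    (realizable? : ∀ n → Decidable (Realizable {n} 2)) →
    (λ n → ℙ n (c / n) (realizable? n)) ⟶ 1ℝ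
theorem5 c 0≤c (δ , 0<δ , K₁ , c+δ<1) realizable? ε (η , 0<η , K₂ , η<ε) =
  -- The room η below ε is split: half is the gap that witnesses the strict inequality, and one
  -- quarter each pays for replacing c by its absolute value and for the distance of the probability
  -- from 1.
  let h              = ½ ℚ.* (½ ℚ.* η)
      0<h            = half-pos (half-pos 0<η)
      K₃ , 0<c+½     = 0≤c ½ (ℚ.positive⁻¹ ½)
      N , ℙ∣c∣-close = ℙℚ-realizable⟶1 0<h 0<δ⊓½
  in N , λ n N≤n →
  -- `K₄` may depend on `n`, being an index into approximating sequences; `N` was fixed beforehand
  -- from ε and c alone.
  let K₄ , ℙ-close = ℙ-cong n {c / n} {∣ c ∣ / n} (c/n≈∣c∣/n n) (realizable? n) h 0<h
  in ½ ℚ.* η , half-pos 0<η , (K₁ ℕ.⊔ K₂) ℕ.⊔ (K₃ ℕ.⊔ K₄) , λ k K≤k →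
  let K₁₂≤k = ℕ.m⊔n≤o⇒m≤o (K₁ ℕ.⊔ K₂) (K₃ ℕ.⊔ K₄) K≤k
      K₃₄≤k = ℕ.m⊔n≤o⇒n≤o (K₁ ℕ.⊔ K₂) (K₃ ℕ.⊔ K₄) K≤k
      c+δ<1ₖ = c+δ<1 k (ℕ.m⊔n≤o⇒m≤o K₁ K₂ K₁₂≤k)
      0<c+½ₖ = 0<c+½ k (ℕ.m⊔n≤o⇒m≤o K₃ K₄ K₃₄≤k)
      P  = seq (ℙ n (c / n) (realizable? n)) k
      P′ = seq (ℙ n (∣ c ∣ / n) (realizable? n)) k
      P′-close : ℚ.∣ P′ ℚ.- 1ℚ ∣ ℚ.< h
      P′-close = subst (λ p → ℚ.∣ p ℚ.- 1ℚ ∣ ℚ.< h) (sym (seq-ℙ n (∣ c ∣ / n) (realizable? n) k))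
        (ℙ∣c∣-close n N≤n (ℚ.0≤∣p∣ (seq c k)) (∣p∣+δ≤1 {seq c k} {δ} c+δ<1ₖ 0<c+½ₖ) (realizable? n))
      P-close : ℚ.∣ P ℚ.- 1ℚ ∣ ℚ.< ½ ℚ.* η
      P-close = subst (ℚ.∣ P ℚ.- 1ℚ ∣ ℚ.<_) (half+half (½ ℚ.* η))
        (dist-triangle P P′ 1ℚ (ℙ-close k (ℕ.m⊔n≤o⇒n≤o K₃ K₄ K₃₄≤k)) P′-close)
  in ℚ.<-trans (ℚ.+-monoˡ-< (½ ℚ.* η) P-close)
       (subst (ℚ._< seq ε k) (trans (ℚ.+-identityˡ η) (sym (half+half η)))
         (η<ε k (ℕ.m⊔n≤o⇒n≤o K₁ K₂ K₁₂≤k)))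
  where
  0<δ⊓½ : 0ℚ ℚ.< δ ℚ.⊓ ½
  0<δ⊓½ with ℚ.≤-total δ ½
  ... | inj₁ δ≤½ = subst (0ℚ ℚ.<_) (sym (ℚ.p≤q⇒p⊓q≡p δ≤½)) 0<δ
  ... | inj₂ ½≤δ = subst (0ℚ ℚ.<_) (sym (ℚ.p≥q⇒p⊓q≡q ½≤δ)) (ℚ.positive⁻¹ ½)
  c/n≈∣c∣/n : ∀ n .{{_ : NonZero n}} → (c / n) ≈ (∣ c ∣ / n)
  c/n≈∣c∣/n n = *-cong {c} {∣ c ∣} {fromℚ (ℤ.+ 1 ℚ./ n)} {fromℚ (ℤ.+ 1 ℚ./ n)}
    (0≤x⇒x≈∣x∣ {c} 0≤c) (≈-refl {fromℚ (ℤ.+ 1 ℚ./ n)})
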